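{- For every integer $k \ge 1$ define $a_k(n)$ by $\sum_{n\ge 0} a_k(n) q^n = \dfrac{f_2^{k-1}}{f_1^{k}}$, where $f_\ell = \prod_{m\ge 1}(1-q^{\ell m})$. Then for all $j\ge 0$ and all $n \ge 0$, \begin{align*} a_{11j+1}(11n+6)&\equiv 0 \pmod{11},\\ a_{11j+4}(11n+10)&\equiv 0 \pmod{11},\\ a_{11j+6}(11n+9)&\equiv 0 \pmod{11},\\ a_{11j+8}(11n+8)&\equiv 0 \pmod{11},\\ a_{11j+11}(11n+1)&\equiv 0 \pmod{11}. \end{align*}
   Context: $a_k(n)$ counts the partitions of $n$ in which even parts come in only one color while odd parts may appear in one of $k$ colors; $f_\ell:=(q^\ell;q^\ell)_\infty=\prod_{m\ge1}(1-q^{\ell m})$, $|q|<1$. -}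

module Defs where

open import Data.Nat as ℕ using (ℕ; zero; suc; _∸_; _≡ᵇ_)
open import Data.Integer using (ℤ; _+_; _*_; _-_; 0ℤ; 1ℤ)
open import Data.Bool using (if_then_else_)
open import Data.List using (List; map; foldr; upTo)

-- Formal power series in q with integer coefficients: n ↦ [q^n].
Series : Set
Series = ℕ → ℤ

δ : ℕ → ℕ → ℤ
δ m n = if m ≡ᵇ n then 1ℤ else 0ℤ

sumTo : ℕ → (ℕ → ℤ) → ℤ
sumTo n g = foldr _+_ 0ℤ (map g (upTo (suc n)))

one : Series
one n = δ 0 n

_⊛_ : Series → Series → Series
(a ⊛ b) n = sumTo n (λ i → a i * b (n ∸ i))

infixl 7 _⊛_

pow : Series → ℕ → Series
pow s zero    = one
pow s (suc k) = s ⊛ pow s k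

prodTo : ℕ → (ℕ → Series) → Series
prodTo zero    F = one
prodTo (suc N) F = F (suc N) ⊛ prodTo N F

oneMinusQ : ℕ → Series
oneMinusQ d n = δ 0 n - δ d n

-- 1/(1 - q^d) = Σ_{j ≥ 0} q^{dj}   (used for d ≥ 1; coefficient of q^n only
-- involves j ≤ n)
geom : ℕ → Series
geom d n = sumTo n (λ j → δ (j ℕ.* d) n)

-- f_ℓ = ∏_{m ≥ 1} (1 - q^{ℓm}).  For ℓ ≥ 1 the coefficient of q^n only
-- depends on the factors with m ≤ n.
f : ℕ → Series
f ℓ n = prodTo n (λ m → oneMinusQ (ℓ ℕ.* m)) n

-- 1/f_ℓ = ∏_{m ≥ 1} 1/(1 - q^{ℓm})  (ℓ ≥ 1)
fInv : ℕ → Series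
fInv ℓ n = prodTo n (λ m → geom (ℓ ℕ.* m)) n

a : ℕ → ℕ → ℤ
a k = pow (f 2) (k ∸ 1) ⊛ pow (fInv 1) k

{-# OPTIONS --safe #-}
-- Work modulo 11 with D = q d/dq.  Eleventh powers are constants of D, so a_{11j+r} may be replaced by the η-product
-- f₁^{11-r} f₂^{r-1}, and the congruence says that (D + e)¹⁰ fixes it, where e is its q-exponent as a product of η's.
-- Put φ = f₁²/f₂, ψ = f₂²/f₁, W = D log φ and S = D log ψ + 1/8.  Expanding the finite Jacobi triple product to second
-- order at z = ∓1 (MacMahon's sums) gives theta series for f₁³ and ψ and the differential equation D(W + S) = 4 W S.
-- By the theta series of f₁³, f₂³, ψ and f₁ the exponents, completed to squares, avoid certain residues modulo 11.
-- Each series is thereby annihilated by a polynomial in D, that is, W and S satisfy four more differential equations.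
-- A combination of these and their derivatives expresses D²S as a polynomial in W, S, DS, so that the differential ring
-- generated by W and S is F₁₁[W, S, DS].  There (D + e)¹⁰ g = (h² + c Dh) g for every product g in question, where h is
-- the constant -1 with (D + 1/8)⁵ f₁³ = h f₁³.
module Submission where

import Algebra.Definitions.RawMonoid as RawMonoidDefinitions
import Algebra.Properties.CommutativeSemiring.Exp as CommutativeSemiringExp
import Algebra.Properties.Ring as RingProperties
import Algebra.Properties.Semiring.Exp as SemiringExp
import Algebra.Properties.Semiring.Mult as SemiringMult
import Data.Integer.Properties as ℤ
import Data.Nat.Divisibility as ℕ
import Data.Nat.DivMod as ℕ
import Data.Nat.Properties as ℕ
import Relation.Binary.Reasoning.Setoid as SetoidReasoning
open import Algebra.Bundles using (CommutativeRing)
open import Algebra.Structures using (IsCommutativeRing)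
open import Data.Bool using (Bool; true; false; _∧_) renaming (T to Holds)
open import Data.Bool.Properties using (∧-conicalˡ; ∧-conicalʳ)
open import Data.Fin using (Fin; zero; suc)
open import Data.Fin.Patterns
open import Data.Integer as ℤ using (ℤ; 0ℤ; 1ℤ)
open import Data.Integer.Divisibility.Signed using (divides; ∣⇒∣ᵤ; ∣ᵤ⇒∣; ∣m∣n⇒∣m+n; ∣m⇒∣m*n; ∣n⇒∣m*n; ∣m⇒∣-m) renaming (_∣_ to _∣ˢ_)
open import Data.Integer.Tactic.RingSolver using (solve-∀)
open import Data.List using (List; []; _∷_; applyUpTo; foldr; map)
open import Data.List.Properties using (map-applyUpTo)
open import Data.List.Relation.Unary.All using (All; []; _∷_)
open import Data.Maybe using (Maybe; just; nothing)
open import Data.Nat as ℕ using (zero; suc; _≤_; _<_; z≤n; s≤s; _≡ᵇ_; _%_; _/_)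
open import Data.Product using (Σ; _,_)
open import Data.Sum using (_⊎_; inj₁; inj₂)
open import Data.Unit using (⊤; tt)
open import Data.Vec using (Vec; []; _∷_; lookup)
open import Function using (id; _∘_)
open import Level using (0ℓ)
open import Relation.Binary.PropositionalEquality as ≡ using (_≡_; _≗_; cong; cong₂; module ≡-Reasoning)
open import Relation.Nullary using (yes; no)
open import Data.Nat using (ℕ)
open import Data.Product using (_×_)


-- Fermat's theorem enters twice: (n + e)¹⁰ is 1 unless n + e vanishes modulo 11, and the fifth
-- power of a square times a constant takes only one nonzero value. The obstacle is that (D + e)¹⁰
-- g, divided by g, is a differential polynomial of order 9 in W and S, so that nothing can be
-- decided by finite computation until the higher derivatives are eliminated. A grading makes this
-- possible. Give W and S weight 1 and let D raise weights by 1. Then D(W + S) = 4 W S is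
-- homogeneous, while each equation from a theta series equates a polynomial of weight 5 with a
-- constant, or one of weight 6 with one of weight 1: a drop of 5. A combination of weight 8 whose
-- top part cancels identically therefore leaves a relation of weight 3, the weight of D²S. The
-- completed exponents 1/8, 1/4 and 1/24 are 7, 3 and 6 modulo 11; only 1/4 is a square, which fixes
-- the signs in the equations.

record DifferentialRing : Set₁ where
  field
    commutativeRing : CommutativeRing 0ℓ 0ℓ
  open CommutativeRing commutativeRing public hiding (zero)
  open SemiringMult semiring public renaming (_×_ to _·_)
  open SemiringExp semiring public
  open RingProperties ring public using (-1*x≈-x)
  field
    char11 : 11 · 1# ≈ 0#
    D      : Carrier → Carrier
    D-cong : ∀ {s t} → s ≈ t → D s ≈ D t
    D-+    : ∀ s t → D (s + t) ≈ D s + D t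
    D-*    : ∀ s t → D (s * t) ≈ D s * t + s * D t

  +-cancel-self : ∀ {s} → s ≈ s + s → s ≈ 0#
  +-cancel-self {s} eq = begin
    s                  ≈⟨ +-identityʳ s ⟨
    s + 0#             ≈⟨ +-congˡ (-‿inverseʳ s) ⟨
    s + (s - s)        ≈⟨ +-assoc s s (- s) ⟨
    s + s - s          ≈⟨ +-congʳ eq ⟨
    s - s              ≈⟨ -‿inverseʳ s ⟩
    0#                 ∎
    where open SetoidReasoning setoid

  D-0 : D 0# ≈ 0#
  D-0 = +-cancel-self (trans (D-cong (sym (+-identityˡ 0#))) (D-+ 0# 0#))

  D-1 : D 1# ≈ 0#
  D-1 = +-cancel-self (trans (D-cong (sym (*-identityˡ 1#)))
    (trans (D-* 1# 1#) (+-cong (*-identityʳ (D 1#)) (*-identityˡ (D 1#)))))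

  D-const : ∀ k → D (k · 1#) ≈ 0#
  D-const zero    = D-0
  D-const (suc k) = trans (D-+ 1# (k · 1#)) (trans (+-cong D-1 (D-const k)) (+-identityˡ 0#))

-- Polynomials over F₁₁ in Horner form, and a decision procedure for identities.

Poly : ℕ → Set
Poly zero    = ℕ
Poly (suc n) = List (Poly n)

constₚ : ∀ {n} → ℕ → Poly n
constₚ {zero}  c = c
constₚ {suc n} c = constₚ c ∷ []

0ₚ : ∀ {n} → Poly n
0ₚ {zero}  = 0
0ₚ {suc n} = []

varₚ : ∀ {n} → Fin n → Poly n
varₚ zero    = 0ₚ ∷ constₚ 1 ∷ []
varₚ (suc i) = varₚ i ∷ []

infixl 6 _+ₚ_
infixl 7 _*ₚ_

_+ₚ_ : ∀ {n} → Poly n → Poly n → Poly n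
_+ₚ_ {zero}  a       b       = a ℕ.+ b
_+ₚ_ {suc n} []      r       = r
_+ₚ_ {suc n} (c ∷ p) []      = c ∷ p
_+ₚ_ {suc n} (c ∷ p) (d ∷ r) = (c +ₚ d) ∷ (p +ₚ r)

_*ₚ_ : ∀ {n} → Poly n → Poly n → Poly n
_*ₚ_ {zero}  a       b = a ℕ.* b
_*ₚ_ {suc n} []      r = []
_*ₚ_ {suc n} (c ∷ p) r = map (c *ₚ_) r +ₚ (0ₚ ∷ (p *ₚ r))

_^ₚ_ : ∀ {n} → Poly n → ℕ → Poly n
p ^ₚ zero  = constₚ 1
p ^ₚ suc k = p *ₚ (p ^ₚ k)

∂ : ∀ {n} → Fin n → Poly n → Poly n
∂ {suc n} zero    []      = []
∂ {suc n} zero    (c ∷ p) = p +ₚ (0ₚ ∷ ∂ {suc n} zero p)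
∂ {suc n} (suc i) p       = map (∂ i) p

-- Coefficients are natural numbers that grow unreduced through the arithmetic, with 10 in the role
-- of -1; only this final test reduces them modulo 11.
isZero : ∀ {n} → Poly n → Bool
isZero {zero}  a       = a % 11 ≡ᵇ 0
isZero {suc n} []      = true
isZero {suc n} (c ∷ p) = isZero c ∧ isZero {suc n} p

isEqual : ∀ {n} → Poly n → Poly n → Bool
isEqual p r = isZero (p +ₚ (constₚ 10 *ₚ r))

infixl 6 _:+_ _:-_
infixl 7 _:*_
infixr 8 _:^_
infix  8 :-_

data Expr (n : ℕ) : Set where
  var  : Fin n → Expr n
  con  : ℕ → Expr n
  -- Separate from `con 1`, which denotes `1# + 0#` and so does not match a literal `1#`.
  :1   : Expr n
  _:+_ : Expr n → Expr n → Expr n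
  _:*_ : Expr n → Expr n → Expr n
  _:-_ : Expr n → Expr n → Expr n
  :-_  : Expr n → Expr n
  _:^_ : Expr n → ℕ → Expr n

normalise : ∀ {n} → Expr n → Poly n
normalise (var i)  = varₚ i
normalise (con c)  = constₚ c
normalise :1       = constₚ 1
normalise (e :+ d) = normalise e +ₚ normalise d
normalise (e :* d) = normalise e *ₚ normalise d
normalise (e :- d) = normalise e +ₚ (constₚ 10 *ₚ normalise d)
normalise (:- e)   = constₚ 10 *ₚ normalise e
normalise (e :^ k) = normalise e ^ₚ k

module Evaluation (𝓡 : DifferentialRing) where
  open DifferentialRing 𝓡
  open SetoidReasoning setoid

  eval : ∀ {n} → Vec Carrier n → Poly n → Carrier
  eval []      a       = a · 1#
  eval (x ∷ ρ) []      = 0#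
  eval (x ∷ ρ) (c ∷ p) = eval ρ c + x * eval (x ∷ ρ) p

  ·1-mod : ∀ a → a · 1# ≈ (a % 11) · 1#
  ·1-mod a = begin
    a · 1#                                      ≡⟨ ≡.cong (_· 1#) (ℕ.m≡m%n+[m/n]*n a 11) ⟩
    (a % 11 ℕ.+ a / 11 ℕ.* 11) · 1#             ≈⟨ ×-homo-+ 1# (a % 11) _ ⟩
    (a % 11) · 1# + (a / 11 ℕ.* 11) · 1#        ≈⟨ +-congˡ (×1-homo-* (a / 11) 11) ⟩
    (a % 11) · 1# + (a / 11) · 1# * (11 · 1#)   ≈⟨ +-congˡ (*-congˡ char11) ⟩
    (a % 11) · 1# + (a / 11) · 1# * 0#          ≈⟨ +-congˡ (zeroʳ _) ⟩
    (a % 11) · 1# + 0#                          ≈⟨ +-identityʳ _ ⟩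
    (a % 11) · 1#                               ∎

  10≈-1 : 10 · 1# ≈ - 1#
  10≈-1 = begin
    10 · 1#                  ≈⟨ +-identityˡ _ ⟨
    0# + 10 · 1#             ≈⟨ +-congʳ (-‿inverseˡ 1#) ⟨
    - 1# + 1# + 10 · 1#      ≈⟨ +-assoc (- 1#) 1# _ ⟩
    - 1# + 11 · 1#           ≈⟨ +-congˡ char11 ⟩
    - 1# + 0#                ≈⟨ +-identityʳ _ ⟩
    - 1#                     ∎

  +-interchange : ∀ a b c d → (a + b) + (c + d) ≈ (a + c) + (b + d)
  +-interchange a b c d = begin
    (a + b) + (c + d)   ≈⟨ +-assoc a b _ ⟩
    a + (b + (c + d))   ≈⟨ +-congˡ (+-assoc b c d) ⟨
    a + (b + c + d)     ≈⟨ +-congˡ (+-congʳ (+-comm b c)) ⟩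
    a + (c + b + d)     ≈⟨ +-congˡ (+-assoc c b d) ⟩
    a + (c + (b + d))   ≈⟨ +-assoc a c _ ⟨
    (a + c) + (b + d)   ∎

  *-swap : ∀ a b c → a * (b * c) ≈ b * (a * c)
  *-swap a b c = trans (sym (*-assoc a b c)) (trans (*-congʳ (*-comm a b)) (*-assoc b a c))

  eval-0 : ∀ {n} (ρ : Vec Carrier n) → eval ρ 0ₚ ≈ 0#
  eval-0 []      = refl
  eval-0 (x ∷ ρ) = refl

  eval-const : ∀ {n} (ρ : Vec Carrier n) c → eval ρ (constₚ c) ≈ c · 1#
  eval-const []      c = refl
  eval-const (x ∷ ρ) c = trans (+-cong (eval-const ρ c) (zeroʳ x)) (+-identityʳ _)

  eval-1 : ∀ {n} (ρ : Vec Carrier n) → eval ρ (constₚ 1) ≈ 1#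
  eval-1 ρ = trans (eval-const ρ 1) (+-identityʳ 1#)

  eval-shift : ∀ {n} x (ρ : Vec Carrier n) p → eval (x ∷ ρ) (0ₚ ∷ p) ≈ x * eval (x ∷ ρ) p
  eval-shift x ρ p = trans (+-congʳ (eval-0 ρ)) (+-identityˡ _)

  eval-var : ∀ {n} (ρ : Vec Carrier n) i → eval ρ (varₚ i) ≈ lookup ρ i
  eval-var (x ∷ ρ) zero    = trans (eval-shift x ρ (constₚ 1)) (trans (*-congˡ (eval-1 (x ∷ ρ))) (*-identityʳ x))
  eval-var (x ∷ ρ) (suc i) = trans (+-cong (eval-var ρ i) (zeroʳ x)) (+-identityʳ _)

  eval-+ : ∀ {n} (ρ : Vec Carrier n) p r → eval ρ (p +ₚ r) ≈ eval ρ p + eval ρ r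
  eval-+ []      a       b       = ×-homo-+ 1# a b
  eval-+ (x ∷ ρ) []      r       = sym (+-identityˡ _)
  eval-+ (x ∷ ρ) (c ∷ p) []      = sym (+-identityʳ _)
  eval-+ (x ∷ ρ) (c ∷ p) (d ∷ r) = begin
    eval ρ (c +ₚ d) + x * eval (x ∷ ρ) (p +ₚ r)
      ≈⟨ +-cong (eval-+ ρ c d) (trans (*-congˡ (eval-+ (x ∷ ρ) p r)) (distribˡ x _ _)) ⟩
    (eval ρ c + eval ρ d) + (x * eval (x ∷ ρ) p + x * eval (x ∷ ρ) r)
      ≈⟨ +-interchange _ _ _ _ ⟩
    eval (x ∷ ρ) (c ∷ p) + eval (x ∷ ρ) (d ∷ r) ∎

  -- Multiplicativity for the coefficients is a hypothesis, which `eval-*` supplies by recursion on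
  -- the number of variables.
  eval-map-* : ∀ {n} x (ρ : Vec Carrier n) (c : Poly n) →
    (∀ d → eval ρ (c *ₚ d) ≈ eval ρ c * eval ρ d) →
    ∀ r → eval (x ∷ ρ) (map (c *ₚ_) r) ≈ eval ρ c * eval (x ∷ ρ) r
  eval-map-* x ρ c hom []      = sym (zeroʳ _)
  eval-map-* x ρ c hom (d ∷ r) = begin
    eval ρ (c *ₚ d) + x * eval (x ∷ ρ) (map (c *ₚ_) r)
      ≈⟨ +-cong (hom d) (*-congˡ (eval-map-* x ρ c hom r)) ⟩
    eval ρ c * eval ρ d + x * (eval ρ c * eval (x ∷ ρ) r)
      ≈⟨ +-congˡ (*-swap x _ _) ⟩
    eval ρ c * eval ρ d + eval ρ c * (x * eval (x ∷ ρ) r)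
      ≈⟨ distribˡ _ _ _ ⟨
    eval ρ c * eval (x ∷ ρ) (d ∷ r) ∎

  eval-* : ∀ {n} (ρ : Vec Carrier n) p r → eval ρ (p *ₚ r) ≈ eval ρ p * eval ρ r
  eval-* []      a       b = ×1-homo-* a b
  eval-* (x ∷ ρ) []      r = sym (zeroˡ _)
  eval-* (x ∷ ρ) (c ∷ p) r = begin
    eval (x ∷ ρ) (map (c *ₚ_) r +ₚ (0ₚ ∷ (p *ₚ r)))
      ≈⟨ eval-+ (x ∷ ρ) (map (c *ₚ_) r) _ ⟩
    eval (x ∷ ρ) (map (c *ₚ_) r) + eval (x ∷ ρ) (0ₚ ∷ (p *ₚ r))
      ≈⟨ +-cong (eval-map-* x ρ c (eval-* ρ c) r) (eval-shift x ρ (p *ₚ r)) ⟩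
    eval ρ c * eval (x ∷ ρ) r + x * eval (x ∷ ρ) (p *ₚ r)
      ≈⟨ +-congˡ (trans (*-congˡ (eval-* (x ∷ ρ) p r)) (sym (*-assoc x _ _))) ⟩
    eval ρ c * eval (x ∷ ρ) r + x * eval (x ∷ ρ) p * eval (x ∷ ρ) r
      ≈⟨ distribʳ _ _ _ ⟨
    eval (x ∷ ρ) (c ∷ p) * eval (x ∷ ρ) r ∎

  eval-neg : ∀ {n} (ρ : Vec Carrier n) p → eval ρ (constₚ 10 *ₚ p) ≈ - eval ρ p
  eval-neg ρ p = begin
    eval ρ (constₚ 10 *ₚ p)           ≈⟨ eval-* ρ (constₚ 10) p ⟩
    eval ρ (constₚ 10) * eval ρ p     ≈⟨ *-congʳ (trans (eval-const ρ 10) 10≈-1) ⟩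
    - 1# * eval ρ p                   ≈⟨ -1*x≈-x _ ⟩
    - eval ρ p                        ∎

  eval-^ : ∀ {n} (ρ : Vec Carrier n) p k → eval ρ (p ^ₚ k) ≈ eval ρ p ^ k
  eval-^ ρ p zero    = eval-1 ρ
  eval-^ ρ p (suc k) = trans (eval-* ρ p (p ^ₚ k)) (*-congˡ (eval-^ ρ p k))

  isZero-sound : ∀ {n} (ρ : Vec Carrier n) p → isZero p ≡ true → eval ρ p ≈ 0#
  isZero-sound []      a       eq = trans (·1-mod a)
    (×-congˡ (ℕ.≡ᵇ⇒≡ (a % 11) 0 (≡.subst Holds (≡.sym eq) tt)))
  isZero-sound (x ∷ ρ) []      eq = refl
  isZero-sound (x ∷ ρ) (c ∷ p) eq = begin
    eval ρ c + x * eval (x ∷ ρ) p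
      ≈⟨ +-cong (isZero-sound ρ c (∧-conicalˡ _ _ eq)) (*-congˡ (isZero-sound (x ∷ ρ) p (∧-conicalʳ (isZero c) _ eq))) ⟩
    0# + x * 0#  ≈⟨ +-identityˡ _ ⟩
    x * 0#       ≈⟨ zeroʳ x ⟩
    0#           ∎

  ≈-from-difference : ∀ {s t} → s - t ≈ 0# → s ≈ t
  ≈-from-difference {s} {t} eq = begin
    s              ≈⟨ +-identityʳ s ⟨
    s + 0#         ≈⟨ +-congˡ (-‿inverseˡ t) ⟨
    s + (- t + t)  ≈⟨ +-assoc s (- t) t ⟨
    s - t + t      ≈⟨ +-congʳ eq ⟩
    0# + t         ≈⟨ +-identityˡ t ⟩
    t              ∎

  isEqual-sound : ∀ {n} (ρ : Vec Carrier n) p r → isEqual p r ≡ true → eval ρ p ≈ eval ρ r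
  isEqual-sound ρ p r eq = ≈-from-difference (begin
    eval ρ p - eval ρ r                       ≈⟨ +-congˡ (eval-neg ρ r) ⟨
    eval ρ p + eval ρ (constₚ 10 *ₚ r)        ≈⟨ eval-+ ρ p _ ⟨
    eval ρ (p +ₚ (constₚ 10 *ₚ r))            ≈⟨ isZero-sound ρ (p +ₚ (constₚ 10 *ₚ r)) eq ⟩
    0#                                        ∎)

  ⟦_⟧ : ∀ {n} → Expr n → Vec Carrier n → Carrier
  ⟦ var i  ⟧ ρ = lookup ρ i
  ⟦ con c  ⟧ ρ = c · 1#
  ⟦ :1     ⟧ ρ = 1#
  ⟦ e :+ d ⟧ ρ = ⟦ e ⟧ ρ + ⟦ d ⟧ ρ
  ⟦ e :* d ⟧ ρ = ⟦ e ⟧ ρ * ⟦ d ⟧ ρ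
  ⟦ e :- d ⟧ ρ = ⟦ e ⟧ ρ - ⟦ d ⟧ ρ
  ⟦ :- e   ⟧ ρ = - ⟦ e ⟧ ρ
  ⟦ e :^ k ⟧ ρ = ⟦ e ⟧ ρ ^ k

  normalise-sound : ∀ {n} (ρ : Vec Carrier n) e → ⟦ e ⟧ ρ ≈ eval ρ (normalise e)
  normalise-sound ρ (var i)  = sym (eval-var ρ i)
  normalise-sound ρ (con c)  = sym (eval-const ρ c)
  normalise-sound ρ :1       = sym (eval-1 ρ)
  normalise-sound ρ (e :+ d) = trans (+-cong (normalise-sound ρ e) (normalise-sound ρ d)) (sym (eval-+ ρ (normalise e) _))
  normalise-sound ρ (e :* d) = trans (*-cong (normalise-sound ρ e) (normalise-sound ρ d)) (sym (eval-* ρ (normalise e) _))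
  normalise-sound ρ (e :- d) = trans (+-cong (normalise-sound ρ e) (trans (-‿cong (normalise-sound ρ d)) (sym (eval-neg ρ (normalise d)))))
    (sym (eval-+ ρ (normalise e) _))
  normalise-sound ρ (:- e)   = trans (-‿cong (normalise-sound ρ e)) (sym (eval-neg ρ (normalise e)))
  normalise-sound ρ (e :^ k) = trans (^-congˡ k (normalise-sound ρ e)) (sym (eval-^ ρ (normalise e) k))

  identity : ∀ {n} (e d : Expr n) → isEqual (normalise e) (normalise d) ≡ true →
    ∀ ρ → ⟦ e ⟧ ρ ≈ ⟦ d ⟧ ρ
  identity e d eq ρ = trans (normalise-sound ρ e)
    (trans (isEqual-sound ρ (normalise e) (normalise d) eq) (sym (normalise-sound ρ d)))

-- Differential polynomials and their consequences, by computation.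

sumₚ : ∀ {n} m → (Fin m → Poly n) → Poly n
sumₚ zero    F = 0ₚ
sumₚ (suc m) F = F zero +ₚ sumₚ m (λ i → F (suc i))

-- Derivatives of the variables; nothing marks a variable whose derivative is not available.
Rule : ℕ → Set
Rule n = Vec (Maybe (Poly n)) n

chain : ∀ {n} → Maybe (Poly n) → Poly n → Poly n
chain nothing  p = 0ₚ
chain (just d) p = p *ₚ d

Dₚ : ∀ {n} → Rule n → Poly n → Poly n
Dₚ {n} δs p = sumₚ n (λ i → chain (lookup δs i) (∂ i p))

-- A variable without a known derivative is harmless in the chain rule as long as the partial
-- derivative by it is zero modulo 11.
admissible : ∀ {n} → Maybe (Poly n) → Poly n → Bool
admissible nothing  p = isZero p
admissible (just d) p = true

allFin : ∀ m → (Fin m → Bool) → Bool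
allFin zero    F = true
allFin (suc m) F = F zero ∧ allFin m (λ i → F (suc i))

allFin-sound : ∀ m (F : Fin m → Bool) → allFin m F ≡ true → ∀ i → F i ≡ true
allFin-sound (suc m) F eq zero    = ∧-conicalˡ _ _ eq
allFin-sound (suc m) F eq (suc i) = allFin-sound m (λ j → F (suc j)) (∧-conicalʳ (F zero) _ eq) i

differentiable : ∀ {n} → Rule n → Poly n → Bool
differentiable {n} δs p = allFin n (λ i → admissible (lookup δs i) (∂ i p))

-- The clause for a single multiplier stops before differentiating again: at weight 8 the next
-- derivative could involve D⁸S, for which `jetRule` has no variable.
combination : ∀ {n} → Rule n → List (Expr n) → Poly n → Poly n
combination δs []       r = 0ₚ
combination δs (c ∷ []) r = normalise c *ₚ r
combination δs (c ∷ cs@(_ ∷ _)) r = (normalise c *ₚ r) +ₚ combination δs cs (Dₚ δs r)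

combinable : ∀ {n} → Rule n → List (Expr n) → Poly n → Bool
combinable δs []       r = true
combinable δs (c ∷ []) r = true
combinable δs (c ∷ cs@(_ ∷ _)) r = differentiable δs r ∧ combinable δs cs (Dₚ δs r)

transformStep : ∀ {n} → Rule n → Poly n → Poly n → Poly n
transformStep δs l t = Dₚ δs t +ₚ (l *ₚ t)

-- (D + e)^k g = transform δs l k * g whenever (D + e) g = l * g.
transform : ∀ {n} → Rule n → Poly n → ℕ → Poly n
transform δs l zero    = constₚ 1
transform δs l (suc k) = transformStep δs l (transform δs l k)

transformable : ∀ {n} → Rule n → Poly n → ℕ → Bool
transformable δs l zero    = true
transformable δs l (suc k) = transformable δs l k ∧ differentiable δs (transform δs l k)

-- The equation (D + e)^k g + c (D + e)^k′ g = 0 for a unit g with (D + e) g = l * g, together with the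
-- multipliers of its derivatives in a linear combination.
record Equation (n : ℕ) : Set where
  constructor equation
  field
    shift       : ℕ
    logDeriv    : Poly n
    k k′ c      : ℕ
    multipliers : List (Expr n)

  residue : Rule n → Poly n
  residue δs = transform δs logDeriv k +ₚ (constₚ c *ₚ transform δs logDeriv k′)

  usable : Rule n → Bool
  usable δs = transformable δs logDeriv k ∧ transformable δs logDeriv k′ ∧ combinable δs multipliers (residue δs)

combinations : ∀ {n} → Rule n → List (Equation n) → Poly n
combinations δs []       = 0ₚ
combinations δs (E ∷ Es) = combination δs (Equation.multipliers E) (Equation.residue E δs) +ₚ combinations δs Es

allUsable : ∀ {n} → Rule n → List (Equation n) → Bool
allUsable δs []       = true
allUsable δs (E ∷ Es) = Equation.usable E δs ∧ allUsable δs Es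

-- A record, because comparing its parameters is cheap while comparing the Boolean computations is not.
record Derivation {n} (δs : Rule n) (p r : Poly n) (Es : List (Equation n)) : Set where
  constructor derivation
  field
    usable : allUsable δs Es ≡ true
    equal  : isEqual p (r +ₚ combinations δs Es) ≡ true

-- The multiplier `c` can be found by undetermined coefficients: `transform δs l 10` has weight 10,
-- `transform δs j 5` has weight 5 and its derivative weight 6, so `c` is a combination of the
-- monomials of weight 4 in W, S and DS.
record Quotient {n} (δs : Rule n) (j l c : Poly n) : Set where
  constructor quotient
  field
    transformable₅  : transformable δs j 5 ≡ true
    differentiable₅ : differentiable δs (transform δs j 5) ≡ true
    transformable₁₀ : transformable δs l 10 ≡ true
    equal           : isEqual (transform δs l 10)
      ((transform δs j 5 *ₚ transform δs j 5) +ₚ (c *ₚ Dₚ δs (transform δs j 5))) ≡ true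

module Differentiation (𝓡 : DifferentialRing) where
  open DifferentialRing 𝓡
  open Evaluation 𝓡
  open SetoidReasoning setoid

  Σᶠ : ∀ m → (Fin m → Carrier) → Carrier
  Σᶠ zero    F = 0#
  Σᶠ (suc m) F = F zero + Σᶠ m (λ i → F (suc i))

  Σᶠ-cong : ∀ m {F G : Fin m → Carrier} → (∀ i → F i ≈ G i) → Σᶠ m F ≈ Σᶠ m G
  Σᶠ-cong zero    eq = refl
  Σᶠ-cong (suc m) eq = +-cong (eq zero) (Σᶠ-cong m (λ i → eq (suc i)))

  Σᶠ-0 : ∀ m {F : Fin m → Carrier} → (∀ i → F i ≈ 0#) → Σᶠ m F ≈ 0#
  Σᶠ-0 zero    eq = refl
  Σᶠ-0 (suc m) eq = trans (+-cong (eq zero) (Σᶠ-0 m (λ i → eq (suc i)))) (+-identityˡ 0#)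

  Σᶠ-linear : ∀ m x (F G : Fin m → Carrier) → Σᶠ m (λ i → F i + x * G i) ≈ Σᶠ m F + x * Σᶠ m G
  Σᶠ-linear zero    x F G = sym (trans (+-identityˡ _) (zeroʳ x))
  Σᶠ-linear (suc m) x F G = begin
    (F zero + x * G zero) + Σᶠ m (λ i → F (suc i) + x * G (suc i))
      ≈⟨ +-congˡ (Σᶠ-linear m x (λ i → F (suc i)) (λ i → G (suc i))) ⟩
    (F zero + x * G zero) + (Σᶠ m (λ i → F (suc i)) + x * Σᶠ m (λ i → G (suc i)))
      ≈⟨ +-interchange _ _ _ _ ⟩
    Σᶠ (suc m) F + (x * G zero + x * Σᶠ m (λ i → G (suc i)))
      ≈⟨ +-congˡ (distribˡ x _ _) ⟨
    Σᶠ (suc m) F + x * Σᶠ (suc m) G ∎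

  eval-Σ : ∀ {n} (ρ : Vec Carrier n) m (F : Fin m → Poly n) → eval ρ (sumₚ m F) ≈ Σᶠ m (λ i → eval ρ (F i))
  eval-Σ ρ zero    F = eval-0 ρ
  eval-Σ ρ (suc m) F = trans (eval-+ ρ (F zero) _) (+-congˡ (eval-Σ ρ m (λ i → F (suc i))))

  gradient : ∀ {n} → Vec Carrier n → Poly n → Carrier
  gradient {n} ρ p = Σᶠ n (λ i → eval ρ (∂ i p) * D (lookup ρ i))

  D-eval : ∀ {n} (ρ : Vec Carrier n) p → D (eval ρ p) ≈ gradient ρ p
  D-eval []          a       = D-const a
  D-eval {suc n} (x ∷ ρ) []  = trans D-0 (sym (Σᶠ-0 (suc n) vanish))
    where
    vanish : ∀ i → eval (x ∷ ρ) (∂ {suc n} i []) * D (lookup (x ∷ ρ) i) ≈ 0#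
    vanish zero    = zeroˡ _
    vanish (suc i) = zeroˡ _
  D-eval {suc n} (x ∷ ρ) (c ∷ p) = begin
    D (eval ρ c + x * P)
      ≈⟨ trans (D-+ _ _) (+-cong (D-eval ρ c) (D-* x P)) ⟩
    Σᶠ n C + (D x * P + x * D P)
      ≈⟨ +-congˡ (+-cong (*-comm (D x) P) (*-congˡ (D-eval (x ∷ ρ) p))) ⟩
    Σᶠ n C + (P * D x + x * (P′ * D x + Σᶠ n G))
      ≈⟨ +-congˡ (+-congˡ (distribˡ x _ _)) ⟩
    Σᶠ n C + (P * D x + (x * (P′ * D x) + x * Σᶠ n G))
      ≈⟨ +-congˡ (+-assoc (P * D x) _ _) ⟨
    Σᶠ n C + ((P * D x + x * (P′ * D x)) + x * Σᶠ n G)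
      ≈⟨ trans (+-congˡ (+-comm _ _)) (trans (sym (+-assoc _ _ _)) (+-comm _ _)) ⟩
    (P * D x + x * (P′ * D x)) + (Σᶠ n C + x * Σᶠ n G)
      ≈⟨ +-cong (trans (+-congˡ (sym (*-assoc x P′ (D x)))) (sym (distribʳ (D x) P (x * P′)))) (sym (Σᶠ-linear n x C G)) ⟩
    (P + x * P′) * D x + Σᶠ n (λ i → C i + x * G i)
      ≈⟨ +-cong (*-congʳ (sym (trans (eval-+ (x ∷ ρ) p _) (+-congˡ (eval-shift x ρ (∂ zero p)))))) (Σᶠ-cong n inner) ⟩
    gradient (x ∷ ρ) (c ∷ p) ∎
    where
    P  = eval (x ∷ ρ) p
    P′ = eval (x ∷ ρ) (∂ zero p)
    C G : Fin n → Carrier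
    C i = eval ρ (∂ i c) * D (lookup ρ i)
    G i = eval (x ∷ ρ) (map (∂ i) p) * D (lookup ρ i)
    inner : ∀ i → C i + x * G i ≈ eval (x ∷ ρ) (map (∂ i) (c ∷ p)) * D (lookup ρ i)
    inner i = trans (+-congˡ (sym (*-assoc x _ _))) (sym (distribʳ _ _ _))

  Derives : Maybe Carrier → Carrier → Set
  Derives nothing  s = ⊤
  Derives (just t) s = D s ≈ t

  Obeys : ∀ {n} → Rule n → Vec Carrier n → Set
  Obeys δs ρ = ∀ i → Derives (Data.Maybe.map (eval ρ) (lookup δs i)) (lookup ρ i)

  module _ {n} (δs : Rule n) (ρ : Vec Carrier n) (obeys : Obeys δs ρ) where

    eval-chain : ∀ δ s p → Derives (Data.Maybe.map (eval ρ) δ) s → admissible δ p ≡ true →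
      eval ρ p * D s ≈ eval ρ (chain δ p)
    eval-chain nothing  s p _  ok = trans (*-congʳ (isZero-sound ρ p ok)) (trans (zeroˡ _) (sym (eval-0 ρ)))
    eval-chain (just d) s p eq ok = trans (*-congˡ eq) (sym (eval-* ρ p d))

    Dₚ-sound : ∀ p → differentiable δs p ≡ true → D (eval ρ p) ≈ eval ρ (Dₚ δs p)
    Dₚ-sound p ok = begin
      D (eval ρ p)   ≈⟨ D-eval ρ p ⟩
      gradient ρ p
        ≈⟨ Σᶠ-cong n (λ i → eval-chain (lookup δs i) _ (∂ i p) (obeys i) (allFin-sound n _ ok i)) ⟩
      Σᶠ n (λ i → eval ρ (chain (lookup δs i) (∂ i p)))   ≈⟨ eval-Σ ρ n _ ⟨
      eval ρ (Dₚ δs p)   ∎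

    combination-vanishes : ∀ cs r → combinable δs cs r ≡ true → eval ρ r ≈ 0# →
      eval ρ (combination δs cs r) ≈ 0#
    combination-vanishes []       r ok eq = eval-0 ρ
    combination-vanishes (c ∷ []) r ok eq = trans (eval-* ρ (normalise c) r) (trans (*-congˡ eq) (zeroʳ _))
    combination-vanishes (c ∷ cs@(_ ∷ _)) r ok eq = begin
      eval ρ ((normalise c *ₚ r) +ₚ combination δs cs (Dₚ δs r))
        ≈⟨ trans (eval-+ ρ (normalise c *ₚ r) _) (+-congʳ (eval-* ρ (normalise c) r)) ⟩
      eval ρ (normalise c) * eval ρ r + eval ρ (combination δs cs (Dₚ δs r))
        ≈⟨ +-cong (trans (*-congˡ eq) (zeroʳ _)) (combination-vanishes cs (Dₚ δs r) (∧-conicalʳ (differentiable δs r) _ ok) Dr) ⟩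
      0# + 0#   ≈⟨ +-identityˡ 0# ⟩
      0#        ∎
      where
      Dr : eval ρ (Dₚ δs r) ≈ 0#
      Dr = trans (sym (Dₚ-sound r (∧-conicalˡ _ _ ok))) (trans (D-cong eq) D-0)

  shifted : ℕ → ℕ → Carrier → Carrier
  shifted e zero    s = s
  shifted e (suc k) s = D (shifted e k s) + e · 1# * shifted e k s

  Unit : Carrier → Set
  Unit g = Σ Carrier λ g⁻¹ → g * g⁻¹ ≈ 1#

  cancel : ∀ {g s t} → Unit g → s * g ≈ t * g → s ≈ t
  cancel {g} {s} {t} (g⁻¹ , inv) eq = begin
    s              ≈⟨ *-identityʳ s ⟨
    s * 1#         ≈⟨ *-congˡ inv ⟨
    s * (g * g⁻¹)  ≈⟨ *-assoc s g g⁻¹ ⟨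
    s * g * g⁻¹    ≈⟨ *-congʳ eq ⟩
    t * g * g⁻¹    ≈⟨ *-assoc t g g⁻¹ ⟩
    t * (g * g⁻¹)  ≈⟨ *-congˡ inv ⟩
    t * 1#         ≈⟨ *-identityʳ t ⟩
    t              ∎

  module _ {n} (δs : Rule n) (ρ : Vec Carrier n) (obeys : Obeys δs ρ) where

    -- By the Leibniz rule (D + e)(t g) = (D t) g + t (D + e) g = (D t + l t) g, which is
    -- `transformStep`.
    transform-sound : ∀ e l g → D g + e · 1# * g ≈ eval ρ l * g →
      ∀ k → transformable δs l k ≡ true → shifted e k g ≈ eval ρ (transform δs l k) * g
    transform-sound e l g eq zero    ok = sym (trans (*-congʳ (eval-1 ρ)) (*-identityˡ g))
    transform-sound e l g eq (suc k) ok = begin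
      D (shifted e k g) + E * shifted e k g
        ≈⟨ +-cong (D-cong IH) (*-congˡ IH) ⟩
      D (t * g) + E * (t * g)
        ≈⟨ +-cong (D-* t g) (*-swap E t g) ⟩
      (D t * g + t * D g) + t * (E * g)
        ≈⟨ trans (+-assoc _ _ _) (+-congˡ (sym (distribˡ t _ _))) ⟩
      D t * g + t * (D g + E * g)
        ≈⟨ +-cong (*-congʳ (Dₚ-sound δs ρ obeys (transform δs l k) (∧-conicalʳ (transformable δs l k) _ ok))) (*-congˡ eq) ⟩
      eval ρ (Dₚ δs (transform δs l k)) * g + t * (eval ρ l * g)
        ≈⟨ +-congˡ (trans (*-swap t _ g) (sym (*-assoc _ t g))) ⟩
      eval ρ (Dₚ δs (transform δs l k)) * g + eval ρ l * t * g
        ≈⟨ trans (sym (distribʳ g _ _)) (*-congʳ (sym (trans (eval-+ ρ (Dₚ δs (transform δs l k)) _) (+-congˡ (eval-* ρ l _))))) ⟩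
      eval ρ (transform δs l (suc k)) * g ∎
      where
      E = e · 1#
      t = eval ρ (transform δs l k)
      IH = transform-sound e l g eq k (∧-conicalˡ _ _ ok)

    Solution : Equation n → Set
    Solution (equation e l k k′ c _) = Σ Carrier λ g → Unit g × (D g + e · 1# * g ≈ eval ρ l * g) ×
      (shifted e k g + c · 1# * shifted e k′ g ≈ 0#)

    -- Dividing by the unit g turns a linear differential equation for g into a nonlinear one for
    -- its logarithmic derivative, as in the passage to a Riccati equation.
    residue-vanishes : ∀ E → Equation.usable E δs ≡ true → Solution E → eval ρ (Equation.residue E δs) ≈ 0#
    residue-vanishes (equation e l k k′ c _) ok (g , unit , log , eq) = cancel unit (begin
      eval ρ (t +ₚ (constₚ c *ₚ t′)) * g
        ≈⟨ *-congʳ (trans (eval-+ ρ t (constₚ c *ₚ t′))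
             (+-congˡ (trans (eval-* ρ (constₚ c) t′) (*-congʳ (eval-const ρ c))))) ⟩
      (eval ρ t + c · 1# * eval ρ t′) * g
        ≈⟨ trans (distribʳ g _ _) (+-congˡ (*-assoc _ _ g)) ⟩
      eval ρ t * g + c · 1# * (eval ρ t′ * g)
        ≈⟨ +-cong (sym (transform-sound e l g log k (∧-conicalˡ _ _ ok)))
             (*-congˡ (sym (transform-sound e l g log k′ (∧-conicalˡ _ _ (∧-conicalʳ (transformable δs l k) _ ok))))) ⟩
      shifted e k g + c · 1# * shifted e k′ g    ≈⟨ eq ⟩
      0#                                         ≈⟨ zeroˡ g ⟨
      0# * g                                     ∎)
      where
      t  = transform δs l k
      t′ = transform δs l k′

    combinations-vanish : ∀ Es → allUsable δs Es ≡ true → All Solution Es → eval ρ (combinations δs Es) ≈ 0#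
    combinations-vanish []       ok []         = eval-0 ρ
    combinations-vanish (E ∷ Es) ok (sol ∷ sols) = begin
      eval ρ (combination δs multipliers r +ₚ combinations δs Es)
        ≈⟨ eval-+ ρ (combination δs multipliers r) (combinations δs Es) ⟩
      eval ρ (combination δs multipliers r) + eval ρ (combinations δs Es)
        ≈⟨ +-cong (combination-vanishes δs ρ obeys multipliers r (∧-conicalʳ (transformable δs logDeriv k′) _
               (∧-conicalʳ (transformable δs logDeriv k) _ usable-E)) (residue-vanishes E usable-E sol))
             (combinations-vanish Es (∧-conicalʳ (usable δs) _ ok) sols) ⟩
      0# + 0#   ≈⟨ +-identityˡ 0# ⟩
      0#        ∎
      where
      open Equation E
      r = residue δs
      usable-E : usable δs ≡ true
      usable-E = ∧-conicalˡ _ _ ok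

    consequence : ∀ p r Es → Derivation δs p r Es → All Solution Es → eval ρ p ≈ eval ρ r
    consequence p r Es (derivation ok eq) sols = begin
      eval ρ p                                  ≈⟨ isEqual-sound ρ p (r +ₚ combinations δs Es) eq ⟩
      eval ρ (r +ₚ combinations δs Es)          ≈⟨ eval-+ ρ r (combinations δs Es) ⟩
      eval ρ r + eval ρ (combinations δs Es)    ≈⟨ +-congˡ (combinations-vanish Es ok sols) ⟩
      eval ρ r + 0#                             ≈⟨ +-identityʳ _ ⟩
      eval ρ r                                  ∎

    -- The polynomial h = transform δs j 5 evaluates to the constant -1, so h² + c D h = 1.
    fixed-by-quotient : ∀ e j J → Unit J → D J + e · 1# * J ≈ eval ρ j * J → shifted e 5 J + 1 · 1# * J ≈ 0# →
      ∀ e′ l g c → D g + e′ · 1# * g ≈ eval ρ l * g → Quotient δs j l c → shifted e′ 10 g ≈ g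
    fixed-by-quotient e j J unit log theta e′ l g c log′ (quotient ok₅ ok′ ok₁₀ eq) = begin
      shifted e′ 10 g                   ≈⟨ transform-sound e′ l g log′ 10 ok₁₀ ⟩
      eval ρ (transform δs l 10) * g    ≈⟨ *-congʳ t≈1 ⟩
      1# * g                            ≈⟨ *-identityˡ g ⟩
      g                                 ∎
      where
      h = transform δs j 5
      h≈-1 : eval ρ h ≈ 10 · 1#
      h≈-1 = cancel unit (begin
        eval ρ h * J                               ≈⟨ transform-sound e j J log 5 ok₅ ⟨
        shifted e 5 J
          ≈⟨ identity (var zero) (var zero :+ con 1 :* var (suc zero) :+ con 10 :* var (suc zero)) ≡.refl (shifted e 5 J ∷ J ∷ []) ⟩
        shifted e 5 J + 1 · 1# * J + 10 · 1# * J   ≈⟨ trans (+-congʳ theta) (+-identityˡ _) ⟩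
        10 · 1# * J                                ∎)
      Dh≈0 : eval ρ (Dₚ δs h) ≈ 0#
      Dh≈0 = trans (sym (Dₚ-sound δs ρ obeys h ok′)) (trans (D-cong h≈-1) (D-const 10))
      t≈1 : eval ρ (transform δs l 10) ≈ 1#
      t≈1 = begin
        eval ρ (transform δs l 10)                   ≈⟨ isEqual-sound ρ (transform δs l 10) ((h *ₚ h) +ₚ (c *ₚ Dₚ δs h)) eq ⟩
        eval ρ ((h *ₚ h) +ₚ (c *ₚ Dₚ δs h))          ≈⟨ eval-+ ρ (h *ₚ h) (c *ₚ Dₚ δs h) ⟩
        eval ρ (h *ₚ h) + eval ρ (c *ₚ Dₚ δs h)
          ≈⟨ +-cong (trans (eval-* ρ h h) (*-cong h≈-1 h≈-1)) (trans (eval-* ρ c (Dₚ δs h)) (*-congˡ Dh≈0)) ⟩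
        10 · 1# * (10 · 1#) + eval ρ c * 0#
          ≈⟨ identity (con 10 :* con 10 :+ var zero :* con 0) :1 ≡.refl (eval ρ c ∷ []) ⟩
        1#                                           ∎

-- The explicit differential identities in W and S.

w : ∀ {n} → Expr (suc n)
w = var zero

s₀ : ∀ {n} → Expr (suc (suc n))
s₀ = var (suc zero)

s₁ : ∀ {n} → Expr (suc (suc (suc n)))
s₁ = var (suc (suc zero))

s₂ : Expr 9
s₂ = var 3F

logDerivative : ∀ {n} → ℕ → ℕ → Poly (suc (suc n))
logDerivative m n = normalise (con m :* w :+ con n :* s₀)

-- The relation D(W + S) = 4 W S solved for DW.
Wʹ : ∀ {n} → Expr (suc (suc (suc n)))
Wʹ = con 4 :* w :* s₀ :+ con 10 :* s₁

S₂ : ∀ {n} → Expr (suc (suc (suc n)))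
S₂ = con 8 :* s₁ :* w :+ con 6 :* s₀ :* s₀ :* w :+ con 4 :* s₀ :* s₁

-- The variables are W and the derivatives S, DS, …, D⁷S.
jetRule : Rule 9
jetRule = just (normalise Wʹ) ∷ just (varₚ 2F) ∷ just (varₚ 3F) ∷ just (varₚ 4F) ∷ just (varₚ 5F)
  ∷ just (varₚ 6F) ∷ just (varₚ 7F) ∷ just (varₚ 8F) ∷ nothing ∷ []

closedRule : Rule 3
closedRule = just (normalise Wʹ) ∷ just (varₚ 2F) ∷ just (normalise S₂) ∷ []

-- Solutions of a linear system over F₁₁: W and S have weight 1, D raises the weight by 1, and in weight at most 8 these
-- multiples of the derivatives of the four equations combine to a formula for D²S.
cofJ cofK cofψ cofA : List (Expr 9)
cofJ = (con 10 :* s₀ :* s₀ :* s₀ :+ con 3 :* s₀ :* s₀ :* w :+ s₀ :* w :* w :+ con 5 :* w :* w :* w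
      :+ con 9 :* s₀ :* s₁ :+ s₁ :* w :+ con 2 :* s₂)
  ∷ (con 7 :* s₀ :* s₀ :+ con 6 :* s₀ :* w :+ con 8 :* w :* w :+ con 6 :* s₁)
  ∷ (con 9 :* s₀ :+ con 2 :* w) ∷ []
cofK = (con 9 :* s₀ :* s₀ :* s₀ :+ con 7 :* s₀ :* s₀ :* w :+ con 4 :* s₀ :* w :* w :+ w :* w :* w
      :+ con 10 :* s₀ :* s₁ :+ con 2 :* s₁ :* w :+ con 4 :* s₂)
  ∷ (con 4 :* s₀ :* s₀ :+ con 4 :* s₀ :* w :+ con 9 :* w :* w :+ con 8 :* s₁)
  ∷ (con 7 :* w) ∷ con 8 ∷ []
cofψ = (con 9 :* s₀ :* s₀ :+ con 2 :* s₀ :* w :+ con 6 :* w :* w) ∷ (s₀ :+ con 4 :* w) ∷ con 9 ∷ []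
cofA = (con 3 :* s₀ :* s₀ :+ con 9 :* s₀ :* w :+ con 5 :* w :* w :+ con 3 :* s₁) ∷ (con 3 :* s₀ :+ con 7 :* w)
  ∷ con 7 ∷ []

-- The series are f₁³ = φ²ψ, f₂³ = φψ², ψ and f₁ = φ^(2/3) ψ^(1/3), where 2/3 = 8 and 1/3 = 4. The
-- first argument is the q-exponent 1/8, 1/4, 1/8 or 1/24, that is 7, 3, 7 or 6. The multipliers
-- raise every residue to weight 8; there the sum is zero as a polynomial in the jet, and what the
-- lower terms contribute in weight 3 is D²S minus `S₂`.
equations : List (Equation 9)
equations = equation 7 (logDerivative 2 1) 5 0 1 cofJ ∷ equation 3 (logDerivative 1 2) 5 0 10 cofK
  ∷ equation 7 (logDerivative 0 1) 6 1 1 cofψ ∷ equation 6 (logDerivative 8 4) 6 1 1 cofA ∷ []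

-- f₁^a f₂^b = φ^m ψ^n with m = (2a + b) / 3 and n = (a + 2b) / 3 modulo 11.
Target : ℕ → ℕ → Poly 3 → Set
Target m n = Quotient closedRule (logDerivative 2 1) (logDerivative m n)

f₁¹⁰ : Target 3 7 (normalise (con 2 :* s₀ :^ 4 :+ con 6 :* s₀ :^ 3 :* w :+ con 5 :* s₀ :^ 2 :* w :^ 2 :+ con 9 :* s₀ :* w :^ 3
  :+ con 10 :* w :^ 4 :+ con 8 :* s₀ :^ 2 :* s₁ :+ con 8 :* s₀ :* s₁ :* w :+ con 6 :* s₁ :^ 2))
f₁¹⁰ = quotient ≡.refl ≡.refl ≡.refl ≡.refl

f₁⁷f₂³ : Target 2 8 (normalise (con 10 :* s₀ :^ 4 :+ con 6 :* s₀ :^ 3 :* w :+ con 8 :* s₀ :^ 2 :* w :^ 2 :+ con 9 :* s₀ :* w :^ 3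
  :+ con 4 :* w :^ 4 :+ s₀ :^ 2 :* s₁ :+ con 2 :* s₀ :* s₁ :* w :+ con 2 :* s₁ :* w :^ 2 :+ con 2 :* s₁ :^ 2))
f₁⁷f₂³ = quotient ≡.refl ≡.refl ≡.refl ≡.refl

f₁⁵f₂⁵ : Target 5 5 (normalise (con 5 :* s₀ :^ 4 :+ con 5 :* s₀ :^ 3 :* w :+ con 5 :* s₀ :^ 2 :* w :^ 2 :+ con 2 :* s₀ :* w :^ 3
  :+ con 6 :* w :^ 4 :+ s₀ :^ 2 :* s₁ :+ con 3 :* s₀ :* s₁ :* w :+ s₁ :* w :^ 2))
f₁⁵f₂⁵ = quotient ≡.refl ≡.refl ≡.refl ≡.refl

f₁³f₂⁷ : Target 8 2 (normalise (con 7 :* s₀ :^ 4 :+ con 5 :* s₀ :^ 3 :* w :+ con 7 :* s₀ :^ 2 :* w :^ 2 :+ s₀ :* w :^ 3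
  :+ w :^ 4 :+ con 2 :* s₀ :^ 2 :* s₁ :+ con 7 :* s₀ :* s₁ :* w :+ s₁ :* w :^ 2 :+ con 9 :* s₁ :^ 2))
f₁³f₂⁷ = quotient ≡.refl ≡.refl ≡.refl ≡.refl

f₂¹⁰ : Target 7 3 (normalise (s₀ :^ 4 :+ con 2 :* s₀ :^ 3 :* w :+ con 10 :* s₀ :^ 2 :* w :^ 2 :+ con 6 :* s₀ :* w :^ 3
  :+ con 9 :* w :^ 4 :+ s₀ :* s₁ :* w :+ con 8 :* s₁ :* w :^ 2 :+ con 5 :* s₁ :^ 2))
f₂¹⁰ = quotient ≡.refl ≡.refl ≡.refl ≡.refl

closing : Derivation jetRule (varₚ 3F) (normalise S₂) equations
closing = derivation ≡.refl ≡.refl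

module ModularEquations (𝓡 : DifferentialRing) where
  open DifferentialRing 𝓡
  open Evaluation 𝓡
  open Differentiation 𝓡
  open SetoidReasoning setoid

  module _ (W S : Carrier) where

    HasLogDerivative : ℕ → ℕ → ℕ → Carrier → Set
    HasLogDerivative e m n g = D g + e · 1# * g ≈ (m · 1# * W + n · 1# * S) * g

    module _
      (DW+DS : D W + D S ≈ 4 · 1# * W * S)
      {J K ψ A : Carrier} (J-unit : Unit J) (K-unit : Unit K) (ψ-unit : Unit ψ) (A-unit : Unit A)
      (J-log : HasLogDerivative 7 2 1 J) (K-log : HasLogDerivative 3 1 2 K)
      (ψ-log : HasLogDerivative 7 0 1 ψ) (A-log : HasLogDerivative 6 8 4 A)
      (J-theta : shifted 7 5 J + 1 · 1# * J ≈ 0#) (K-theta : shifted 3 5 K + 10 · 1# * K ≈ 0#)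
      (ψ-theta : shifted 7 6 ψ + 1 · 1# * shifted 7 1 ψ ≈ 0#) (A-theta : shifted 6 6 A + 1 · 1# * shifted 6 1 A ≈ 0#)
      where

      S′ S″ : Carrier
      S′ = D S
      S″ = D S′

      jet : Vec Carrier 9
      jet = W ∷ S ∷ S′ ∷ S″ ∷ D S″ ∷ D (D S″) ∷ D (D (D S″)) ∷ D (D (D (D S″))) ∷ D (D (D (D (D S″)))) ∷ []

      DW : D W ≈ 4 · 1# * W * S + 10 · 1# * S′
      DW = begin
        D W                             ≈⟨ identity (var 0F) (var 0F :+ var 1F :+ con 10 :* var 1F) ≡.refl (D W ∷ S′ ∷ []) ⟩
        D W + D S + 10 · 1# * S′        ≈⟨ +-congʳ DW+DS ⟩
        4 · 1# * W * S + 10 · 1# * S′   ∎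

      jet-obeys : Obeys jetRule jet
      jet-obeys 0F = trans DW (normalise-sound jet Wʹ)
      jet-obeys 1F = sym (eval-var jet 2F)
      jet-obeys 2F = sym (eval-var jet 3F)
      jet-obeys 3F = sym (eval-var jet 4F)
      jet-obeys 4F = sym (eval-var jet 5F)
      jet-obeys 5F = sym (eval-var jet 6F)
      jet-obeys 6F = sym (eval-var jet 7F)
      jet-obeys 7F = sym (eval-var jet 8F)
      jet-obeys 8F = tt

      log-jet : ∀ e {g} m n → HasLogDerivative e m n g → D g + e · 1# * g ≈ eval jet (logDerivative m n) * g
      log-jet e m n log = trans log (*-congʳ (normalise-sound jet (con m :* w :+ con n :* s₀)))

      solutions : All (Solution jetRule jet jet-obeys) equations
      solutions = (J , J-unit , log-jet 7 2 1 J-log , J-theta) ∷ (K , K-unit , log-jet 3 1 2 K-log , K-theta)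
        ∷ (ψ , ψ-unit , log-jet 7 0 1 ψ-log , ψ-theta) ∷ (A , A-unit , log-jet 6 8 4 A-log , A-theta) ∷ []

      DS′ : D S′ ≈ ⟦ S₂ ⟧ jet
      DS′ = begin
        S″                         ≈⟨ eval-var jet 3F ⟨
        eval jet (varₚ 3F)         ≈⟨ consequence jetRule jet jet-obeys (varₚ 3F) (normalise S₂) equations closing solutions ⟩
        eval jet (normalise S₂)    ≈⟨ normalise-sound jet S₂ ⟨
        ⟦ S₂ ⟧ jet                 ∎

      point : Vec Carrier 3
      point = W ∷ S ∷ S′ ∷ []

      point-obeys : Obeys closedRule point
      point-obeys 0F = trans DW (normalise-sound point Wʹ)
      point-obeys 1F = sym (eval-var point 2F)
      point-obeys 2F = trans DS′ (normalise-sound point S₂)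

      log-point : ∀ e {g} m n → HasLogDerivative e m n g → D g + e · 1# * g ≈ eval point (logDerivative m n) * g
      log-point e m n log = trans log (*-congʳ (normalise-sound point (con m :* w :+ con n :* s₀)))

      target-fixed : ∀ {e m n c g} → Target m n c → HasLogDerivative e m n g → shifted e 10 g ≈ g
      target-fixed {e} {m} {n} {c} {g} target log = fixed-by-quotient closedRule point point-obeys
        7 (logDerivative 2 1) J J-unit (log-point 7 2 1 J-log) J-theta
        e (logDerivative m n) g c (log-point e m n log) target

-- Differential rings filtered by order, and congruences up to a given order.

record FilteredRing : Set₁ where
  field
    differentialRing : DifferentialRing
  open DifferentialRing differentialRing public
  open Evaluation differentialRing public
  open Differentiation differentialRing public
  field
    -- O n s: the series s has order at least n.
    O           : ℕ → Carrier → Set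
    O-resp      : ∀ {n s t} → s ≈ t → O n s → O n t
    O-zero      : ∀ s → O 0 s
    O-0#        : ∀ n → O n 0#
    O-+         : ∀ {n s t} → O n s → O n t → O n (s + t)
    O-*         : ∀ {m n s t} → O m s → O n t → O (m ℕ.+ n) (s * t)
    O-weaken    : ∀ {m n s} → m ≤ n → O n s → O m s
    O-D         : ∀ {n s} → O n s → O n (D s)
    O-separated : ∀ {s} → (∀ n → O n s) → s ≈ 0#

  infix 4 _≈[_]_

  _≈[_]_ : Carrier → ℕ → Carrier → Set
  s ≈[ n ] t = O n (s - t)

  O-*ˡ : ∀ {n t} s → O n t → O n (s * t)
  O-*ˡ s = O-* (O-zero s)

  O-^ : ∀ {s} → O 1 s → ∀ n → O n (s ^ n)
  O-^ o zero    = O-zero 1#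
  O-^ o (suc n) = O-* o (O-^ o n)

  ≈⇒≈[] : ∀ {n s t} → s ≈ t → s ≈[ n ] t
  ≈⇒≈[] {n} eq = O-resp (sym (trans (+-congʳ eq) (-‿inverseʳ _))) (O-0# n)

  ≈[]-sym : ∀ {n s t} → s ≈[ n ] t → t ≈[ n ] s
  ≈[]-sym {n} {s} {t} o = O-resp
    (identity (con 10 :* (var 0F :- var 1F)) (var 1F :- var 0F) ≡.refl (s ∷ t ∷ [])) (O-*ˡ _ o)

  ≈[]-trans : ∀ {n s t u} → s ≈[ n ] t → t ≈[ n ] u → s ≈[ n ] u
  ≈[]-trans {n} {s} {t} {u} o p = O-resp
    (identity ((var 0F :- var 1F) :+ (var 1F :- var 2F)) (var 0F :- var 2F) ≡.refl (s ∷ t ∷ u ∷ [])) (O-+ o p)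

  ≈[]-weaken : ∀ {m n s t} → m ≤ n → s ≈[ n ] t → s ≈[ m ] t
  ≈[]-weaken = O-weaken

  ≈[]-separated : ∀ {s t} → (∀ n → s ≈[ n ] t) → s ≈ t
  ≈[]-separated o = ≈-from-difference (O-separated o)

  +-cong[] : ∀ {n s t u v} → s ≈[ n ] t → u ≈[ n ] v → s + u ≈[ n ] t + v
  +-cong[] {n} {s} {t} {u} {v} o p = O-resp
    (identity ((var 0F :- var 1F) :+ (var 2F :- var 3F)) ((var 0F :+ var 2F) :- (var 1F :+ var 3F)) ≡.refl (s ∷ t ∷ u ∷ v ∷ []))
    (O-+ o p)

  *-cong[]-O : ∀ {m n s u v} → O m s → u ≈[ n ] v → s * u ≈[ m ℕ.+ n ] s * v
  *-cong[]-O {m} {n} {s} {u} {v} o p = O-resp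
    (identity (var 0F :* (var 1F :- var 2F)) (var 0F :* var 1F :- var 0F :* var 2F) ≡.refl (s ∷ u ∷ v ∷ [])) (O-* o p)

  *-cong[] : ∀ {n s t u v} → s ≈[ n ] t → u ≈[ n ] v → s * u ≈[ n ] t * v
  *-cong[] {n} {s} {t} {u} {v} o p = O-resp
    (identity (var 2F :* (var 0F :- var 1F) :+ var 1F :* (var 2F :- var 3F)) (var 0F :* var 2F :- var 1F :* var 3F) ≡.refl
      (s ∷ t ∷ u ∷ v ∷ []))
    (O-+ (O-*ˡ u o) (O-*ˡ t p))

  *-congˡ[] : ∀ {n s u v} → u ≈[ n ] v → s * u ≈[ n ] s * v
  *-congˡ[] = *-cong[] (≈⇒≈[] refl)

  D-negate : ∀ s → D (- s) ≈ - D s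
  D-negate s = trans (D-cong (sym (-1*x≈-x s))) (trans (D-* (- 1#) s)
    (trans (+-congʳ (trans (*-congʳ D-minus-1) (zeroˡ s))) (trans (+-identityˡ _) (-1*x≈-x (D s)))))
    where
    D-minus-1 : D (- 1#) ≈ 0#
    D-minus-1 = trans (D-cong (sym 10≈-1)) (D-const 10)

  D-cong[] : ∀ {n s t} → s ≈[ n ] t → D s ≈[ n ] D t
  D-cong[] {n} {s} {t} o = O-resp (trans (D-+ s (- t)) (+-congˡ (D-negate t))) (O-D o)

  cancel[] : ∀ {n s t g} → Unit g → s * g ≈[ n ] t * g → s ≈[ n ] t
  cancel[] {n} {s} {t} {g} (g⁻¹ , inv) o = O-resp (begin
    g⁻¹ * (s * g - t * g)
      ≈⟨ identity (var 3F :* (var 0F :* var 2F :- var 1F :* var 2F)) ((var 0F :- var 1F) :* (var 2F :* var 3F)) ≡.refl (s ∷ t ∷ g ∷ g⁻¹ ∷ []) ⟩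
    (s - t) * (g * g⁻¹)   ≈⟨ *-congˡ inv ⟩
    (s - t) * 1#          ≈⟨ *-identityʳ _ ⟩
    s - t                 ∎) (O-*ˡ g⁻¹ o)
    where open SetoidReasoning setoid

  Constant : Carrier → Set
  Constant c = D c ≈ 0#

  D-constant-* : ∀ {c} → Constant c → ∀ s → D (c * s) ≈ c * D s
  D-constant-* {c} const s = trans (D-* c s) (trans (+-congʳ (trans (*-congʳ const) (zeroˡ s))) (+-identityˡ _))

  constant-* : ∀ {c d} → Constant c → Constant d → Constant (c * d)
  constant-* const const′ = trans (D-constant-* const _) (trans (*-congˡ const′) (zeroʳ _))

  constant-+ : ∀ {c d} → Constant c → Constant d → Constant (c + d)
  constant-+ const const′ = trans (D-+ _ _) (trans (+-cong const const′) (+-identityˡ 0#))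

  record Additive (F : Carrier → Carrier) : Set where
    field
      F-cong : ∀ {s t} → s ≈ t → F s ≈ F t
      F-+    : ∀ s t → F (s + t) ≈ F s + F t

  shifted-cong : ∀ e k {s t} → s ≈ t → shifted e k s ≈ shifted e k t
  shifted-cong e zero    eq = eq
  shifted-cong e (suc k) eq = +-cong (D-cong (shifted-cong e k eq)) (*-congˡ (shifted-cong e k eq))

  shifted-+ : ∀ e k s t → shifted e k (s + t) ≈ shifted e k s + shifted e k t
  shifted-+ e zero    s t = refl
  shifted-+ e (suc k) s t = trans
    (+-cong (trans (D-cong (shifted-+ e k s t)) (D-+ _ _)) (trans (*-congˡ (shifted-+ e k s t)) (distribˡ _ _ _)))
    (+-interchange _ _ _ _)

  shifted-cong[] : ∀ {n s t} e k → s ≈[ n ] t → shifted e k s ≈[ n ] shifted e k t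
  shifted-cong[] e zero    o = o
  shifted-cong[] e (suc k) o = +-cong[] (D-cong[] (shifted-cong[] e k o)) (*-congˡ[] (shifted-cong[] e k o))

  -- The terms of a theta series are eigenvectors of D with constant eigenvalues, so a polynomial in
  -- D acts on each of them as a scalar.
  shifted-eigen : ∀ e k {m s} → Constant m → D s ≈ m * s → shifted e k s ≈ (m + e · 1#) ^ k * s
  shifted-eigen e zero    {m} {s} const eig = sym (*-identityˡ s)
  shifted-eigen e (suc k) {m} {s} const eig = begin
    D (shifted e k s) + e · 1# * shifted e k s
      ≈⟨ +-cong (D-cong IH) (*-congˡ IH) ⟩
    D (p * s) + e · 1# * (p * s)
      ≈⟨ +-congʳ (trans (D-constant-* (constant-^ k) s) (*-congˡ eig)) ⟩
    p * (m * s) + e · 1# * (p * s)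
      ≈⟨ identity (var 0F :* (var 1F :* var 2F) :+ var 3F :* (var 0F :* var 2F)) ((var 1F :+ var 3F) :* var 0F :* var 2F) ≡.refl
           (p ∷ m ∷ s ∷ e · 1# ∷ []) ⟩
    (m + e · 1#) * p * s ∎
    where
    open SetoidReasoning setoid
    p = (m + e · 1#) ^ k
    IH = shifted-eigen e k const eig
    constant-^ : ∀ k → Constant ((m + e · 1#) ^ k)
    constant-^ zero    = D-1
    constant-^ (suc k) = constant-* (constant-+ const (D-const e)) (constant-^ k)

  D-^ : ∀ {x c} → D x ≈ c * x → ∀ n → D (x ^ n) ≈ n · 1# * c * x ^ n
  D-^ {x} {c} eig zero    = trans D-1 (sym (trans (*-congʳ (zeroˡ c)) (zeroˡ 1#)))
  D-^ {x} {c} eig (suc n) = begin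
    D (x * x ^ n)                            ≈⟨ trans (D-* x _) (+-cong (*-congʳ eig) (*-congˡ (D-^ eig n))) ⟩
    c * x * x ^ n + x * (n · 1# * c * x ^ n)
      ≈⟨ identity (var 0F :* var 1F :* var 2F :+ var 1F :* (var 3F :* var 0F :* var 2F))
           ((:1 :+ var 3F) :* var 0F :* (var 1F :* var 2F)) ≡.refl (c ∷ x ∷ x ^ n ∷ n · 1# ∷ []) ⟩
    (1# + n · 1#) * c * (x * x ^ n)          ∎
    where open SetoidReasoning setoid

  -- Fermat's little theorem, by induction from the additivity of the Frobenius map.
  ·1-^11 : ∀ k → (k · 1#) ^ 11 ≈ k · 1#
  ·1-^11 zero    = zeroˡ _
  ·1-^11 (suc k) = begin
    (1# + K) ^ 11    ≈⟨ identity ((:1 :+ var 0F) :^ 11) (:1 :+ var 0F :^ 11) ≡.refl (K ∷ []) ⟩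
    1# + K ^ 11      ≈⟨ +-congˡ (·1-^11 k) ⟩
    1# + K           ∎
    where
    open SetoidReasoning setoid
    K = k · 1#

  partialProduct : Carrier → ℕ → Carrier
  partialProduct x zero    = 1#
  partialProduct x (suc n) = (1# - x ^ suc n) * partialProduct x n

  e₁ e₂ : (ℕ → Carrier) → ℕ → Carrier
  e₁ y zero    = 0#
  e₁ y (suc n) = e₁ y n + y (suc n)
  e₂ y zero    = 0#
  e₂ y (suc n) = e₂ y n + e₁ y n * y (suc n)

-- Euler products and the finite Jacobi triple product.

tri : ℕ → ℕ
tri zero    = 0
tri (suc k) = suc k ℕ.+ tri k

k≤tri : ∀ k → k ≤ tri k
k≤tri zero    = z≤n
k≤tri (suc k) = ℕ.m≤m+n (suc k) (tri k)

-- x stands for q^ℓ and f for ∏ (1 - x^i).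
record EulerProduct (𝓕 : FilteredRing) (ℓ : ℕ) : Set where
  open FilteredRing 𝓕
  field
    x        : Carrier
    x-O      : O 1 x
    D-x      : D x ≈ ℓ · 1# * x
    inv      : ℕ → Carrier
    inv-law  : ∀ i → (1# - x ^ suc i) * inv (suc i) ≈ 1#

  g : ℕ → Carrier
  g = partialProduct x

  field
    f f⁻     : Carrier
    f-inv    : f * f⁻ ≈ 1#
    f-limit  : ∀ n → f ≈[ suc n ] g n

  g⁻ : ℕ → Carrier
  g⁻ zero    = 1#
  g⁻ (suc n) = inv (suc n) * g⁻ n

module Kernel {𝓕 : FilteredRing} {ℓ : ℕ} (𝓔 : EulerProduct 𝓕 ℓ) where
  open FilteredRing 𝓕
  open EulerProduct 𝓔 public
  open SetoidReasoning setoid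

  L : Carrier
  L = ℓ · 1#

  g-inv : ∀ n → g n * g⁻ n ≈ 1#
  g-inv zero    = *-identityˡ 1#
  g-inv (suc n) = begin
    (1# - x ^ suc n) * g n * (inv (suc n) * g⁻ n)
      ≈⟨ identity (var 0F :* var 1F :* (var 2F :* var 3F)) (var 0F :* var 2F :* (var 1F :* var 3F)) ≡.refl
           (1# - x ^ suc n ∷ g n ∷ inv (suc n) ∷ g⁻ n ∷ []) ⟩
    (1# - x ^ suc n) * inv (suc n) * (g n * g⁻ n)   ≈⟨ *-cong (inv-law n) (g-inv n) ⟩
    1# * 1#                                         ≈⟨ *-identityˡ 1# ⟩
    1#                                              ∎

  -- The coefficient of z^k in (1 + z⁻¹) ∏_{i ≤ n} (1 + z x^i) (1 + z⁻¹ x^i), where n = d + k.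
  t : ℕ → ℕ → Carrier
  t d k = x ^ tri k * (g (suc ((d ℕ.+ k) ℕ.+ (d ℕ.+ k))) * (g⁻ d * g⁻ (suc (d ℕ.+ (k ℕ.+ k)))))

  -- `t₋ d (suc k)` belongs to the same n = d + k as `t d k`: it is the next coefficient, and 0 once
  -- the exponent of z exceeds n.
  t₋ : ℕ → ℕ → Carrier
  t₋ zero    k = 0#
  t₋ (suc d) k = t d k

  reindex : (F : ℕ → Carrier) → ∀ {m n} → m ≡ n → F m ≈ F n
  reindex F eq = reflexive (≡.cong F eq)

  g-double : ∀ N → g (suc (suc N ℕ.+ suc N)) ≈
    (1# - x * (x ^ suc N * x ^ suc N)) * (1# - x ^ suc N * x ^ suc N) * g (suc (N ℕ.+ N))
  g-double N = begin
    g (suc (suc N ℕ.+ suc N))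
      ≡⟨ ≡.cong (λ m → g (suc (suc m))) (ℕ.+-suc N N) ⟩
    (1# - x * x ^ suc (suc (N ℕ.+ N))) * ((1# - x ^ suc (suc (N ℕ.+ N))) * G)
      ≈⟨ *-cong (+-congˡ (-‿cong (*-congˡ double))) (*-congʳ (+-congˡ (-‿cong double))) ⟩
    (1# - x * (Q * Q)) * ((1# - Q * Q) * G)
      ≈⟨ *-assoc _ _ _ ⟨
    (1# - x * (Q * Q)) * (1# - Q * Q) * G ∎
    where
    Q = x ^ suc N
    G = g (suc (N ℕ.+ N))
    double : x ^ suc (suc (N ℕ.+ N)) ≈ Q * Q
    double = trans (reindex (x ^_) (≡.cong suc (≡.sym (ℕ.+-suc N N)))) (^-homo-* x (suc N) (suc N))

  t-zero : ∀ k → t 0 k ≈ x ^ tri k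
  t-zero k = begin
    x ^ tri k * (G * (1# * G⁻))
      ≈⟨ identity (var 0F :* (var 1F :* (:1 :* var 2F))) (var 0F :* (var 1F :* var 2F)) ≡.refl (x ^ tri k ∷ G ∷ G⁻ ∷ []) ⟩
    x ^ tri k * (G * G⁻)    ≈⟨ *-congˡ (g-inv (suc (k ℕ.+ k))) ⟩
    x ^ tri k * 1#          ≈⟨ *-identityʳ _ ⟩
    x ^ tri k               ∎
    where
    G  = g (suc (k ℕ.+ k))
    G⁻ = g⁻ (suc (k ℕ.+ k))

  t-zero-suc : ∀ k → t 0 (suc k) ≈ x ^ suc k * t 0 k
  t-zero-suc k = trans (t-zero (suc k)) (trans (^-homo-* x (suc k) (tri k)) (*-congˡ (sym (t-zero k))))

  g⁻-lower : ∀ n → g⁻ n ≈ (1# - x ^ suc n) * g⁻ (suc n)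
  g⁻-lower n = sym (trans (sym (*-assoc _ _ _)) (trans (*-congʳ (inv-law n)) (*-identityˡ _)))

  -- The factor 1 - x^d vanishes at d = 0, so one formula serves both clauses of `t₋` and the
  -- recurrences below need no case distinction.
  t₋-formula : ∀ d k → t₋ d (suc k) ≈ x ^ tri (suc k) *
    (g (suc ((d ℕ.+ k) ℕ.+ (d ℕ.+ k))) * ((1# - x ^ d) * g⁻ d * g⁻ (suc (suc (d ℕ.+ (k ℕ.+ k))))))
  t₋-formula zero    k = sym (trans (*-congˡ (trans (*-congˡ (trans (*-congʳ (trans (*-congʳ (-‿inverseʳ 1#)) (zeroˡ _)))
    (zeroˡ _))) (zeroʳ _))) (zeroʳ _))
  t₋-formula (suc d) k = *-congˡ (*-cong
    (reindex (λ m → g (suc (m ℕ.+ m))) (ℕ.+-suc d k))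
    (*-cong (g⁻-lower d) (reindex (λ m → g⁻ (suc m))
      (≡.trans (≡.cong (d ℕ.+_) (≡.cong suc (ℕ.+-suc k k))) (≡.trans (ℕ.+-suc d _) (≡.cong suc (ℕ.+-suc d _)))))))

  -- Polynomial identities cannot use that (1 - x^i) `inv i` is 1. Where a term lacks an inverse
  -- that the others have, such a product is inserted, and this removes it afterwards.
  clear : ∀ {a A b B} → a * A ≈ 1# → b * B ≈ 1# → ∀ s t → s * (a * A) * (b * B) + t * (a * A) ≈ s + t
  clear aA bB s t = +-cong
    (trans (*-cong (trans (*-congˡ aA) (*-identityʳ s)) bB) (*-identityʳ s)) (trans (*-congˡ aA) (*-identityʳ t))

  -- The constant term in z after multiplication by (1 + zQ)(1 + z⁻¹Q). The triple product is
  -- symmetric under k ↦ -1 - k, so the coefficient of z⁻¹ equals that of z⁰ and adds a further Q.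
  t-first : ∀ d → t (suc d) 0 ≈
    (1# + x ^ suc d * x ^ suc d + x ^ suc d) * t d 0 + x ^ suc d * t₋ d 1
  t-first d = begin
    1# * (g (suc (suc d ℕ.+ 0 ℕ.+ (suc d ℕ.+ 0))) * (A * g⁻ d * (B′ * H′)))
      ≈⟨ *-congˡ (*-cong (trans (reindex (λ m → g (suc (m ℕ.+ m))) (ℕ.+-identityʳ (suc d))) (g-double d))
           (*-congˡ (*-cong (reindex (λ m → inv (suc (suc m))) d+0) (reindex (λ m → g⁻ (suc m)) d+0)))) ⟩
    1# * ((1# - x * (Q * Q)) * (1# - Q * Q) * G * (A * g⁻ d * (B * H)))
      ≈⟨ identity
           (:1 :* ((:1 :- X :* (Q′ :* Q′)) :* (:1 :- Q′ :* Q′) :* var 2F :* (var 3F :* var 4F :* (var 5F :* var 6F))))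
           ((:1 :+ Q′ :* Q′ :+ Q′) :* (:1 :* (var 2F :* (var 4F :* var 6F))) :* ((:1 :- Q′) :* var 3F) :* ((:1 :- X :* Q′) :* var 5F)
             :+ Q′ :* (X :* :1 :* (var 2F :* ((:1 :- var 1F) :* var 4F :* (var 5F :* var 6F)))) :* ((:1 :- Q′) :* var 3F))
           ≡.refl (x ∷ x ^ d ∷ G ∷ A ∷ g⁻ d ∷ B ∷ H ∷ []) ⟩
    (1# + Q * Q + Q) * (1# * (G * (g⁻ d * H))) * ((1# - Q) * A) * ((1# - x * Q) * B)
      + Q * (x * 1# * (G * ((1# - x ^ d) * g⁻ d * (B * H)))) * ((1# - Q) * A)
      ≈⟨ clear (inv-law d) (inv-law (suc d)) _ _ ⟩
    (1# + Q * Q + Q) * (1# * (G * (g⁻ d * H))) + Q * (x * 1# * (G * ((1# - x ^ d) * g⁻ d * (B * H))))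
      ≈⟨ +-cong
           (*-congˡ (*-congˡ (*-cong (reindex (λ m → g (suc (m ℕ.+ m))) (≡.sym d+0)) (*-congˡ (reindex (λ m → g⁻ (suc m)) (≡.sym d+0))))))
           (*-congˡ (trans (*-congˡ (*-cong (reindex (λ m → g (suc (m ℕ.+ m))) (≡.sym d+0))
             (*-congˡ (reindex (λ m → g⁻ (suc (suc m))) (≡.sym d+0))))) (sym (t₋-formula d 0)))) ⟩
    (1# + Q * Q + Q) * t d 0 + Q * t₋ d 1 ∎
    where
    X Q′ : Expr 7
    X = var 0F
    Q′ = X :* var 1F
    Q = x ^ suc d
    d+0 = ℕ.+-identityʳ d
    G  = g (suc (d ℕ.+ d))
    A  = inv (suc d)
    B  = inv (suc (suc d))
    B′ = inv (suc (suc (d ℕ.+ 0)))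
    H  = g⁻ (suc d)
    H′ = g⁻ (suc (d ℕ.+ 0))

  -- The same multiplication, 1 + Q² + Q (z + z⁻¹), read off at a positive power of z, where both
  -- neighbours are available.
  t-next : ∀ d k → let Q = x ^ suc (d ℕ.+ suc k) in
    t (suc d) (suc k) ≈ (1# + Q * Q) * t d (suc k) + Q * (t (suc d) k + t₋ d (suc (suc k)))
  t-next d k = begin
    x ^ tri (suc k) * (g (suc (suc N ℕ.+ suc N)) * (A * g⁻ d * (B * H)))
      ≈⟨ *-cong (^-homo-* x (suc k) (tri k)) (*-congʳ (trans (g-double N) (*-congʳ
           (*-cong (+-congˡ (-‿cong (*-congˡ (*-cong Q≈ Q≈)))) (+-congˡ (-‿cong (*-cong Q≈ Q≈))))))) ⟩
    x * Y * T * ((1# - x * (Q * Q)) * (1# - Q * Q) * G * (A * g⁻ d * (B * H)))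
      ≈⟨ identity
           (x′ :* y :* τ :* ((:1 :- x′ :* (q :* q)) :* (:1 :- q :* q) :* var 4F :* (var 5F :* var 6F :* (var 7F :* var 8F))))
           ((:1 :+ q :* q) :* (x′ :* y :* τ :* (var 4F :* (var 6F :* var 8F)))
               :* ((:1 :- x′ :* z) :* var 5F) :* ((:1 :- x′ :* (q :* (x′ :* y))) :* var 7F)
             :+ q :* (τ :* (var 4F :* (var 5F :* var 6F :* ((:1 :- q :* (x′ :* y)) :* var 8F)))
                 :* ((:1 :- x′ :* (q :* (x′ :* y))) :* var 7F)
               :+ x′ :* (x′ :* y) :* (x′ :* y :* τ) :* (var 4F :* ((:1 :- z) :* var 6F :* (var 7F :* var 8F)))
                 :* ((:1 :- x′ :* z) :* var 5F)))
           ≡.refl (x ∷ Y ∷ Z ∷ T ∷ G ∷ A ∷ g⁻ d ∷ B ∷ H ∷ []) ⟩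
    (1# + Q * Q) * (x * Y * T * (G * (g⁻ d * H))) * a * b
      + Q * (T * (G * (A * g⁻ d * ((1# - Q * (x * Y)) * H))) * b
        + x * (x * Y) * (x * Y * T) * (G * ((1# - Z) * g⁻ d * (B * H))) * a)
      ≈⟨ +-cong (trans (*-cong (trans (*-congˡ a≈1) (*-identityʳ _)) b≈1) (*-identityʳ _))
           (*-congˡ (+-cong (trans (*-congˡ b≈1) (*-identityʳ _)) (trans (*-congˡ a≈1) (*-identityʳ _)))) ⟩
    (1# + Q * Q) * (x * Y * T * (G * (g⁻ d * H)))
      + Q * (T * (G * (A * g⁻ d * ((1# - Q * (x * Y)) * H))) + x * (x * Y) * (x * Y * T) * (G * ((1# - Z) * g⁻ d * (B * H))))
      ≈⟨ +-cong (*-cong (+-congˡ (*-cong (sym Q≈) (sym Q≈))) (*-congʳ (sym (^-homo-* x (suc k) (tri k)))))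
           (*-cong (sym Q≈) (+-cong (sym same) (sym lower))) ⟩
    (1# + Q₀ * Q₀) * t d (suc k) + Q₀ * (t (suc d) k + t₋ d (suc (suc k))) ∎
    where
    x′ y z τ q : Expr 9
    x′ = var 0F
    y = var 1F
    z = var 2F
    τ = var 3F
    q = x′ :* (z :* (x′ :* y))
    N = d ℕ.+ suc k
    M = d ℕ.+ (suc k ℕ.+ suc k)
    Y = x ^ k
    Z = x ^ d
    T = x ^ tri k
    Q₀ = x ^ suc N
    Q = x * (Z * (x * Y))
    G = g (suc (N ℕ.+ N))
    A = inv (suc d)
    B = inv (suc (suc M))
    H = g⁻ (suc M)
    a = (1# - x * Z) * A
    b = (1# - x * (Q * (x * Y))) * B
    Q≈ : Q₀ ≈ Q
    Q≈ = *-congˡ (^-homo-* x d (suc k))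
    x^M : x ^ suc M ≈ Q * (x * Y)
    x^M = begin
      x * x ^ M                     ≈⟨ *-congˡ (trans (^-homo-* x d _) (*-congˡ (^-homo-* x (suc k) (suc k)))) ⟩
      x * (Z * (x * Y * (x * Y)))
        ≈⟨ identity (var 0F :* (var 2F :* (var 0F :* var 1F :* (var 0F :* var 1F)))) (var 0F :* (var 2F :* (var 0F :* var 1F)) :* (var 0F :* var 1F))
             ≡.refl (x ∷ Y ∷ Z ∷ []) ⟩
      Q * (x * Y)                   ∎
    a≈1 : a ≈ 1#
    a≈1 = inv-law d
    b≈1 : b ≈ 1#
    b≈1 = trans (*-congʳ (+-congˡ (-‿cong (*-congˡ (sym x^M))))) (inv-law (suc M))
    M≡ : suc (suc (d ℕ.+ (k ℕ.+ k))) ≡ M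
    M≡ = ≡.sym (≡.trans (ℕ.+-suc d _) (≡.cong suc (≡.trans (≡.cong (d ℕ.+_) (ℕ.+-suc k k)) (ℕ.+-suc d _))))
    same : t (suc d) k ≈ T * (G * (A * g⁻ d * ((1# - Q * (x * Y)) * H)))
    same = *-congˡ (*-cong (reindex (λ m → g (suc (m ℕ.+ m))) (≡.sym (ℕ.+-suc d k)))
      (*-congˡ (trans (reindex g⁻ M≡) (trans (g⁻-lower M) (*-congʳ (+-congˡ (-‿cong x^M)))))))
    lower : t₋ d (suc (suc k)) ≈ x * (x * Y) * (x * Y * T) * (G * ((1# - Z) * g⁻ d * (B * H)))
    lower = trans (t₋-formula d (suc k))
      (*-congʳ (trans (^-homo-* x (suc (suc k)) (tri (suc k))) (*-congˡ (^-homo-* x (suc k) (tri k)))))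

  -- ∑ c j * t (n - j) j over k ≤ j ≤ n, where n = d + k.
  tail : (ℕ → Carrier) → ℕ → ℕ → Carrier
  tail c zero    k = c k * t 0 k
  tail c (suc d) k = c k * t (suc d) k + tail c d (suc k)

  total : (ℕ → Carrier) → ℕ → Carrier
  total c n = tail c n 0

  total-0 : ∀ n → total (λ _ → 0#) n ≈ 0#
  total-0 n = tail-0 n 0
    where
    tail-0 : ∀ d k → tail (λ _ → 0#) d k ≈ 0#
    tail-0 zero    k = zeroˡ _
    tail-0 (suc d) k = trans (+-cong (zeroˡ _) (tail-0 d (suc k))) (+-identityˡ 0#)

  -- For z + z⁻¹ = μ + ε the quotient (z^k + z^(-1-k)) / (1 + z⁻¹) satisfies a three-term recurrence
  -- in k with multiplier μ + ε. Its coefficients at successive powers of ε satisfy this one, `b`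
  -- being the coefficient one power lower. The field `first` is the recurrence at k = 0 with the
  -- symmetric value c (-1) = c 0.
  record Recurrence (μ : Carrier) (b c : ℕ → Carrier) : Set where
    field
      first : c 1 ≈ μ * c 0 + b 0 - c 0
      next  : ∀ k → c (suc (suc k)) ≈ μ * c (suc k) + b (suc k) - c k

  module _ {μ b c} (rec : Recurrence μ b c) where
    open Recurrence rec

    -- Summation by parts.
    tail-step : ∀ d k → let Q = x ^ suc (d ℕ.+ suc k) in
      tail c (suc d) (suc k) ≈ (1# + Q * Q + μ * Q) * tail c d (suc k) + Q * tail b d (suc k)
        + Q * (c (suc k) * t (suc d) k - c k * t d (suc k))
    tail-step zero    k = begin
      C₁ * t 1 (suc k) + c (suc (suc k)) * t 0 (suc (suc k))
        ≈⟨ +-cong (*-congˡ (t-next 0 k)) (*-cong (next k) (t-zero-suc (suc k))) ⟩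
      C₁ * ((1# + Q * Q) * T₀ + Q * (T₁ + 0#)) + (μ * C₁ + B₁ - C₀) * (Q * T₀)
        ≈⟨ identity (var 0F :* ((:1 :+ var 1F :* var 1F) :* var 2F :+ var 1F :* (var 3F :+ con 0))
             :+ (var 4F :* var 0F :+ var 5F :- var 6F) :* (var 1F :* var 2F))
           ((:1 :+ var 1F :* var 1F :+ var 4F :* var 1F) :* (var 0F :* var 2F) :+ var 1F :* (var 5F :* var 2F)
             :+ var 1F :* (var 0F :* var 3F :- var 6F :* var 2F)) ≡.refl (C₁ ∷ Q ∷ T₀ ∷ T₁ ∷ μ ∷ B₁ ∷ C₀ ∷ []) ⟩
      (1# + Q * Q + μ * Q) * (C₁ * T₀) + Q * (B₁ * T₀) + Q * (C₁ * T₁ - C₀ * T₀) ∎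
      where
      Q = x ^ suc (suc k)
      C₀ = c k
      C₁ = c (suc k)
      B₁ = b (suc k)
      T₀ = t 0 (suc k)
      T₁ = t 1 k
    tail-step (suc d) k = begin
      C₁ * t (suc (suc d)) (suc k) + tail c (suc d) (suc (suc k))
        ≈⟨ +-cong (*-congˡ (t-next (suc d) k)) (trans (tail-step d (suc k))
             (+-cong (+-cong (*-congʳ (+-cong (+-congˡ (*-cong Q≈ Q≈)) (*-congˡ Q≈))) (*-congʳ Q≈))
               (*-cong Q≈ (+-congʳ (*-congʳ (next k)))))) ⟩
      C₁ * ((1# + Q * Q) * T₁ + Q * (T₂ + T₀))
        + ((1# + Q * Q + μ * Q) * V + Q * B + Q * ((μ * C₁ + B₁ - C₀) * T₁ - C₁ * T₀))
        ≈⟨ identity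
             (var 0F :* ((:1 :+ var 1F :* var 1F) :* var 2F :+ var 1F :* (var 3F :+ var 4F))
               :+ ((:1 :+ var 1F :* var 1F :+ var 5F :* var 1F) :* var 6F :+ var 1F :* var 7F
                 :+ var 1F :* ((var 5F :* var 0F :+ var 8F :- var 9F) :* var 2F :- var 0F :* var 4F)))
             ((:1 :+ var 1F :* var 1F :+ var 5F :* var 1F) :* (var 0F :* var 2F :+ var 6F)
               :+ var 1F :* (var 8F :* var 2F :+ var 7F) :+ var 1F :* (var 0F :* var 3F :- var 9F :* var 2F))
             ≡.refl (C₁ ∷ Q ∷ T₁ ∷ T₂ ∷ T₀ ∷ μ ∷ V ∷ B ∷ B₁ ∷ C₀ ∷ []) ⟩
      (1# + Q * Q + μ * Q) * (C₁ * T₁ + V) + Q * (B₁ * T₁ + B) + Q * (C₁ * T₂ - C₀ * T₁) ∎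
      where
      Q = x ^ suc (suc d ℕ.+ suc k)
      Q≈ : x ^ suc (d ℕ.+ suc (suc k)) ≈ Q
      Q≈ = reindex (λ m → x ^ suc m) (ℕ.+-suc d (suc k))
      C₀ = c k
      C₁ = c (suc k)
      B₁ = b (suc k)
      T₀ = t d (suc (suc k))
      T₁ = t (suc d) (suc k)
      T₂ = t (suc (suc d)) k
      V = tail c d (suc (suc k))
      B = tail b d (suc (suc k))

    -- The passage from n to n + 1 multiplies by 1 + Q² + Q (z + z⁻¹). On the functional z^k ↦ c k
    -- the factor z + z⁻¹ acts as μ, up to the correction `b`.
    total-step : ∀ n → let Q = x ^ suc n in
      total c (suc n) ≈ (1# + Q * Q + μ * Q) * total c n + Q * total b n
    total-step zero    = begin
      c 0 * t 1 0 + c 1 * t 0 1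
        ≈⟨ +-cong (*-congˡ (t-first 0)) (*-cong first (t-zero-suc 0)) ⟩
      c 0 * ((1# + Q * Q + Q) * T + Q * 0#) + (μ * c 0 + b 0 - c 0) * (Q * T)
        ≈⟨ identity (var 0F :* ((:1 :+ var 1F :* var 1F :+ var 1F) :* var 2F :+ var 1F :* con 0)
               :+ (var 3F :* var 0F :+ var 4F :- var 0F) :* (var 1F :* var 2F))
             ((:1 :+ var 1F :* var 1F :+ var 3F :* var 1F) :* (var 0F :* var 2F) :+ var 1F :* (var 4F :* var 2F))
             ≡.refl (c 0 ∷ Q ∷ T ∷ μ ∷ b 0 ∷ []) ⟩
      (1# + Q * Q + μ * Q) * (c 0 * T) + Q * (b 0 * T) ∎
      where
      Q = x ^ 1
      T = t 0 0
    total-step (suc d) = begin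
      c 0 * t (suc (suc d)) 0 + tail c (suc d) 1
        ≈⟨ +-cong (*-congˡ (t-first (suc d))) (trans (tail-step d 0)
             (+-cong (+-cong (*-congʳ (+-cong (+-congˡ (*-cong Q≈ Q≈)) (*-congˡ Q≈))) (*-congʳ Q≈))
               (*-cong Q≈ (+-congʳ (*-congʳ first))))) ⟩
      c 0 * ((1# + Q * Q + Q) * T₁ + Q * T₀)
        + ((1# + Q * Q + μ * Q) * V + Q * B + Q * ((μ * c 0 + b 0 - c 0) * T₁ - c 0 * T₀))
        ≈⟨ identity
             (var 0F :* ((:1 :+ var 1F :* var 1F :+ var 1F) :* var 2F :+ var 1F :* var 3F)
               :+ ((:1 :+ var 1F :* var 1F :+ var 4F :* var 1F) :* var 5F :+ var 1F :* var 6F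
                 :+ var 1F :* ((var 4F :* var 0F :+ var 7F :- var 0F) :* var 2F :- var 0F :* var 3F)))
             ((:1 :+ var 1F :* var 1F :+ var 4F :* var 1F) :* (var 0F :* var 2F :+ var 5F)
               :+ var 1F :* (var 7F :* var 2F :+ var 6F))
             ≡.refl (c 0 ∷ Q ∷ T₁ ∷ T₀ ∷ μ ∷ V ∷ B ∷ b 0 ∷ []) ⟩
      (1# + Q * Q + μ * Q) * (c 0 * T₁ + V) + Q * (b 0 * T₁ + B) ∎
      where
      Q = x ^ suc (suc d)
      Q≈ : x ^ suc (d ℕ.+ 1) ≈ Q
      Q≈ = reindex (λ m → x ^ suc m) (ℕ.+-comm d 1)
      T₀ = t d 1
      T₁ = t (suc d) 0
      V = tail c d 1
      B = tail b d 1

-- The limit of the triple product: theta series and MacMahon's sums.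

module Theta {𝓕 : FilteredRing} {ℓ : ℕ} (𝓔 : EulerProduct 𝓕 ℓ) where
  open FilteredRing 𝓕
  open Kernel 𝓔
  open SetoidReasoning setoid

  L-constant : Constant L
  L-constant = D-const ℓ

  f-unit : Unit f
  f-unit = f⁻ , f-inv

  unit-* : ∀ {s t} → Unit s → Unit t → Unit (s * t)
  unit-* {s} {t} (s⁻ , inv-s) (t⁻ , inv-t) = s⁻ * t⁻ , trans
    (identity (var 0F :* var 1F :* (var 2F :* var 3F)) (var 0F :* var 2F :* (var 1F :* var 3F)) ≡.refl (s ∷ t ∷ s⁻ ∷ t⁻ ∷ []))
    (trans (*-cong inv-s inv-t) (*-identityˡ 1#))

  unit-1 : Unit 1#
  unit-1 = 1# , *-identityˡ 1#

  unit-^ : ∀ {s} → Unit s → ∀ n → Unit (s ^ n)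
  unit-^ unit zero    = unit-1
  unit-^ unit (suc n) = unit-* unit (unit-^ unit n)

  g-unit : ∀ n → Unit (g n)
  g-unit n = g⁻ n , g-inv n

  g≈f : ∀ {m n} → m ≤ n → g n ≈[ suc m ] f
  g≈f m≤n = ≈[]-weaken (s≤s m≤n) (≈[]-sym (f-limit _))

  -- All the partial products in the q-binomial coefficient agree with f at least to order d + 1, so
  -- f times it is 1 to that order only. The factor x^`tri k` supplies the missing k orders because
  -- k ≤ `tri k`.
  f*t : ∀ d k → f * t d k ≈[ suc (d ℕ.+ k) ] x ^ tri k
  f*t d k = ≈[]-weaken bound (≈[]-trans (≈⇒≈[] (*-swap f _ _))
    (≈[]-trans (*-cong[]-O (O-^ x-O (tri k)) (cancel[] (unit-* (g-unit d) (g-unit p)) inner)) (≈⇒≈[] (*-identityʳ _))))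
    where
    p = suc (d ℕ.+ (k ℕ.+ k))
    m = suc ((d ℕ.+ k) ℕ.+ (d ℕ.+ k))
    d≤m : d ≤ m
    d≤m = ℕ.≤-trans (ℕ.m≤m+n d k) (ℕ.≤-trans (ℕ.m≤m+n (d ℕ.+ k) _) (ℕ.n≤1+n _))
    d≤p : d ≤ p
    d≤p = ℕ.≤-trans (ℕ.m≤m+n d _) (ℕ.n≤1+n _)
    bound : suc (d ℕ.+ k) ≤ tri k ℕ.+ suc d
    bound = ℕ.≤-trans (ℕ.≤-reflexive (≡.trans (≡.cong suc (ℕ.+-comm d k)) (≡.sym (ℕ.+-suc k d)))) (ℕ.+-monoˡ-≤ (suc d) (k≤tri k))
    inner : f * (g m * (g⁻ d * g⁻ p)) * (g d * g p) ≈[ suc d ] 1# * (g d * g p)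
    inner = ≈[]-trans (≈⇒≈[] (begin
        f * (g m * (g⁻ d * g⁻ p)) * (g d * g p)
          ≈⟨ identity (var 0F :* (var 1F :* (var 2F :* var 3F)) :* (var 4F :* var 5F))
               (var 0F :* var 1F :* ((var 4F :* var 2F) :* (var 5F :* var 3F))) ≡.refl (f ∷ g m ∷ g⁻ d ∷ g⁻ p ∷ g d ∷ g p ∷ []) ⟩
        f * g m * (g d * g⁻ d * (g p * g⁻ p))   ≈⟨ *-congˡ (trans (*-cong (g-inv d) (g-inv p)) (*-identityˡ 1#)) ⟩
        f * g m * 1#                            ≈⟨ *-comm _ 1# ⟩
        1# * (f * g m)                          ∎))
      (*-congˡ[] (*-cong[] (≈[]-sym (g≈f ℕ.≤-refl)) (≈[]-trans (g≈f d≤m) (≈[]-sym (g≈f d≤p)))))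

  partialTheta : (ℕ → Carrier) → ℕ → ℕ → Carrier
  partialTheta c zero    k = c k * x ^ tri k
  partialTheta c (suc d) k = c k * x ^ tri k + partialTheta c d (suc k)

  theta : (ℕ → Carrier) → ℕ → Carrier
  theta c n = partialTheta c n 0

  f*tail : ∀ c d k → f * tail c d k ≈[ suc (d ℕ.+ k) ] partialTheta c d k
  f*tail c zero    k = ≈[]-trans (≈⇒≈[] (*-swap f _ _)) (*-congˡ[] (f*t 0 k))
  f*tail c (suc d) k = ≈[]-trans (≈⇒≈[] (trans (distribˡ f _ _) (+-congʳ (*-swap f _ _))))
    (+-cong[] (*-congˡ[] (f*t (suc d) k))
      (≡.subst (λ n → f * tail c d (suc k) ≈[ suc n ] partialTheta c d (suc k)) (ℕ.+-suc d k) (f*tail c d (suc k))))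

  f*total : ∀ c n → f * total c n ≈[ suc n ] theta c n
  f*total c n = ≡.subst (λ m → f * total c n ≈[ suc m ] theta c n) (ℕ.+-identityʳ n) (f*tail c n 0)

  theta-map : ∀ {F c c′} → Additive F → (∀ k → F (c k * x ^ tri k) ≈ c′ k * x ^ tri k) →
    ∀ n → F (theta c n) ≈ theta c′ n
  theta-map {F} {c} {c′} add eq n = go n 0
    where
    open Additive add
    go : ∀ d k → F (partialTheta c d k) ≈ partialTheta c′ d k
    go zero    k = eq k
    go (suc d) k = trans (F-+ _ _) (+-cong (eq k) (go d (suc k)))

  theta-scale : ∀ a c n → theta (λ k → a * c k) n ≈ a * theta c n
  theta-scale a c n = sym (theta-map {c = c} (record { F-cong = *-congˡ ; F-+ = distribˡ a }) (λ k → sym (*-assoc a _ _)) n)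

  theta-0 : ∀ {c} → (∀ k → c k ≈ 0#) → ∀ n → theta c n ≈ 0#
  theta-0 {c} eq n = go n 0
    where
    go : ∀ d k → partialTheta c d k ≈ 0#
    go zero    k = trans (*-congʳ (eq k)) (zeroˡ _)
    go (suc d) k = trans (+-cong (trans (*-congʳ (eq k)) (zeroˡ _)) (go d (suc k))) (+-identityˡ 0#)

  -- The triangular number as a polynomial in the image of k, with 6 = 1/2.
  τ : ℕ → Carrier
  τ k = 6 · 1# * (k · 1# * (k · 1# + 1#))

  tri≈τ : ∀ k → tri k · 1# ≈ τ k
  tri≈τ zero    = identity (con 0) (con 6 :* (con 0 :* (con 0 :+ :1))) ≡.refl []
  tri≈τ (suc k) = begin
    (suc k ℕ.+ tri k) · 1#         ≈⟨ ×-homo-+ 1# (suc k) (tri k) ⟩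
    (1# + K) + tri k · 1#          ≈⟨ +-congˡ (tri≈τ k) ⟩
    (1# + K) + τ k
      ≈⟨ identity ((:1 :+ var 0F) :+ con 6 :* (var 0F :* (var 0F :+ :1))) (con 6 :* ((:1 :+ var 0F) :* ((:1 :+ var 0F) :+ :1))) ≡.refl (K ∷ []) ⟩
    τ (suc k)                      ∎
    where K = k · 1#

  τ-constant : ∀ k → Constant (τ k)
  τ-constant k = constant-* (D-const 6) (constant-* (D-const k) (constant-+ (D-const k) D-1))

  D-term : ∀ {c} → Constant c → ∀ k → D (c * x ^ tri k) ≈ τ k * L * (c * x ^ tri k)
  D-term {c} const k = begin
    D (c * x ^ tri k)                        ≈⟨ trans (D-constant-* const _) (*-congˡ (D-^ D-x (tri k))) ⟩
    c * (tri k · 1# * L * x ^ tri k)         ≈⟨ *-congˡ (*-congʳ (*-congʳ (tri≈τ k))) ⟩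
    c * (τ k * L * x ^ tri k)                ≈⟨ *-swap c _ _ ⟩
    τ k * L * (c * x ^ tri k)                ∎

  shifted-term : ∀ e j {c} → Constant c → ∀ k →
    shifted e j (c * x ^ tri k) ≈ (τ k * L + e · 1#) ^ j * (c * x ^ tri k)
  shifted-term e j const k = shifted-eigen e j (constant-* (τ-constant k) L-constant) (D-term const k)

  -- The factor at x^i is Q ↦ 1 + μ Q + Q² = (1 ∓ Q)², and perturbing μ by ε multiplies it by 1 + ε y i.
  -- Hence the coefficients c₀, c₁, c₂ of ε⁰, ε¹, ε² yield the elementary symmetric functions of the y i.
  record Family (μ : Carrier) : Set where
    field
      c₀ c₁ c₂ h y : ℕ → Carrier
      a b          : Carrier
      c₀-constant  : ∀ k → Constant (c₀ k)
      recurrence₀  : Recurrence μ (λ _ → 0#) c₀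
      recurrence₁  : Recurrence μ c₀ c₁
      recurrence₂  : Recurrence μ c₁ c₂
      c₀-zero      : c₀ 0 ≈ 1#
      c₁-formula   : ∀ k → c₁ k ≈ a * (τ k * c₀ k)
      c₂-formula   : ∀ k → c₂ k ≈ b * (τ k * (τ k - 1#) * c₀ k)
      h-zero       : h 0 ≈ 1#
      h-step       : ∀ n → h (suc n) ≈ (1# + x ^ suc n * x ^ suc n + μ * x ^ suc n) * h n
      y-law        : ∀ n → (1# + x ^ suc n * x ^ suc n + μ * x ^ suc n) * y (suc n) ≈ x ^ suc n

    τ-zero : τ 0 ≈ 0#
    τ-zero = identity (con 6 :* (con 0 :* (con 0 :+ :1))) (con 0) ≡.refl []

    total-start : ∀ c → c 0 ≈ 0# → total c 0 ≈ 0#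
    total-start c eq = trans (*-congʳ eq) (zeroˡ _)

    total₀ : ∀ n → total c₀ n ≈ h n
    total₀ zero    = trans (*-cong c₀-zero (t-zero 0)) (trans (*-identityˡ 1#) (sym h-zero))
    total₀ (suc n) = trans (total-step recurrence₀ n) (trans (+-cong (*-congˡ (total₀ n))
      (trans (*-congˡ (total-0 n)) (zeroʳ _))) (trans (+-identityʳ _) (sym (h-step n))))

    total₁ : ∀ n → total c₁ n ≈ h n * e₁ y n
    total₁ zero    = trans (total-start c₁ (trans (c₁-formula 0) (trans (*-congˡ (trans (*-congʳ τ-zero) (zeroˡ _))) (zeroʳ a)))) (sym (zeroʳ _))
    total₁ (suc n) = begin
      total c₁ (suc n)                                   ≈⟨ total-step recurrence₁ n ⟩
      m * total c₁ n + Q * total c₀ n                    ≈⟨ +-cong (*-congˡ (total₁ n)) (*-cong (sym (y-law n)) (total₀ n)) ⟩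
      m * (h n * e₁ y n) + m * y (suc n) * h n
        ≈⟨ identity (var 0F :* (var 1F :* var 2F) :+ var 0F :* var 3F :* var 1F) (var 0F :* var 1F :* (var 2F :+ var 3F)) ≡.refl
             (m ∷ h n ∷ e₁ y n ∷ y (suc n) ∷ []) ⟩
      m * h n * (e₁ y n + y (suc n))                     ≈⟨ *-congʳ (h-step n) ⟨
      h (suc n) * e₁ y (suc n)                           ∎
      where
      Q = x ^ suc n
      m = 1# + Q * Q + μ * Q

    total₂ : ∀ n → total c₂ n ≈ h n * e₂ y n
    total₂ zero    = trans (total-start c₂ (trans (c₂-formula 0)
      (trans (*-congˡ (trans (*-congʳ (trans (*-congʳ τ-zero) (zeroˡ _))) (zeroˡ _))) (zeroʳ b)))) (sym (zeroʳ _))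
    total₂ (suc n) = begin
      total c₂ (suc n)                                   ≈⟨ total-step recurrence₂ n ⟩
      m * total c₂ n + Q * total c₁ n                    ≈⟨ +-cong (*-congˡ (total₂ n)) (*-cong (sym (y-law n)) (total₁ n)) ⟩
      m * (h n * e₂ y n) + m * y (suc n) * (h n * e₁ y n)
        ≈⟨ identity (var 0F :* (var 1F :* var 2F) :+ var 0F :* var 3F :* (var 1F :* var 4F))
             (var 0F :* var 1F :* (var 2F :+ var 4F :* var 3F)) ≡.refl (m ∷ h n ∷ e₂ y n ∷ y (suc n) ∷ e₁ y n ∷ []) ⟩
      m * h n * (e₂ y n + e₁ y n * y (suc n))            ≈⟨ *-congʳ (h-step n) ⟨
      h (suc n) * e₂ y (suc n)                           ∎
      where
      Q = x ^ suc n
      m = 1# + Q * Q + μ * Q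

    module Limit {Φ λ′ : Carrier} (Φ-unit : Unit Φ) (DΦ : D Φ ≈ λ′ * Φ) (Φ-limit : ∀ n → f * h n ≈[ suc n ] Φ) where

      Φ≈theta : ∀ n → Φ ≈[ suc n ] theta c₀ n
      Φ≈theta n = ≈[]-trans (≈[]-sym (Φ-limit n)) (≈[]-trans (≈⇒≈[] (*-congˡ (sym (total₀ n)))) (f*total c₀ n))

      Φ*e : ∀ {c e n} → total c n ≈ h n * e → Φ * e ≈[ suc n ] theta c n
      Φ*e {c} {e} {n} eq = ≈[]-trans (*-cong[] (≈[]-sym (Φ-limit n)) (≈⇒≈[] refl))
        (≈[]-trans (≈⇒≈[] (trans (*-assoc f (h n) e) (*-congˡ (sym eq)))) (f*total c n))

      annihilated : ∀ {F} → Additive F → (∀ {n s t} → s ≈[ n ] t → F s ≈[ n ] F t) →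
        (∀ k → F (c₀ k * x ^ tri k) ≈ 0#) → F Φ ≈ 0#
      annihilated {F} add cong[] eq = ≈[]-separated (λ n → ≈[]-weaken (ℕ.n≤1+n n)
        (≈[]-trans (cong[] (Φ≈theta n)) (≈⇒≈[] (trans (theta-map {c = c₀} {c′ = λ _ → 0#} add (λ k → trans (eq k) (sym (zeroˡ _))) n)
          (theta-0 (λ _ → refl) n)))))

      -- D multiplies x^`tri k` by τ k L, so the factor τ k in c₁ turns the theta series of c₀ into
      -- its derivative, and division by Φ leaves λ′.
      e₁-limit : ∀ n → L * e₁ y n ≈[ suc n ] a * λ′
      e₁-limit n = cancel[] Φ-unit (≈[]-trans (≈⇒≈[] (trans (*-assoc L _ Φ) (*-congˡ (*-comm _ Φ))))
        (≈[]-trans (*-congˡ[] (Φ*e (total₁ n))) (≈[]-trans (≈⇒≈[] (sym derivative))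
        (≈[]-trans (*-congˡ[] (D-cong[] (≈[]-sym (Φ≈theta n)))) (≈⇒≈[] (trans (*-congˡ DΦ) (sym (*-assoc a λ′ Φ))))))))
        where
        derivative : a * D (theta c₀ n) ≈ L * theta c₁ n
        derivative = trans (theta-map {F = λ s → a * D s} {c′ = λ k → L * c₁ k}
          (record { F-cong = λ eq → *-congˡ (D-cong eq) ; F-+ = λ s t → trans (*-congˡ (D-+ s t)) (distribˡ a _ _) })
          (λ k → begin
            a * D (c₀ k * x ^ tri k)               ≈⟨ *-congˡ (D-term (c₀-constant k) k) ⟩
            a * (τ k * L * (c₀ k * x ^ tri k))
              ≈⟨ identity (var 0F :* (var 1F :* var 2F :* (var 3F :* var 4F))) (var 2F :* (var 0F :* (var 1F :* var 3F)) :* var 4F)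
                   ≡.refl (a ∷ τ k ∷ L ∷ c₀ k ∷ x ^ tri k ∷ []) ⟩
            L * (a * (τ k * c₀ k)) * x ^ tri k     ≈⟨ *-congʳ (*-congˡ (c₁-formula k)) ⟨
            L * c₁ k * x ^ tri k                   ∎) n)
          (theta-scale L c₁ n)

      -- Similarly, L² τ (τ - 1) is the eigenvalue of D (D - L) on x^`tri k`.
      e₂-limit : ∀ n → L * L * e₂ y n ≈[ suc n ] b * (D λ′ + λ′ * λ′ - L * λ′)
      e₂-limit n = cancel[] Φ-unit (≈[]-trans (≈⇒≈[] (trans (*-assoc (L * L) _ Φ) (*-congˡ (*-comm _ Φ))))
        (≈[]-trans (*-congˡ[] (Φ*e (total₂ n))) (≈[]-trans (≈⇒≈[] (sym derivative))
        (≈[]-trans (cong[] (≈[]-sym (Φ≈theta n))) (≈⇒≈[] value)))))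
        where
        F : Carrier → Carrier
        F s = b * (D (D s) + - L * D s)
        cong[] : ∀ {m s t} → s ≈[ m ] t → F s ≈[ m ] F t
        cong[] o = *-congˡ[] (+-cong[] (D-cong[] (D-cong[] o)) (*-congˡ[] (D-cong[] o)))
        value : F Φ ≈ b * (D λ′ + λ′ * λ′ - L * λ′) * Φ
        value = begin
          b * (D (D Φ) + - L * D Φ)
            ≈⟨ *-congˡ (+-cong (trans (D-cong DΦ) (trans (D-* λ′ Φ) (+-congˡ (*-congˡ DΦ)))) (*-congˡ DΦ)) ⟩
          b * (D λ′ * Φ + λ′ * (λ′ * Φ) + - L * (λ′ * Φ))
            ≈⟨ identity (var 0F :* (var 1F :* var 2F :+ var 3F :* (var 3F :* var 2F) :+ :- var 4F :* (var 3F :* var 2F)))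
                 (var 0F :* (var 1F :+ var 3F :* var 3F :- var 4F :* var 3F) :* var 2F) ≡.refl (b ∷ D λ′ ∷ Φ ∷ λ′ ∷ L ∷ []) ⟩
          b * (D λ′ + λ′ * λ′ - L * λ′) * Φ ∎
        derivative : F (theta c₀ n) ≈ L * L * theta c₂ n
        derivative = trans (theta-map {F = F} {c′ = λ k → L * L * c₂ k}
          (record
            { F-cong = λ eq → *-congˡ (+-cong (D-cong (D-cong eq)) (*-congˡ (D-cong eq)))
            ; F-+ = λ s t → trans (*-congˡ (trans (+-cong (trans (D-cong (D-+ s t)) (D-+ _ _)) (trans (*-congˡ (D-+ s t)) (distribˡ _ _ _)))
                (+-interchange _ _ _ _))) (distribˡ b _ _) })
          (λ k → let T = c₀ k * x ^ tri k ; m = τ k * L in begin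
            b * (D (D T) + - L * D T)
              ≈⟨ *-congˡ (+-cong (trans (D-cong (D-term (c₀-constant k) k))
                   (trans (D-constant-* (constant-* (τ-constant k) L-constant) T) (*-congˡ (D-term (c₀-constant k) k))))
                   (*-congˡ (D-term (c₀-constant k) k))) ⟩
            b * (m * (m * T) + - L * (m * T))
              ≈⟨ identity (var 0F :* (var 1F :* var 2F :* (var 1F :* var 2F :* (var 3F :* var 4F)) :+ :- var 2F :* (var 1F :* var 2F :* (var 3F :* var 4F))))
                   (var 2F :* var 2F :* (var 0F :* (var 1F :* (var 1F :- :1) :* var 3F)) :* var 4F) ≡.refl
                   (b ∷ τ k ∷ L ∷ c₀ k ∷ x ^ tri k ∷ []) ⟩
            L * L * (b * (τ k * (τ k - 1#) * c₀ k)) * x ^ tri k   ≈⟨ *-congʳ (*-congˡ (c₂-formula k)) ⟨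
            L * L * c₂ k * x ^ tri k ∎) n)
          (theta-scale (L * L) c₂ n)

τᵉ : ∀ {n} → Expr n → Expr n
τᵉ k = con 6 :* (k :* (k :+ :1))

-- The theta series of f³ and ψ and the operators that annihilate them.

module ThetaSeries {𝓕 : FilteredRing} {ℓ : ℕ} (𝓔 : EulerProduct 𝓕 ℓ) where
  open FilteredRing 𝓕
  open Kernel 𝓔
  open Theta 𝓔 public
  open SetoidReasoning setoid

  sgn : ℕ → Carrier
  sgn zero    = 1#
  sgn (suc k) = 10 · 1# * sgn k

  sgn-constant : ∀ k → Constant (sgn k)
  sgn-constant zero    = D-1
  sgn-constant (suc k) = constant-* (D-const 10) (sgn-constant k)

  -- The point z = -1, where μ = -2 and the factors are (1 - x^i)². Here c₀ is the limit (-1)^k (2k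
  -- + 1) of (z^k + z^(-1-k)) / (1 + z⁻¹). The two constants 7 are -1/3 and 1/30.
  cubeFamily : Family (9 · 1#)
  cubeFamily = record
    { c₀ = λ k → sgn k * (2 · 1# * (k · 1#) + 1#)
    ; c₁ = λ k → 7 · 1# * (τ k * (sgn k * (2 · 1# * (k · 1#) + 1#)))
    ; c₂ = λ k → 7 · 1# * (τ k * (τ k - 1#) * (sgn k * (2 · 1# * (k · 1#) + 1#)))
    ; h = λ n → g n * g n
    ; y = λ i → x ^ i * inv i * inv i
    ; a = 7 · 1# ; b = 7 · 1#
    ; c₀-constant = λ k → constant-* (sgn-constant k) (constant-+ (constant-* (D-const 2) (D-const k)) D-1)
    ; recurrence₀ = record
        { first = identity (p₀ (con 10 :* :1) (con 1)) (con 9 :* p₀ :1 (con 0) :+ con 0 :- p₀ :1 (con 0)) ≡.refl []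
        ; next  = λ k → identity (p₀ s″ k″) (con 9 :* p₀ s′ k′ :+ con 0 :- p₀ s₀ᵉ k₀) ≡.refl (sgn k ∷ k · 1# ∷ []) }
    ; recurrence₁ = record
        { first = identity (p₁ (con 10 :* :1) (con 1)) (con 9 :* p₁ :1 (con 0) :+ p₀ :1 (con 0) :- p₁ :1 (con 0)) ≡.refl []
        ; next  = λ k → identity (p₁ s″ k″) (con 9 :* p₁ s′ k′ :+ p₀ s′ k′ :- p₁ s₀ᵉ k₀) ≡.refl (sgn k ∷ k · 1# ∷ []) }
    ; recurrence₂ = record
        { first = identity (p₂ (con 10 :* :1) (con 1)) (con 9 :* p₂ :1 (con 0) :+ p₁ :1 (con 0) :- p₂ :1 (con 0)) ≡.refl []
        ; next  = λ k → identity (p₂ s″ k″) (con 9 :* p₂ s′ k′ :+ p₁ s′ k′ :- p₂ s₀ᵉ k₀) ≡.refl (sgn k ∷ k · 1# ∷ []) }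
    ; c₀-zero = identity (p₀ :1 (con 0)) :1 ≡.refl []
    ; c₁-formula = λ k → refl
    ; c₂-formula = λ k → refl
    ; h-zero = *-identityˡ 1#
    ; h-step = λ n → identity ((:1 :- var 0F) :* var 1F :* ((:1 :- var 0F) :* var 1F))
        ((:1 :+ var 0F :* var 0F :+ con 9 :* var 0F) :* (var 1F :* var 1F)) ≡.refl (x ^ suc n ∷ g n ∷ [])
    ; y-law = λ n → begin
        (1# + x ^ suc n * x ^ suc n + 9 · 1# * x ^ suc n) * (x ^ suc n * inv (suc n) * inv (suc n))
          ≈⟨ identity ((:1 :+ var 0F :* var 0F :+ con 9 :* var 0F) :* (var 0F :* var 1F :* var 1F))
               (var 0F :* ((:1 :- var 0F) :* var 1F) :* ((:1 :- var 0F) :* var 1F)) ≡.refl (x ^ suc n ∷ inv (suc n) ∷ []) ⟩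
        x ^ suc n * ((1# - x ^ suc n) * inv (suc n)) * ((1# - x ^ suc n) * inv (suc n))
          ≈⟨ *-cong (trans (*-congˡ (inv-law n)) (*-identityʳ _)) (inv-law n) ⟩
        x ^ suc n * 1#   ≈⟨ *-identityʳ _ ⟩
        x ^ suc n        ∎
    }
    where
    p₀ p₁ p₂ : ∀ {n} → Expr n → Expr n → Expr n
    p₀ s k = s :* (con 2 :* k :+ :1)
    p₁ s k = con 7 :* (τᵉ k :* p₀ s k)
    p₂ s k = con 7 :* (τᵉ k :* (τᵉ k :- :1) :* p₀ s k)
    s₀ᵉ s′ s″ k₀ k′ k″ : Expr 2
    s₀ᵉ = var 0F
    s′ = con 10 :* s₀ᵉ
    s″ = con 10 :* s′
    k₀ = var 1F
    k′ = :1 :+ k₀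
    k″ = :1 :+ k′

  module Cube {α : Carrier} (Df : D f ≈ α * f) where

    Df^ : ∀ n → D (f ^ n) ≈ n · 1# * α * f ^ n
    Df^ = D-^ Df

    open Family.Limit cubeFamily {Φ = f ^ 3} {λ′ = 3 · 1# * α} (unit-^ f-unit 3) (Df^ 3)
      (λ n → ≈[]-trans (*-congˡ[] (*-cong[] (≈[]-sym (f-limit n)) (≈[]-sym (f-limit n))))
        (≈⇒≈[] (identity (var 0F :* (var 0F :* var 0F)) (var 0F :^ 3) ≡.refl (f ∷ [])))) public

    -- Completing the square, τ k + 7 = (2k + 1)² / 8. As 1/8 is not a square, the fifth power of L
    -- times this is -L⁵, unless 2k + 1 vanishes modulo 11, and then so does the coefficient. The
    -- factor K¹¹ - K expresses this for all k at once.
    cube-equation : ∀ {e m} → e · 1# ≈ 7 · 1# * L → m · 1# ≈ L ^ 5 → shifted e 5 (f ^ 3) + m · 1# * f ^ 3 ≈ 0#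
    cube-equation {e} {m} e≈ m≈ = annihilated
      (record { F-cong = λ eq → +-cong (shifted-cong e 5 eq) (*-congˡ eq)
              ; F-+ = λ s t → trans (+-cong (shifted-+ e 5 s t) (distribˡ _ s t)) (+-interchange _ _ _ _) })
      (λ o → +-cong[] (shifted-cong[] e 5 o) (*-congˡ[] o))
      (λ k → let K = k · 1# ; T = sgn k * (2 · 1# * K + 1#) * x ^ tri k in begin
        shifted e 5 T + m · 1# * T
          ≈⟨ +-cong (trans (shifted-term e 5 (Family.c₀-constant cubeFamily k) k) (*-congʳ (^-congˡ 5 (+-congˡ e≈)))) (*-congʳ m≈) ⟩
        (τ k * L + 7 · 1# * L) ^ 5 * T + L ^ 5 * T
          ≈⟨ identity
               ((τᵉ (var 0F) :* var 1F :+ con 7 :* var 1F) :^ 5 :* (var 2F :* (con 2 :* var 0F :+ :1) :* var 3F)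
                 :+ var 1F :^ 5 :* (var 2F :* (con 2 :* var 0F :+ :1) :* var 3F))
               (con 9 :* var 1F :^ 5 :* var 2F :* var 3F :* (var 0F :^ 11 :- var 0F)) ≡.refl (K ∷ L ∷ sgn k ∷ x ^ tri k ∷ []) ⟩
        9 · 1# * L ^ 5 * sgn k * x ^ tri k * (K ^ 11 - K)
          ≈⟨ trans (*-congˡ (trans (+-congʳ (·1-^11 k)) (-‿inverseʳ K))) (zeroʳ _) ⟩
        0# ∎)

  module Psi {p r : ℕ → Carrier} (p-zero : p 0 ≈ 1#) (p-step : ∀ n → p (suc n) ≈ (1# + x ^ suc n) * p n)
    (r-law : ∀ n → (1# + x ^ suc n) * r (suc n) ≈ 1#) where

    -- The point z = 1, with factors (1 + x^i)². The coefficients of ε and ε² are the binomials C(k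
    -- + 1, 2) and C(k + 2, 4); the latter is τ (τ - 1) / 6, and 2 = 1/6.
    psiFamily : Family (2 · 1#)
    psiFamily = record
      { c₀ = λ k → 1#
      ; c₁ = τ
      ; c₂ = λ k → 2 · 1# * (τ k * (τ k - 1#) * 1#)
      ; h = λ n → p n * p n
      ; y = λ i → x ^ i * r i * r i
      ; a = 1# ; b = 2 · 1#
      ; c₀-constant = λ k → D-1
      ; recurrence₀ = record
          { first = identity :1 (con 2 :* :1 :+ con 0 :- :1) ≡.refl []
          ; next  = λ k → identity :1 (con 2 :* :1 :+ con 0 :- :1) ≡.refl [] }
      ; recurrence₁ = record
          { first = identity (τᵉ (con 1)) (con 2 :* τᵉ (con 0) :+ :1 :- τᵉ (con 0)) ≡.refl []
          ; next  = λ k → identity (τᵉ k″) (con 2 :* τᵉ k′ :+ :1 :- τᵉ k₀) ≡.refl (k · 1# ∷ []) }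
      ; recurrence₂ = record
          { first = identity (p₂ (con 1)) (con 2 :* p₂ (con 0) :+ τᵉ (con 0) :- p₂ (con 0)) ≡.refl []
          ; next  = λ k → identity (p₂ k″) (con 2 :* p₂ k′ :+ τᵉ k′ :- p₂ k₀) ≡.refl (k · 1# ∷ []) }
      ; c₀-zero = refl
      ; c₁-formula = λ k → sym (trans (*-identityˡ _) (*-identityʳ _))
      ; c₂-formula = λ k → refl
      ; h-zero = trans (*-cong p-zero p-zero) (*-identityˡ 1#)
      ; h-step = λ n → trans (*-cong (p-step n) (p-step n)) (identity ((:1 :+ var 0F) :* var 1F :* ((:1 :+ var 0F) :* var 1F))
          ((:1 :+ var 0F :* var 0F :+ con 2 :* var 0F) :* (var 1F :* var 1F)) ≡.refl (x ^ suc n ∷ p n ∷ []))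
      ; y-law = λ n → begin
          (1# + x ^ suc n * x ^ suc n + 2 · 1# * x ^ suc n) * (x ^ suc n * r (suc n) * r (suc n))
            ≈⟨ identity ((:1 :+ var 0F :* var 0F :+ con 2 :* var 0F) :* (var 0F :* var 1F :* var 1F))
                 (var 0F :* ((:1 :+ var 0F) :* var 1F) :* ((:1 :+ var 0F) :* var 1F)) ≡.refl (x ^ suc n ∷ r (suc n) ∷ []) ⟩
          x ^ suc n * ((1# + x ^ suc n) * r (suc n)) * ((1# + x ^ suc n) * r (suc n))
            ≈⟨ *-cong (trans (*-congˡ (r-law n)) (*-identityʳ _)) (r-law n) ⟩
          x ^ suc n * 1#   ≈⟨ *-identityʳ _ ⟩
          x ^ suc n        ∎
      }
      where
      p₂ : ∀ {n} → Expr n → Expr n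
      p₂ k = con 2 :* (τᵉ k :* (τᵉ k :- :1) :* :1)
      k₀ k′ k″ : Expr 1
      k₀ = var 0F
      k′ = :1 :+ k₀
      k″ = :1 :+ k′

    module PsiLimit {ψ σ : Carrier} (ψ-unit : Unit ψ) (Dψ : D ψ ≈ σ * ψ) (ψ-limit : ∀ n → f * (p n * p n) ≈[ suc n ] ψ) where

      open Family.Limit psiFamily ψ-unit Dψ ψ-limit public

      -- The exponents are those of f³, but now the terms with 2k + 1 = 0 modulo 11 have coefficient
      -- 1, so a further factor D + e is needed to kill them.
      psi-equation : ∀ {e m} → e · 1# ≈ 7 · 1# * L → m · 1# ≈ L ^ 5 → shifted e 6 ψ + m · 1# * shifted e 1 ψ ≈ 0#
      psi-equation {e} {m} e≈ m≈ = annihilated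
        (record { F-cong = λ eq → +-cong (shifted-cong e 6 eq) (*-congˡ (shifted-cong e 1 eq))
                ; F-+ = λ s t → trans (+-cong (shifted-+ e 6 s t) (trans (*-congˡ (shifted-+ e 1 s t)) (distribˡ _ _ _))) (+-interchange _ _ _ _) })
        (λ o → +-cong[] (shifted-cong[] e 6 o) (*-congˡ[] (shifted-cong[] e 1 o)))
        (λ k → let K = k · 1# ; T = 1# * x ^ tri k in begin
          shifted e 6 T + m · 1# * shifted e 1 T
            ≈⟨ +-cong (trans (shifted-term e 6 D-1 k) (*-congʳ (^-congˡ 6 (+-congˡ e≈))))
                 (*-cong m≈ (trans (shifted-term e 1 D-1 k) (*-congʳ (^-congˡ 1 (+-congˡ e≈))))) ⟩
          (τ k * L + 7 · 1# * L) ^ 6 * T + L ^ 5 * ((τ k * L + 7 · 1# * L) ^ 1 * T)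
            ≈⟨ identity
                 ((τᵉ (var 0F) :* var 1F :+ con 7 :* var 1F) :^ 6 :* (:1 :* var 2F)
                   :+ var 1F :^ 5 :* ((τᵉ (var 0F) :* var 1F :+ con 7 :* var 1F) :^ 1 :* (:1 :* var 2F)))
                 (var 1F :^ 6 :* (con 5 :* var 0F :+ con 8) :* var 2F :* (var 0F :^ 11 :- var 0F)) ≡.refl (K ∷ L ∷ x ^ tri k ∷ []) ⟩
          L ^ 6 * (5 · 1# * K + 8 · 1#) * x ^ tri k * (K ^ 11 - K)
            ≈⟨ trans (*-congˡ (trans (+-congʳ (·1-^11 k)) (-‿inverseʳ K))) (zeroʳ _) ⟩
          0# ∎)

-- Shanks' proof of Euler's pentagonal number theorem.
module Pentagonal {𝓕 : FilteredRing} {ℓ : ℕ} (𝓔 : EulerProduct 𝓕 ℓ) where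
  open FilteredRing 𝓕
  open Kernel 𝓔
  open ThetaSeries 𝓔
  open SetoidReasoning setoid

  shanks : ℕ → ℕ → Carrier
  shanks n s = sgn s * (g n * g⁻ s) * x ^ (s ℕ.* n ℕ.+ tri s)

  boundary : ℕ → ℕ → Carrier
  boundary n zero    = 0#
  boundary n (suc s) = sgn (suc s) * (g n * g⁻ s) * x ^ (suc s ℕ.* n ℕ.+ tri (suc s))

  -- Row n + 1 has the extra factor x^s (1 - x^(n+1)) = 1 - (1 - x^s) - x^(s+n+1). In the middle
  -- part 1 - x^s cancels the last factor of `g⁻ s`; the last part has the opposite sign and the
  -- exponent of s + 1. Hence the sum over s telescopes.
  shanks-step : ∀ n s → shanks (suc n) s ≈ shanks n s - boundary n s + boundary n (suc s)
  shanks-step n zero    = trans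
    (identity
      (:1 :* ((:1 :- var 0F :* var 1F) :* var 2F :* :1) :* :1)
      (:1 :* (var 2F :* :1) :* :1 :- con 0 :+ con 10 :* :1 :* (var 2F :* :1) :* (var 0F :* var 1F))
      ≡.refl (x ∷ x ^ n ∷ g n ∷ []))
    (+-congˡ (*-congˡ (reindex (x ^_) (≡.sym (≡.trans (≡.cong (ℕ._+ 1) (ℕ.+-identityʳ n)) (ℕ.+-comm n 1))))))
  shanks-step n (suc s) = begin
    sgn (suc s) * ((1# - Xⁿ) * g n * (I * g⁻ s)) * x ^ (suc s ℕ.* suc n ℕ.+ tri (suc s))
      ≈⟨ *-congˡ e-both ⟩
    sgn (suc s) * ((1# - Xⁿ) * g n * (I * g⁻ s)) * (Xˢ * P)
      ≈⟨ identity (var 0F :* ((:1 :- var 1F) :* var 2F :* (var 3F :* var 4F)) :* (var 5F :* var 6F))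
           (var 0F :* (var 2F :* (var 3F :* var 4F)) :* var 6F :- var 0F :* (var 2F :* var 4F) :* var 6F :* ((:1 :- var 5F) :* var 3F)
             :+ con 10 :* var 0F :* (var 2F :* (var 3F :* var 4F)) :* (var 5F :* var 1F :* var 6F)) ≡.refl
           (sgn (suc s) ∷ Xⁿ ∷ g n ∷ I ∷ g⁻ s ∷ Xˢ ∷ P ∷ []) ⟩
    shanks n (suc s) - boundary n (suc s) * ((1# - Xˢ) * I)
      + 10 · 1# * sgn (suc s) * (g n * g⁻ (suc s)) * (Xˢ * Xⁿ * P)
      ≈⟨ +-cong (+-congˡ (-‿cong (trans (*-congˡ (inv-law s)) (*-identityʳ _)))) (*-congˡ (sym e-next)) ⟩
    shanks n (suc s) - boundary n (suc s) + boundary n (suc (suc s)) ∎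
    where
    I = inv (suc s)
    Xⁿ = x ^ suc n
    Xˢ = x ^ suc s
    P = x ^ (suc s ℕ.* n ℕ.+ tri (suc s))
    e-both : x ^ (suc s ℕ.* suc n ℕ.+ tri (suc s)) ≈ Xˢ * P
    e-both = trans (reindex (x ^_) (≡.trans (≡.cong (ℕ._+ tri (suc s)) (ℕ.*-suc (suc s) n)) (ℕ.+-assoc (suc s) _ _)))
      (^-homo-* x (suc s) _)
    e-next : x ^ (suc (suc s) ℕ.* n ℕ.+ tri (suc (suc s))) ≈ Xˢ * Xⁿ * P
    e-next = begin
      x ^ (n ℕ.+ suc s ℕ.* n ℕ.+ tri (suc (suc s)))
        ≈⟨ trans (^-homo-* x (n ℕ.+ suc s ℕ.* n) _) (*-cong (^-homo-* x n _) (^-homo-* x (suc (suc s)) (tri (suc s)))) ⟩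
      x ^ n * x ^ (suc s ℕ.* n) * (x * Xˢ * x ^ tri (suc s))
        ≈⟨ identity (var 0F :* var 1F :* (var 2F :* var 3F :* var 4F)) (var 3F :* (var 2F :* var 0F) :* (var 1F :* var 4F)) ≡.refl
             (x ^ n ∷ x ^ (suc s ℕ.* n) ∷ x ∷ Xˢ ∷ x ^ tri (suc s) ∷ []) ⟩
      Xˢ * Xⁿ * (x ^ (suc s ℕ.* n) * x ^ tri (suc s))
        ≈⟨ *-congˡ (^-homo-* x (suc s ℕ.* n) (tri (suc s))) ⟨
      Xˢ * Xⁿ * P ∎

  shanksSum : ℕ → ℕ → Carrier
  shanksSum n zero    = shanks n 0
  shanksSum n (suc m) = shanksSum n m + shanks n (suc m)

  shanksSum-step : ∀ n m → shanksSum (suc n) m ≈ shanksSum n m + boundary n (suc m)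
  shanksSum-step n zero    = trans (shanks-step n 0) (+-congʳ (identity (var 0F :- con 0) (var 0F) ≡.refl (shanks n 0 ∷ [])))
  shanksSum-step n (suc m) = trans (+-cong (shanksSum-step n m) (shanks-step n (suc m)))
    (identity (var 0F :+ var 1F :+ (var 2F :- var 1F :+ var 3F)) (var 0F :+ var 2F :+ var 3F) ≡.refl
      (shanksSum n m ∷ boundary n (suc m) ∷ shanks n (suc m) ∷ boundary n (suc (suc m)) ∷ []))

  shanksSum-limit : ∀ n m → shanksSum n m ≈[ suc n ] f
  shanksSum-limit n zero    = ≈[]-trans (≈⇒≈[] (identity (:1 :* (var 0F :* :1) :* :1) (var 0F) ≡.refl (g n ∷ []))) (≈[]-sym (f-limit n))
  shanksSum-limit n (suc m) = ≈[]-trans (+-cong[] (shanksSum-limit n m) small) (≈⇒≈[] (+-identityʳ f))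
    where
    bound : suc n ≤ suc m ℕ.* n ℕ.+ tri (suc m)
    bound = ℕ.≤-trans (ℕ.≤-reflexive (ℕ.+-comm 1 n)) (ℕ.+-mono-≤ (ℕ.m≤m+n n (m ℕ.* n)) (s≤s z≤n))
    small : shanks n (suc m) ≈[ suc n ] 0#
    small = O-resp (identity (var 0F) (var 0F :- con 0) ≡.refl (shanks n (suc m) ∷ []))
      (O-weaken bound (O-*ˡ _ (O-^ x-O (suc m ℕ.* n ℕ.+ tri (suc m)))))

  operator : ℕ → ℕ → Carrier → Carrier
  operator e m s = shifted e 6 s + m · 1# * shifted e 1 s

  module _ {e m : ℕ} (e≈ : e · 1# ≈ 6 · 1# * L) (m≈ : m · 1# ≈ L ^ 5) where

    operator-+ : ∀ s t → operator e m (s + t) ≈ operator e m s + operator e m t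
    operator-+ s t = trans (+-cong (shifted-+ e 6 s t) (trans (*-congˡ (shifted-+ e 1 s t)) (distribˡ _ _ _))) (+-interchange _ _ _ _)

    operator-cong : ∀ {s t} → s ≈ t → operator e m s ≈ operator e m t
    operator-cong eq = +-cong (shifted-cong e 6 eq) (*-congˡ (shifted-cong e 1 eq))

    operator-term : ∀ {c} k → Constant c →
      operator e m (c * x ^ k) ≈ ((k · 1# * L + 6 · 1# * L) ^ 6 + L ^ 5 * (k · 1# * L + 6 · 1# * L) ^ 1) * (c * x ^ k)
    operator-term {c} k const = trans
      (+-cong (trans (shifted-eigen e 6 eigen-constant eigen) (*-congʳ (^-congˡ 6 (+-congˡ e≈))))
        (trans (*-cong m≈ (trans (shifted-eigen e 1 eigen-constant eigen) (*-congʳ (^-congˡ 1 (+-congˡ e≈))))) (sym (*-assoc _ _ _))))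
      (sym (distribʳ _ _ _))
      where
      eigen-constant : Constant (k · 1# * L)
      eigen-constant = constant-* (D-const k) L-constant
      eigen : D (c * x ^ k) ≈ k · 1# * L * (c * x ^ k)
      eigen = trans (D-constant-* const _) (trans (*-congˡ (D-^ D-x k)) (*-swap c _ _))

    exponent : ∀ j n → (suc n ℕ.* j ℕ.+ tri (suc n)) · 1# ≈ (suc n · 1#) * (j · 1#) + τ (suc n)
    exponent j n = trans (×-homo-+ 1# (suc n ℕ.* j) (tri (suc n))) (+-cong (×1-homo-* (suc n) j) (tri≈τ (suc n)))

    -- With k = n + 1 and j = n or j = n + 1 the exponent is k (3k - 1) / 2 or k (3k + 1) / 2, and
    -- adding 6 = 1/24 completes it to (6k ∓ 1)² / 24. As 1/24 is not a square, M⁶ + L⁵ M vanishes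
    -- at every k modulo 11, hence is divisible by K¹¹ - K; `p` is the cofactor.
    pentagonal-term : ∀ j n p →
      (let K = suc n · 1# ; M = (K * (j · 1#) + τ (suc n)) * L + 6 · 1# * L in M ^ 6 + L ^ 5 * M ^ 1 ≈ p * (K ^ 11 - K)) →
      operator e m (sgn (suc n) * (g n * g⁻ n) * x ^ (suc n ℕ.* j ℕ.+ tri (suc n))) ≈ 0#
    pentagonal-term j n p eq = begin
      operator e m (sgn (suc n) * (g n * g⁻ n) * x ^ E)
        ≈⟨ trans (operator-cong (*-congʳ (trans (*-congˡ (g-inv n)) (*-identityʳ _)))) (operator-term E (sgn-constant (suc n))) ⟩
      ((E · 1# * L + 6 · 1# * L) ^ 6 + L ^ 5 * (E · 1# * L + 6 · 1# * L) ^ 1) * (sgn (suc n) * x ^ E)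
        ≈⟨ *-congʳ (+-cong (^-congˡ 6 E≈) (*-congˡ (^-congˡ 1 E≈))) ⟩
      (M ^ 6 + L ^ 5 * M ^ 1) * (sgn (suc n) * x ^ E)
        ≈⟨ *-congʳ (trans eq (trans (*-congˡ (trans (+-congʳ (·1-^11 (suc n))) (-‿inverseʳ K))) (zeroʳ p))) ⟩
      0# * (sgn (suc n) * x ^ E)   ≈⟨ zeroˡ _ ⟩
      0#                           ∎
      where
      E = suc n ℕ.* j ℕ.+ tri (suc n)
      K = suc n · 1#
      M = (K * (j · 1#) + τ (suc n)) * L + 6 · 1# * L
      E≈ : E · 1# * L + 6 · 1# * L ≈ M
      E≈ = +-congʳ (*-congʳ (exponent j n))

    boundary-term : ∀ n → operator e m (boundary n (suc n)) ≈ 0#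
    boundary-term n = pentagonal-term n n (L ^ 6 * (4 · 1# * (suc n · 1#) + 3 · 1#))
      (identity (M :^ 6 :+ var 0F :^ 5 :* M :^ 1) (var 0F :^ 6 :* (con 4 :* K :+ con 3) :* (K :^ 11 :- K)) ≡.refl (L ∷ n · 1# ∷ []))
      where
      K M : Expr 2
      K = :1 :+ var 1F
      M = (K :* var 1F :+ τᵉ K) :* var 0F :+ con 6 :* var 0F

    diagonal-term : ∀ n → operator e m (shanks (suc n) (suc n)) ≈ 0#
    diagonal-term n = trans
      (operator-cong (*-congʳ (*-congˡ (trans (g-inv (suc n)) (sym (g-inv n))))))
      (pentagonal-term (suc n) n (L ^ 6 * (4 · 1# * (suc n · 1#) + 8 · 1#))
        (identity (M :^ 6 :+ var 0F :^ 5 :* M :^ 1) (var 0F :^ 6 :* (con 4 :* K :+ con 8) :* (K :^ 11 :- K)) ≡.refl (L ∷ n · 1# ∷ [])))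
      where
      K M : Expr 2
      K = :1 :+ var 1F
      M = (K :* K :+ τᵉ K) :* var 0F :+ con 6 :* var 0F

    -- From n to n + 1 the sum gains exactly the two terms of the (n + 1)-st pair of pentagonal
    -- numbers, both killed by the operator.
    operator-sum : ∀ n → operator e m (shanksSum n n) ≈ 0#
    operator-sum zero    = begin
      operator e m (1# * (1# * 1#) * 1#)
        ≈⟨ trans (operator-cong (*-congʳ (trans (*-identityˡ _) (*-identityˡ 1#)))) (operator-term 0 D-1) ⟩
      ((0# * L + 6 · 1# * L) ^ 6 + L ^ 5 * (0# * L + 6 · 1# * L) ^ 1) * (1# * 1#)
        ≈⟨ identity (((con 0 :* var 0F :+ con 6 :* var 0F) :^ 6 :+ var 0F :^ 5 :* (con 0 :* var 0F :+ con 6 :* var 0F) :^ 1) :* (:1 :* :1))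
             (con 0) ≡.refl (L ∷ []) ⟩
      0# ∎
    operator-sum (suc n) = begin
      operator e m (shanksSum (suc n) n + shanks (suc n) (suc n))
        ≈⟨ trans (operator-+ _ _) (+-cong (trans (operator-cong (shanksSum-step n n)) (operator-+ _ _)) (diagonal-term n)) ⟩
      operator e m (shanksSum n n) + operator e m (boundary n (suc n)) + 0#
        ≈⟨ trans (+-identityʳ _) (trans (+-cong (operator-sum n) (boundary-term n)) (+-identityˡ 0#)) ⟩
      0# ∎

    pentagonal-equation : operator e m f ≈ 0#
    pentagonal-equation = ≈[]-separated (λ n → ≈[]-weaken (ℕ.n≤1+n n) (≈[]-trans
      (+-cong[] (shifted-cong[] e 6 (≈[]-sym (shanksSum-limit n n))) (*-congˡ[] (shifted-cong[] e 1 (≈[]-sym (shanksSum-limit n n)))))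
      (≈⇒≈[] (operator-sum n))))

-- The products f₁ and f₂ together: the differential equation for W and S and the invariant
-- monomials.

module LevelTwo {𝓕 : FilteredRing} (𝓔₁ : EulerProduct 𝓕 1) (𝓔₂ : EulerProduct 𝓕 2)
  (x₂≈x₁² : FilteredRing._≈_ 𝓕 (EulerProduct.x 𝓔₂) (FilteredRing._*_ 𝓕 (EulerProduct.x 𝓔₁) (EulerProduct.x 𝓔₁)))
  where
  open FilteredRing 𝓕
  open ModularEquations differentialRing
  open SetoidReasoning setoid

  module E₁ = Kernel 𝓔₁
  module E₂ = Kernel 𝓔₂
  module T₁ = ThetaSeries 𝓔₁
  module T₂ = ThetaSeries 𝓔₂

  f₁ f₁⁻ f₂ f₂⁻ α β : Carrier
  f₁ = E₁.f
  f₁⁻ = E₁.f⁻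
  f₂ = E₂.f
  f₂⁻ = E₂.f⁻
  α = D f₁ * f₁⁻
  β = D f₂ * f₂⁻

  D-log : ∀ {s s⁻} → s * s⁻ ≈ 1# → D s ≈ D s * s⁻ * s
  D-log {s} {s⁻} inv = sym (trans (*-assoc _ _ _) (trans (*-congˡ (trans (*-comm s⁻ s) inv)) (*-identityʳ _)))

  Df₁ : D f₁ ≈ α * f₁
  Df₁ = D-log E₁.f-inv

  Df₂ : D f₂ ≈ β * f₂
  Df₂ = D-log E₂.f-inv

  Df₁⁻ : D f₁⁻ ≈ 10 · 1# * α * f₁⁻
  Df₁⁻ = cancel T₁.f-unit (begin
    D f₁⁻ * f₁
      ≈⟨ identity (var 0F :* var 1F) (var 3F :* var 1F :* var 2F :+ var 1F :* var 0F :- var 3F :* (var 1F :* var 2F)) ≡.refl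
           (D f₁⁻ ∷ f₁ ∷ f₁⁻ ∷ α ∷ []) ⟩
    α * f₁ * f₁⁻ + f₁ * D f₁⁻ - α * (f₁ * f₁⁻)
      ≈⟨ +-congʳ (trans (+-congʳ (*-congʳ (sym Df₁))) (trans (sym (D-* f₁ f₁⁻)) (trans (D-cong E₁.f-inv) D-1))) ⟩
    0# - α * (f₁ * f₁⁻)
      ≈⟨ identity (con 0 :- var 0F :* (var 1F :* var 2F)) (con 10 :* var 0F :* var 2F :* var 1F) ≡.refl (α ∷ f₁ ∷ f₁⁻ ∷ []) ⟩
    10 · 1# * α * f₁⁻ * f₁ ∎)

  x₂^ : ∀ n → E₂.x ^ n ≈ E₁.x ^ n * E₁.x ^ n
  x₂^ zero    = sym (*-identityˡ 1#)
  x₂^ (suc n) = trans (*-cong x₂≈x₁² (x₂^ n))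
    (identity (var 0F :* var 0F :* (var 1F :* var 1F)) (var 0F :* var 1F :* (var 0F :* var 1F)) ≡.refl (E₁.x ∷ E₁.x ^ n ∷ []))

  -- The product of the 1 + x^i for i ≤ n and the inverse of 1 + x^i, both by way of 1 - x^(2i) = (1
  -- - x^i)(1 + x^i).
  p r : ℕ → Carrier
  p n = E₂.g n * E₁.g⁻ n
  r i = (1# - E₁.x ^ i) * E₂.inv i

  p-step : ∀ n → p (suc n) ≈ (1# + E₁.x ^ suc n) * p n
  p-step n = begin
    (1# - E₂.x ^ suc n) * E₂.g n * (I * E₁.g⁻ n)  ≈⟨ *-congʳ (*-congʳ (+-congˡ (-‿cong (x₂^ (suc n))))) ⟩
    (1# - X * X) * E₂.g n * (I * E₁.g⁻ n)
      ≈⟨ identity ((:1 :- var 0F :* var 0F) :* var 1F :* (var 2F :* var 3F)) ((:1 :+ var 0F) :* (var 1F :* var 3F) :* ((:1 :- var 0F) :* var 2F))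
           ≡.refl (X ∷ E₂.g n ∷ I ∷ E₁.g⁻ n ∷ []) ⟩
    (1# + X) * p n * ((1# - X) * I)               ≈⟨ trans (*-congˡ (E₁.inv-law n)) (*-identityʳ _) ⟩
    (1# + X) * p n                                ∎
    where
    X = E₁.x ^ suc n
    I = E₁.inv (suc n)

  r-law : ∀ n → (1# + E₁.x ^ suc n) * r (suc n) ≈ 1#
  r-law n = begin
    (1# + X) * ((1# - X) * I)
      ≈⟨ identity ((:1 :+ var 0F) :* ((:1 :- var 0F) :* var 1F)) ((:1 :- var 0F :* var 0F) :* var 1F) ≡.refl (X ∷ I ∷ []) ⟩
    (1# - X * X) * I           ≈⟨ *-congʳ (+-congˡ (-‿cong (x₂^ (suc n)))) ⟨
    (1# - E₂.x ^ suc n) * I    ≈⟨ E₂.inv-law n ⟩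
    1#                         ∎
    where
    X = E₁.x ^ suc n
    I = E₂.inv (suc n)

  ψ σ : Carrier
  ψ = f₂ * f₂ * f₁⁻
  σ = 2 · 1# * β + 10 · 1# * α

  ψ-unit : Unit ψ
  ψ-unit = T₁.unit-* (T₁.unit-* T₂.f-unit T₂.f-unit) (f₁ , trans (*-comm _ _) E₁.f-inv)

  Dψ : D ψ ≈ σ * ψ
  Dψ = begin
    D (f₂ * f₂ * f₁⁻)
      ≈⟨ trans (D-* _ _) (+-cong (*-congʳ (trans (D-* f₂ f₂) (+-cong (*-congʳ Df₂) (*-congˡ Df₂)))) (*-congˡ Df₁⁻)) ⟩
    (β * f₂ * f₂ + f₂ * (β * f₂)) * f₁⁻ + f₂ * f₂ * (10 · 1# * α * f₁⁻)
      ≈⟨ identity ((var 0F :* var 1F :* var 1F :+ var 1F :* (var 0F :* var 1F)) :* var 2F :+ var 1F :* var 1F :* (con 10 :* var 3F :* var 2F))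
           ((con 2 :* var 0F :+ con 10 :* var 3F) :* (var 1F :* var 1F :* var 2F)) ≡.refl (β ∷ f₂ ∷ f₁⁻ ∷ α ∷ []) ⟩
    σ * ψ ∎

  p-limit : ∀ n → p n ≈[ suc n ] f₂ * f₁⁻
  p-limit n = *-cong[] (≈[]-sym (E₂.f-limit n)) (cancel[] (T₁.g-unit n) (≈[]-trans
    (≈⇒≈[] (trans (trans (*-comm _ _) (E₁.g-inv n)) (trans (sym E₁.f-inv) (*-comm f₁ f₁⁻)))) (*-congˡ[] (E₁.f-limit n))))

  ψ-limit : ∀ n → f₁ * (p n * p n) ≈[ suc n ] ψ
  ψ-limit n = ≈[]-trans (*-congˡ[] (*-cong[] (p-limit n) (p-limit n))) (≈⇒≈[] (begin
    f₁ * (f₂ * f₁⁻ * (f₂ * f₁⁻))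
      ≈⟨ identity (var 0F :* (var 1F :* var 2F :* (var 1F :* var 2F))) (var 1F :* var 1F :* var 2F :* (var 0F :* var 2F)) ≡.refl (f₁ ∷ f₂ ∷ f₁⁻ ∷ []) ⟩
    ψ * (f₁ * f₁⁻)   ≈⟨ trans (*-congˡ E₁.f-inv) (*-identityʳ ψ) ⟩
    ψ                ∎))

  module J = T₁.Cube Df₁
  module K = T₂.Cube Df₂
  module Ψ where
    open T₁.Psi {p} {r} (*-identityˡ 1#) p-step r-law public
    open PsiLimit ψ-unit Dψ ψ-limit public

  y₁ y₂ u : ℕ → Carrier
  y₁ i = E₁.x ^ i * E₁.inv i * E₁.inv i
  y₂ i = E₂.x ^ i * E₂.inv i * E₂.inv i
  u i  = E₁.x ^ i * r i * r i

  -- Newton's formula for the sum of squares, with 9 = -2.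
  powerSum : (ℕ → Carrier) → ℕ → Carrier
  powerSum y n = e₁ y n * e₁ y n + 9 · 1# * e₂ y n

  -- With a = x^i, y₁ = a / (1 - a)², y₂ = a² / (1 - a²)² and u = a / (1 + a)².
  u² : ∀ n → u (suc n) * u (suc n) ≈
    10 · 1# * (y₁ (suc n) * y₁ (suc n)) + 2 · 1# * y₂ (suc n) + 5 · 1# * (y₂ (suc n) * y₂ (suc n))
  u² n = begin
    a * ((1# - a) * v) * ((1# - a) * v) * (a * ((1# - a) * v) * ((1# - a) * v))
      ≈⟨ identity
           (A :* ((:1 :- A) :* V) :* ((:1 :- A) :* V) :* (A :* ((:1 :- A) :* V) :* ((:1 :- A) :* V)))
           (con 10 :* (A :* ((:1 :+ A) :* V) :* ((:1 :+ A) :* V) :* (A :* ((:1 :+ A) :* V) :* ((:1 :+ A) :* V)))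
             :+ con 2 :* (A :* A :* V :* V :* ((:1 :- A :* A) :* V) :* ((:1 :- A :* A) :* V)) :+ con 5 :* (A :* A :* V :* V :* (A :* A :* V :* V)))
           ≡.refl (a ∷ v ∷ []) ⟩
    10 · 1# * (a * ((1# + a) * v) * ((1# + a) * v) * (a * ((1# + a) * v) * ((1# + a) * v)))
      + 2 · 1# * (a * a * v * v * ((1# - a * a) * v) * ((1# - a * a) * v)) + 5 · 1# * (a * a * v * v * (a * a * v * v))
      ≈⟨ +-cong (+-cong (*-congˡ (*-cong y₁≈ y₁≈)) (*-congˡ (trans (*-cong (trans (*-congˡ unit) (*-identityʳ _)) unit)
           (trans (*-identityʳ _) y₂≈)))) (*-congˡ (*-cong y₂≈ y₂≈)) ⟩
    10 · 1# * (y₁ (suc n) * y₁ (suc n)) + 2 · 1# * y₂ (suc n) + 5 · 1# * (y₂ (suc n) * y₂ (suc n)) ∎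
    where
    A V : Expr 2
    A = var 0F
    V = var 1F
    a = E₁.x ^ suc n
    v = E₂.inv (suc n)
    unit : (1# - a * a) * v ≈ 1#
    unit = trans (*-congʳ (+-congˡ (-‿cong (sym (x₂^ (suc n)))))) (E₂.inv-law n)
    inv₁≈ : (1# + a) * v ≈ E₁.inv (suc n)
    inv₁≈ = cancel (E₁.inv (suc n) , E₁.inv-law n) (begin
      (1# + a) * v * (1# - a)
        ≈⟨ identity ((:1 :+ A) :* V :* (:1 :- A)) ((:1 :- A :* A) :* V) ≡.refl (a ∷ v ∷ []) ⟩
      (1# - a * a) * v           ≈⟨ trans unit (sym (E₁.inv-law n)) ⟩
      (1# - a) * E₁.inv (suc n)  ≈⟨ *-comm _ _ ⟩
      E₁.inv (suc n) * (1# - a)  ∎)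
    y₁≈ : a * ((1# + a) * v) * ((1# + a) * v) ≈ y₁ (suc n)
    y₁≈ = *-cong (*-congˡ inv₁≈) inv₁≈
    y₂≈ : a * a * v * v ≈ y₂ (suc n)
    y₂≈ = *-congʳ (*-congʳ (sym (x₂^ (suc n))))

  powerSum-step : ∀ y n → powerSum y (suc n) ≈ powerSum y n + y (suc n) * y (suc n)
  powerSum-step y n = identity ((var 0F :+ var 1F) :* (var 0F :+ var 1F) :+ con 9 :* (var 2F :+ var 0F :* var 1F))
    (var 0F :* var 0F :+ con 9 :* var 2F :+ var 1F :* var 1F) ≡.refl (e₁ y n ∷ y (suc n) ∷ e₂ y n ∷ [])

  -- Over the integers u² + y₁² = 2 y₂ + 16 y₂² for each i, because (1 - a)⁴ + (1 + a)⁴ = 2 (1 -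
  -- a²)² + 16 a². The sums of squares are known through e₁ and e₂, which is why the triple product
  -- is expanded to second order.
  powerSum-relation : ∀ n → powerSum u n ≈ 10 · 1# * powerSum y₁ n + 2 · 1# * e₁ y₂ n + 5 · 1# * powerSum y₂ n
  powerSum-relation zero    = identity (con 0 :* con 0 :+ con 9 :* con 0)
    (con 10 :* (con 0 :* con 0 :+ con 9 :* con 0) :+ con 2 :* con 0 :+ con 5 :* (con 0 :* con 0 :+ con 9 :* con 0)) ≡.refl []
  powerSum-relation (suc n) = begin
    powerSum u (suc n)
      ≈⟨ trans (powerSum-step u n) (+-cong (powerSum-relation n) (u² n)) ⟩
    10 · 1# * P₁ + 2 · 1# * E + 5 · 1# * P₂ + (10 · 1# * (Y₁ * Y₁) + 2 · 1# * Y₂ + 5 · 1# * (Y₂ * Y₂))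
      ≈⟨ identity
           (con 10 :* var 0F :+ con 2 :* var 1F :+ con 5 :* var 2F :+ (con 10 :* (var 3F :* var 3F) :+ con 2 :* var 4F :+ con 5 :* (var 4F :* var 4F)))
           (con 10 :* (var 0F :+ var 3F :* var 3F) :+ con 2 :* (var 1F :+ var 4F) :+ con 5 :* (var 2F :+ var 4F :* var 4F)) ≡.refl
           (P₁ ∷ E ∷ P₂ ∷ Y₁ ∷ Y₂ ∷ []) ⟩
    10 · 1# * (P₁ + Y₁ * Y₁) + 2 · 1# * (E + Y₂) + 5 · 1# * (P₂ + Y₂ * Y₂)
      ≈⟨ +-cong (+-congʳ (*-congˡ (powerSum-step y₁ n))) (*-congˡ (powerSum-step y₂ n)) ⟨
    10 · 1# * powerSum y₁ (suc n) + 2 · 1# * e₁ y₂ (suc n) + 5 · 1# * powerSum y₂ (suc n) ∎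
    where
    P₁ = powerSum y₁ n
    P₂ = powerSum y₂ n
    E = e₁ y₂ n
    Y₁ = y₁ (suc n)
    Y₂ = y₂ (suc n)

  power[] : ∀ {n s t u v} → s ≈[ n ] u → t ≈[ n ] v → s * s + 9 · 1# * t ≈[ n ] u * u + 9 · 1# * v
  power[] o p = +-cong[] (*-cong[] o o) (*-congˡ[] p)

  quasi : ℕ → Carrier → Carrier → Carrier
  quasi b l s = b · 1# * (D s + s * s - l * s)

  W S : Carrier
  W = 2 · 1# * α + 10 · 1# * β
  S = 2 · 1# * β + 10 · 1# * α + 7 · 1#

  D-linear : ∀ a b s t → D (a · 1# * s + b · 1# * t) ≈ a · 1# * D s + b · 1# * D t
  D-linear a b s t = trans (D-+ _ _) (+-cong (D-constant-* (D-const a) s) (D-constant-* (D-const b) t))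

  -- The limit of `powerSum-relation`. The sums of y₁ and y₂ come from f₁³ and f₂³ and those of u
  -- from ψ. Since L = 2 for f₂³, its limits are divided by 2 and by 4, that is multiplied by 6 and
  -- by 3.
  logDerivative-relation :
    1# * σ * (1# * σ) + 9 · 1# * quasi 2 (1 · 1#) σ ≈
      10 · 1# * (7 · 1# * (3 · 1# * α) * (7 · 1# * (3 · 1# * α)) + 9 · 1# * quasi 7 (1 · 1#) (3 · 1# * α))
      + 2 · 1# * (6 · 1# * (7 · 1# * (3 · 1# * β)))
      + 5 · 1# * (6 · 1# * (7 · 1# * (3 · 1# * β)) * (6 · 1# * (7 · 1# * (3 · 1# * β))) + 9 · 1# * (3 · 1# * quasi 7 (2 · 1#) (3 · 1# * β)))
  logDerivative-relation = ≈[]-separated (λ n → ≈[]-weaken (ℕ.n≤1+n n) (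
    ≈[]-trans (≈[]-sym (power[] (drop (Ψ.e₁-limit n)) (drop² (Ψ.e₂-limit n))))
    (≈[]-trans (≈⇒≈[] (powerSum-relation n))
    (+-cong[] (+-cong[]
      (*-congˡ[] (power[] (drop (J.e₁-limit n)) (drop² (J.e₂-limit n))))
      (*-congˡ[] (B₁ n)))
      (*-congˡ[] (power[] (B₁ n) (B₂ n)))))))
    where
    drop : ∀ {n s t} → 1 · 1# * s ≈[ n ] t → s ≈[ n ] t
    drop {s = s} o = ≈[]-trans (≈⇒≈[] (identity (var 0F) (con 1 :* var 0F) ≡.refl (s ∷ []))) o
    drop² : ∀ {n s t} → 1 · 1# * (1 · 1#) * s ≈[ n ] t → s ≈[ n ] t
    drop² {s = s} o = ≈[]-trans (≈⇒≈[] (identity (var 0F) (con 1 :* con 1 :* var 0F) ≡.refl (s ∷ []))) o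
    B₁ : ∀ n → e₁ y₂ n ≈[ suc n ] 6 · 1# * (7 · 1# * (3 · 1# * β))
    B₁ n = ≈[]-trans (≈⇒≈[] (identity (var 0F) (con 6 :* (con 2 :* var 0F)) ≡.refl (e₁ y₂ n ∷ []))) (*-congˡ[] (K.e₁-limit n))
    B₂ : ∀ n → e₂ y₂ n ≈[ suc n ] 3 · 1# * quasi 7 (2 · 1#) (3 · 1# * β)
    B₂ n = ≈[]-trans (≈⇒≈[] (identity (var 0F) (con 3 :* (con 2 :* con 2 :* var 0F)) ≡.refl (e₂ y₂ n ∷ []))) (*-congˡ[] (K.e₂-limit n))

  DW+DS : D W + D S ≈ 4 · 1# * W * S
  DW+DS = ≈-from-difference (begin
    D W + D S - 4 · 1# * W * S
      ≈⟨ +-congʳ (+-cong (D-linear 2 10 α β) (trans (D-+ _ _) (+-cong (D-linear 2 10 β α) (D-const 7)))) ⟩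
    2 · 1# * D α + 10 · 1# * D β + (2 · 1# * D β + 10 · 1# * D α + 0#) - 4 · 1# * W * S
      ≈⟨ identity
           (con 2 :* α′ :+ con 10 :* β′ :+ (con 2 :* β′ :+ con 10 :* α′ :+ con 0)
             :- con 4 :* (con 2 :* var 0F :+ con 10 :* var 1F) :* (con 2 :* var 1F :+ con 10 :* var 0F :+ con 7))
           (con 2 :* (left :- right)) ≡.refl (α ∷ β ∷ D α ∷ D β ∷ []) ⟩
    2 · 1# * (⟦ left ⟧ (α ∷ β ∷ D α ∷ D β ∷ []) - ⟦ right ⟧ (α ∷ β ∷ D α ∷ D β ∷ []))
      ≈⟨ *-congˡ (trans (+-congʳ relation) (-‿inverseʳ _)) ⟩
    2 · 1# * 0#  ≈⟨ zeroʳ _ ⟩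
    0#           ∎)
    where
    α′ β′ left right : Expr 4
    α′ = var 2F
    β′ = var 3F
    quasiᵉ : ℕ → Expr 4 → Expr 4 → Expr 4 → Expr 4
    quasiᵉ b l s s′ = con b :* (s′ :+ s :* s :- l :* s)
    σᵉ σ′ 3α 3α′ 3β 3β′ : Expr 4
    σᵉ  = con 2 :* var 1F :+ con 10 :* var 0F
    σ′  = con 2 :* β′ :+ con 10 :* α′
    3α  = con 3 :* var 0F
    3α′ = con 3 :* α′
    3β  = con 3 :* var 1F
    3β′ = con 3 :* β′
    left = :1 :* σᵉ :* (:1 :* σᵉ) :+ con 9 :* quasiᵉ 2 (con 1) σᵉ σ′
    right = con 10 :* (con 7 :* 3α :* (con 7 :* 3α) :+ con 9 :* quasiᵉ 7 (con 1) 3α 3α′)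
      :+ con 2 :* (con 6 :* (con 7 :* 3β))
      :+ con 5 :* (con 6 :* (con 7 :* 3β) :* (con 6 :* (con 7 :* 3β)) :+ con 9 :* (con 3 :* quasiᵉ 7 (con 2) 3β 3β′))
    quasi-cong : ∀ b l s {s′} → D s ≈ s′ → quasi b l s ≈ b · 1# * (s′ + s * s - l * s)
    quasi-cong b l s eq = *-congˡ (+-congʳ (+-congʳ eq))
    relation : ⟦ left ⟧ (α ∷ β ∷ D α ∷ D β ∷ []) ≈ ⟦ right ⟧ (α ∷ β ∷ D α ∷ D β ∷ [])
    relation = trans (+-congˡ (*-congˡ (sym (quasi-cong 2 (1 · 1#) σ (D-linear 2 10 β α)))))
      (trans logDerivative-relation
      (+-cong (+-congʳ (*-congˡ (+-congˡ (*-congˡ (quasi-cong 7 (1 · 1#) (3 · 1# * α) (D-constant-* (D-const 3) α))))))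
        (*-congˡ (+-congˡ (*-congˡ (*-congˡ (quasi-cong 7 (2 · 1#) (3 · 1# * β) (D-constant-* (D-const 3) β))))))))

  D-monomial : ∀ z a b → D (z ^ 11 * (f₁ ^ a * f₂ ^ b)) ≈ (a · 1# * α + b · 1# * β) * (z ^ 11 * (f₁ ^ a * f₂ ^ b))
  D-monomial z a b = begin
    D (z ^ 11 * (f₁ ^ a * f₂ ^ b))
      ≈⟨ trans (D-constant-* z¹¹ _) (*-congˡ (trans (D-* _ _) (+-cong (*-congʳ (D-^ Df₁ a)) (*-congˡ (D-^ Df₂ b))))) ⟩
    z ^ 11 * (a · 1# * α * f₁ ^ a * f₂ ^ b + f₁ ^ a * (b · 1# * β * f₂ ^ b))
      ≈⟨ identity (var 0F :* (var 1F :* var 2F :* var 3F :* var 4F :+ var 3F :* (var 5F :* var 6F :* var 4F)))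
           ((var 1F :* var 2F :+ var 5F :* var 6F) :* (var 0F :* (var 3F :* var 4F))) ≡.refl
           (z ^ 11 ∷ a · 1# ∷ α ∷ f₁ ^ a ∷ f₂ ^ b ∷ b · 1# ∷ β ∷ []) ⟩
    (a · 1# * α + b · 1# * β) * (z ^ 11 * (f₁ ^ a * f₂ ^ b)) ∎
    where
    z¹¹ : Constant (z ^ 11)
    z¹¹ = begin
      D (z ^ 11)
        ≈⟨ Dz^ 10 ⟩
      11 · 1# * (z ^ 10 * D z)   ≈⟨ trans (*-congʳ char11) (zeroˡ _) ⟩
      0#                         ∎
      where
      Dz^ : ∀ n → D (z ^ suc n) ≈ suc n · 1# * (z ^ n * D z)
      Dz^ zero    = trans (D-* z 1#) (trans (+-congˡ (trans (*-congˡ D-1) (zeroʳ z)))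
        (identity (var 0F :* :1 :+ con 0) (con 1 :* (:1 :* var 0F)) ≡.refl (D z ∷ [])))
      Dz^ (suc n) = trans (D-* z _) (trans (+-congˡ (*-congˡ (Dz^ n)))
        (identity (var 0F :* (var 1F :* var 2F) :+ var 1F :* (var 3F :* (var 2F :* var 0F)))
          ((:1 :+ var 3F) :* (var 1F :* var 2F :* var 0F)) ≡.refl (D z ∷ z ∷ z ^ n ∷ suc n · 1# ∷ [])))

  hasLog : ∀ {g l} e m n → D g ≈ l * g → e · 1# + l ≈ m · 1# * W + n · 1# * S → HasLogDerivative W S e m n g
  hasLog {g} {l} e m n Dg eq = begin
    D g + e · 1# * g       ≈⟨ trans (+-congʳ Dg) (+-comm _ _) ⟩
    e · 1# * g + l * g     ≈⟨ distribʳ g _ _ ⟨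
    (e · 1# + l) * g       ≈⟨ *-congʳ eq ⟩
    (m · 1# * W + n · 1# * S) * g ∎

  αᵉ βᵉ Wᵉ Sᵉ : Expr 2
  αᵉ = var 0F
  βᵉ = var 1F
  Wᵉ = con 2 :* αᵉ :+ con 10 :* βᵉ
  Sᵉ = con 2 :* βᵉ :+ con 10 :* αᵉ :+ con 7

  invariant : ∀ e m n {c} g → Target m n c → HasLogDerivative W S e m n g → shifted e 10 g ≈ g
  invariant e m n {c} g = target-fixed W S DW+DS
    {J = f₁ ^ 3} {K = f₂ ^ 3} {ψ = ψ} {A = f₁}
    (T₁.unit-^ T₁.f-unit 3) (T₁.unit-^ T₂.f-unit 3) ψ-unit T₁.f-unit
    (hasLog 7 2 1 (J.Df^ 3) (identity (con 7 :+ con 3 :* αᵉ) (con 2 :* Wᵉ :+ con 1 :* Sᵉ) ≡.refl (α ∷ β ∷ [])))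
    (hasLog 3 1 2 (K.Df^ 3) (identity (con 3 :+ con 3 :* βᵉ) (con 1 :* Wᵉ :+ con 2 :* Sᵉ) ≡.refl (α ∷ β ∷ [])))
    (hasLog 7 0 1 Dψ (identity (con 7 :+ (con 2 :* βᵉ :+ con 10 :* αᵉ)) (con 0 :* Wᵉ :+ con 1 :* Sᵉ) ≡.refl (α ∷ β ∷ [])))
    (hasLog 6 8 4 Df₁ (identity (con 6 :+ αᵉ) (con 8 :* Wᵉ :+ con 4 :* Sᵉ) ≡.refl (α ∷ β ∷ [])))
    (J.cube-equation {7} {1} (identity (con 7) (con 7 :* con 1) ≡.refl []) (identity (con 1) (con 1 :^ 5) ≡.refl []))
    (K.cube-equation {3} {10} (identity (con 3) (con 7 :* con 2) ≡.refl []) (identity (con 10) (con 2 :^ 5) ≡.refl []))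
    (Ψ.psi-equation {7} {1} (identity (con 7) (con 7 :* con 1) ≡.refl []) (identity (con 1) (con 1 :^ 5) ≡.refl []))
    (Pentagonal.pentagonal-equation 𝓔₁ {6} {1} (identity (con 6) (con 6 :* con 1) ≡.refl []) (identity (con 1) (con 1 :^ 5) ≡.refl []))
    {e} {m} {n} {c} {g}

  -- The exponent of q in η(z)^a η(2z)^b is e ≡ (a + 2b) / 24.
  module _ (z : Carrier) where

    monomial : ℕ → ℕ → Carrier
    monomial a b = z ^ 11 * (f₁ ^ a * f₂ ^ b)

    f₁¹⁰-invariant : shifted 5 10 (monomial 10 0) ≈ monomial 10 0
    f₁¹⁰-invariant = invariant 5 3 7 (monomial 10 0) f₁¹⁰ (hasLog 5 3 7 (D-monomial z 10 0)
      (identity (con 5 :+ (con 10 :* αᵉ :+ con 0 :* βᵉ)) (con 3 :* Wᵉ :+ con 7 :* Sᵉ) ≡.refl (α ∷ β ∷ [])))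

    f₁⁷f₂³-invariant : shifted 1 10 (monomial 7 3) ≈ monomial 7 3
    f₁⁷f₂³-invariant = invariant 1 2 8 (monomial 7 3) f₁⁷f₂³ (hasLog 1 2 8 (D-monomial z 7 3)
      (identity (con 1 :+ (con 7 :* αᵉ :+ con 3 :* βᵉ)) (con 2 :* Wᵉ :+ con 8 :* Sᵉ) ≡.refl (α ∷ β ∷ [])))

    f₁⁵f₂⁵-invariant : shifted 2 10 (monomial 5 5) ≈ monomial 5 5
    f₁⁵f₂⁵-invariant = invariant 2 5 5 (monomial 5 5) f₁⁵f₂⁵ (hasLog 2 5 5 (D-monomial z 5 5)
      (identity (con 2 :+ (con 5 :* αᵉ :+ con 5 :* βᵉ)) (con 5 :* Wᵉ :+ con 5 :* Sᵉ) ≡.refl (α ∷ β ∷ [])))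

    f₁³f₂⁷-invariant : shifted 3 10 (monomial 3 7) ≈ monomial 3 7
    f₁³f₂⁷-invariant = invariant 3 8 2 (monomial 3 7) f₁³f₂⁷ (hasLog 3 8 2 (D-monomial z 3 7)
      (identity (con 3 :+ (con 3 :* αᵉ :+ con 7 :* βᵉ)) (con 8 :* Wᵉ :+ con 2 :* Sᵉ) ≡.refl (α ∷ β ∷ [])))

    f₂¹⁰-invariant : shifted 10 10 (monomial 0 10) ≈ monomial 0 10
    f₂¹⁰-invariant = invariant 10 7 3 (monomial 0 10) f₂¹⁰ (hasLog 10 7 3 (D-monomial z 0 10)
      (identity (con 10 :+ (con 0 :* αᵉ :+ con 10 :* βᵉ)) (con 7 :* Wᵉ :+ con 3 :* Sᵉ) ≡.refl (α ∷ β ∷ [])))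

  f₁⁻-cancel : ∀ a → f₁⁻ ^ a * f₁ ^ a ≈ 1#
  f₁⁻-cancel zero    = *-identityˡ 1#
  f₁⁻-cancel (suc a) = trans
    (identity (var 0F :* var 1F :* (var 2F :* var 3F)) (var 2F :* var 0F :* (var 1F :* var 3F)) ≡.refl (f₁⁻ ∷ f₁⁻ ^ a ∷ f₁ ∷ f₁ ^ a ∷ []))
    (trans (*-cong E₁.f-inv (f₁⁻-cancel a)) (*-identityˡ 1#))

  ^-split : ∀ s j b → s ^ (11 ℕ.* j ℕ.+ b) ≈ (s ^ j) ^ 11 * s ^ b
  ^-split s j b = trans (^-homo-* s (11 ℕ.* j) b)
    (*-congʳ (trans (reflexive (≡.cong (s ^_) (ℕ.*-comm 11 j))) (sym (^-assocʳ s j 11))))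

  -- Since f₁^(-r) = f₁^(-11) f₁^a, one more eleventh power of `f₁⁻` makes the exponent of f₁
  -- nonnegative; hence `suc j`.
  quotient≈monomial : ∀ j a b r → a ℕ.+ r ≡ 11 →
    f₂ ^ (11 ℕ.* j ℕ.+ b) * f₁⁻ ^ (11 ℕ.* j ℕ.+ r) ≈ monomial (f₂ ^ j * f₁⁻ ^ suc j) a b
  quotient≈monomial j a b r eq = begin
    f₂ ^ (11 ℕ.* j ℕ.+ b) * f₁⁻ ^ (11 ℕ.* j ℕ.+ r)
      ≈⟨ *-cong (^-split f₂ j b) (^-split f₁⁻ j r) ⟩
    P * f₂ ^ b * (R * f₁⁻ ^ r)
      ≈⟨ trans (*-congˡ (f₁⁻-cancel a)) (*-identityʳ _) ⟨
    P * f₂ ^ b * (R * f₁⁻ ^ r) * (f₁⁻ ^ a * f₁ ^ a)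
      ≈⟨ identity (var 0F :* var 1F :* (var 2F :* var 3F) :* (var 4F :* var 5F)) (var 0F :* (var 4F :* var 3F :* var 2F) :* (var 5F :* var 1F))
           ≡.refl (P ∷ f₂ ^ b ∷ R ∷ f₁⁻ ^ r ∷ f₁⁻ ^ a ∷ f₁ ^ a ∷ []) ⟩
    P * (f₁⁻ ^ a * f₁⁻ ^ r * R) * (f₁ ^ a * f₂ ^ b)
      ≈⟨ *-congʳ (*-congˡ (*-congʳ (trans (reflexive (≡.cong (f₁⁻ ^_) (≡.sym eq))) (^-homo-* f₁⁻ a r)))) ⟨
    P * (f₁⁻ ^ 11 * R) * (f₁ ^ a * f₂ ^ b)
      ≈⟨ *-congʳ (trans (^-distrib-* (f₂ ^ j) _ 11) (*-congˡ (^-distrib-* f₁⁻ (f₁⁻ ^ j) 11))) ⟨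
    (f₂ ^ j * (f₁⁻ * f₁⁻ ^ j)) ^ 11 * (f₁ ^ a * f₂ ^ b) ∎
    where
    open CommutativeSemiringExp commutativeSemiring using (^-distrib-*)
    P = (f₂ ^ j) ^ 11
    R = (f₁⁻ ^ j) ^ 11

-- Integer power series as a commutative ring with derivation.

open import Defs
open import Data.Integer using (+_)

shift : Series → Series
shift s n = s (suc n)

-- The Cauchy product by recursion, from a = a 0 + q `shift a`, so that the ring laws follow by
-- induction on the index.
conv : Series → Series → Series
conv a b zero    = a 0 ℤ.* b 0
conv a b (suc n) = a 0 ℤ.* b (suc n) ℤ.+ conv (shift a) b n

⊛≗conv : ∀ a b → a ⊛ b ≗ conv a b
⊛≗conv a b n = ≡.trans (cong (foldr ℤ._+_ 0ℤ) (map-applyUpTo id (λ i → a i ℤ.* b (n ℕ.∸ i)) (suc n))) (go a n)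
  where
  go : ∀ a n → foldr ℤ._+_ 0ℤ (applyUpTo (λ i → a i ℤ.* b (n ℕ.∸ i)) (suc n)) ≡ conv a b n
  go a zero    = ℤ.+-identityʳ _
  go a (suc n) = cong (ℤ._+_ (a 0 ℤ.* b (suc n))) (go (shift a) n)

zeroSeries : Series
zeroSeries _ = 0ℤ

infixl 6 _⊕_

_⊕_ : Series → Series → Series
(a ⊕ b) n = a n ℤ.+ b n

⊖_ : Series → Series
(⊖ a) n = ℤ.- a n

conv-cong : ∀ {a b c d} → a ≗ b → c ≗ d → conv a c ≗ conv b d
conv-cong p q zero    = cong₂ ℤ._*_ (p 0) (q 0)
conv-cong p q (suc n) = cong₂ ℤ._+_ (cong₂ ℤ._*_ (p 0) (q (suc n))) (conv-cong (p ∘ suc) q n)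

conv-zeroˡ : ∀ b n → conv zeroSeries b n ≡ 0ℤ
conv-zeroˡ b zero    = ≡.refl
conv-zeroˡ b (suc n) = ≡.trans (ℤ.+-identityˡ _) (conv-zeroˡ b n)

conv-oneˡ : ∀ b → conv one b ≗ b
conv-oneˡ b zero    = ℤ.*-identityˡ _
conv-oneˡ b (suc n) = ≡.trans (cong₂ ℤ._+_ (ℤ.*-identityˡ (b (suc n))) (conv-zeroˡ b n)) (ℤ.+-identityʳ _)

conv-distribʳ : ∀ a b c n → conv (a ⊕ b) c n ≡ conv a c n ℤ.+ conv b c n
conv-distribʳ a b c zero    = ℤ.*-distribʳ-+ (c 0) (a 0) (b 0)
conv-distribʳ a b c (suc n) = ≡.trans (cong (ℤ._+_ ((a 0 ℤ.+ b 0) ℤ.* c (suc n))) (conv-distribʳ (shift a) (shift b) c n))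
  (rearrange (a 0) (b 0) (c (suc n)) (conv (shift a) c n) (conv (shift b) c n))
  where
  rearrange : ∀ x y z u v → (x ℤ.+ y) ℤ.* z ℤ.+ (u ℤ.+ v) ≡ (x ℤ.* z ℤ.+ u) ℤ.+ (y ℤ.* z ℤ.+ v)
  rearrange = solve-∀

conv-scale : ∀ k a b n → conv (λ i → k ℤ.* a i) b n ≡ k ℤ.* conv a b n
conv-scale k a b zero    = ℤ.*-assoc k (a 0) (b 0)
conv-scale k a b (suc n) = ≡.trans (cong (ℤ._+_ (k ℤ.* a 0 ℤ.* b (suc n))) (conv-scale k (shift a) b n)) (rearrange k (a 0) (b (suc n)) (conv (shift a) b n))
  where
  rearrange : ∀ k x y u → k ℤ.* x ℤ.* y ℤ.+ k ℤ.* u ≡ k ℤ.* (x ℤ.* y ℤ.+ u)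
  rearrange = solve-∀

conv-last : ∀ a b n → conv a b (suc n) ≡ conv a (shift b) n ℤ.+ a (suc n) ℤ.* b 0
conv-last a b zero    = ≡.refl
conv-last a b (suc n) = ≡.trans (cong (ℤ._+_ (a 0 ℤ.* b (suc (suc n)))) (conv-last (shift a) b n))
  (≡.sym (ℤ.+-assoc (a 0 ℤ.* b (suc (suc n))) _ _))

conv-comm : ∀ a b → conv a b ≗ conv b a
conv-comm a b zero    = ℤ.*-comm (a 0) (b 0)
conv-comm a b (suc n) = begin
  a 0 ℤ.* b (suc n) ℤ.+ conv (shift a) b n  ≡⟨ cong₂ ℤ._+_ (ℤ.*-comm (a 0) _) (conv-comm (shift a) b n) ⟩
  b (suc n) ℤ.* a 0 ℤ.+ conv b (shift a) n  ≡⟨ ℤ.+-comm _ (conv b (shift a) n) ⟩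
  conv b (shift a) n ℤ.+ b (suc n) ℤ.* a 0  ≡⟨ conv-last b a n ⟨
  conv b a (suc n)                          ∎
  where open ≡-Reasoning

-- The shift of `conv a b` is by definition a 0 times the shift of b plus `conv (shift a) b`;
-- linearity in the first argument then reduces to the induction hypothesis.
conv-assoc : ∀ a b c → conv (conv a b) c ≗ conv a (conv b c)
conv-assoc a b c zero    = ℤ.*-assoc (a 0) (b 0) (c 0)
conv-assoc a b c (suc n) = begin
  a 0 ℤ.* b 0 ℤ.* c (suc n) ℤ.+ conv ((λ i → a 0 ℤ.* shift b i) ⊕ conv (shift a) b) c n
    ≡⟨ cong (ℤ._+_ (a 0 ℤ.* b 0 ℤ.* c (suc n))) (≡.trans (conv-distribʳ (λ i → a 0 ℤ.* shift b i) (conv (shift a) b) c n)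
         (cong₂ ℤ._+_ (conv-scale (a 0) (shift b) c n) (conv-assoc (shift a) b c n))) ⟩
  a 0 ℤ.* b 0 ℤ.* c (suc n) ℤ.+ (a 0 ℤ.* conv (shift b) c n ℤ.+ conv (shift a) (conv b c) n)
    ≡⟨ rearrange (a 0) (b 0) (c (suc n)) (conv (shift b) c n) (conv (shift a) (conv b c) n) ⟩
  a 0 ℤ.* (b 0 ℤ.* c (suc n) ℤ.+ conv (shift b) c n) ℤ.+ conv (shift a) (conv b c) n ∎
  where
  open ≡-Reasoning
  rearrange : ∀ x y z u v → x ℤ.* y ℤ.* z ℤ.+ (x ℤ.* u ℤ.+ v) ≡ x ℤ.* (y ℤ.* z ℤ.+ u) ℤ.+ v
  rearrange = solve-∀

derivative : Series → Series
derivative s n = + n ℤ.* s n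

-- The induction rests on D(q s) = q (s + D s): the shift of `derivative a` is `shift a` plus
-- `derivative (shift a)`.
derivative-conv : ∀ a b n → derivative (conv a b) n ≡ conv (derivative a) b n ℤ.+ conv a (derivative b) n
derivative-conv a b zero    = refl-zero (a 0) (b 0)
  where
  refl-zero : ∀ x y → 0ℤ ℤ.* (x ℤ.* y) ≡ 0ℤ ℤ.* x ℤ.* y ℤ.+ x ℤ.* (0ℤ ℤ.* y)
  refl-zero = solve-∀
derivative-conv a b (suc n) = begin
  (1ℤ ℤ.+ + n) ℤ.* (a 0 ℤ.* b (suc n) ℤ.+ C)
    ≡⟨ expand (+ n) (a 0) (b (suc n)) C ⟩
  M ℤ.+ C ℤ.+ N ℤ.+ + n ℤ.* C
    ≡⟨ cong (ℤ._+_ (M ℤ.+ C ℤ.+ N)) (derivative-conv (shift a) b n) ⟩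
  M ℤ.+ C ℤ.+ N ℤ.+ (X ℤ.+ Y)
    ≡⟨ collect M C N X Y ⟩
  (M ℤ.+ (C ℤ.+ X)) ℤ.+ (N ℤ.+ Y)
    ≡⟨ cong (λ t → (M ℤ.+ t) ℤ.+ (N ℤ.+ Y)) (≡.trans (≡.sym (conv-distribʳ (shift a) (derivative (shift a)) b n))
         (conv-cong {c = b} (λ i → ≡.sym (ℤ.suc-* (+ i) (a (suc i)))) (λ _ → ≡.refl) n)) ⟩
  conv (derivative a) b (suc n) ℤ.+ conv a (derivative b) (suc n) ∎
  where
  open ≡-Reasoning
  C = conv (shift a) b n
  M = 0ℤ ℤ.* a 0 ℤ.* b (suc n)
  N = a 0 ℤ.* ((1ℤ ℤ.+ + n) ℤ.* b (suc n))
  X = conv (derivative (shift a)) b n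
  Y = conv (shift a) (derivative b) n
  expand : ∀ n x y c → (1ℤ ℤ.+ n) ℤ.* (x ℤ.* y ℤ.+ c) ≡ 0ℤ ℤ.* x ℤ.* y ℤ.+ c ℤ.+ (x ℤ.* ((1ℤ ℤ.+ n) ℤ.* y)) ℤ.+ n ℤ.* c
  expand = solve-∀
  collect : ∀ z c w x y → z ℤ.+ c ℤ.+ w ℤ.+ (x ℤ.+ y) ≡ (z ℤ.+ (c ℤ.+ x)) ℤ.+ (w ℤ.+ y)
  collect = solve-∀

-- Congruence modulo 11 and the order filtration.

infix 4 _≋_ _≈ˢ_

record _≋_ (x y : ℤ) : Set where
  constructor congruent
  field
    difference : + 11 ∣ˢ x ℤ.- y

open _≋_

∣-resp : ∀ {x y} → x ≡ y → + 11 ∣ˢ x → + 11 ∣ˢ y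
∣-resp = ≡.subst (+ 11 ∣ˢ_)

∣0 : + 11 ∣ˢ 0ℤ
∣0 = divides 0ℤ ≡.refl

≡⇒≋ : ∀ {x y} → x ≡ y → x ≋ y
≡⇒≋ {x} ≡.refl = congruent (∣-resp (≡.sym (ℤ.+-inverseʳ x)) ∣0)

≋-sym : ∀ {x y} → x ≋ y → y ≋ x
≋-sym {x} {y} (congruent p) = congruent (∣-resp (negate x y) (∣m⇒∣-m p))
  where
  negate : ∀ x y → ℤ.- (x ℤ.- y) ≡ y ℤ.- x
  negate = solve-∀

≋-trans : ∀ {x y z} → x ≋ y → y ≋ z → x ≋ z
≋-trans {x} {y} {z} (congruent p) (congruent q) = congruent (∣-resp (telescope x y z) (∣m∣n⇒∣m+n p q))
  where
  telescope : ∀ x y z → (x ℤ.- y) ℤ.+ (y ℤ.- z) ≡ x ℤ.- z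
  telescope = solve-∀

≋-+ : ∀ {x y u v} → x ≋ y → u ≋ v → x ℤ.+ u ≋ y ℤ.+ v
≋-+ {x} {y} {u} {v} (congruent p) (congruent q) = congruent (∣-resp (regroup x y u v) (∣m∣n⇒∣m+n p q))
  where
  regroup : ∀ x y u v → (x ℤ.- y) ℤ.+ (u ℤ.- v) ≡ (x ℤ.+ u) ℤ.- (y ℤ.+ v)
  regroup = solve-∀

≋-* : ∀ {x y u v} → x ≋ y → u ≋ v → x ℤ.* u ≋ y ℤ.* v
≋-* {x} {y} {u} {v} (congruent p) (congruent q) = congruent (∣-resp (regroup x y u v) (∣m∣n⇒∣m+n (∣m⇒∣m*n u p) (∣n⇒∣m*n y q)))
  where
  regroup : ∀ x y u v → (x ℤ.- y) ℤ.* u ℤ.+ y ℤ.* (u ℤ.- v) ≡ x ℤ.* u ℤ.- y ℤ.* v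
  regroup = solve-∀

≋-neg : ∀ {x y} → x ≋ y → ℤ.- x ≋ ℤ.- y
≋-neg {x} {y} (congruent p) = congruent (∣-resp (regroup x y) (∣m⇒∣-m p))
  where
  regroup : ∀ x y → ℤ.- (x ℤ.- y) ≡ (ℤ.- x) ℤ.- (ℤ.- y)
  regroup = solve-∀

-- Reduction modulo 11 sits in the equality, so the integer series of the statement are themselves
-- elements of a ring of characteristic 11.
record _≈ˢ_ (s t : Series) : Set where
  constructor coefficientwise
  field
    coefficient : ∀ n → s n ≋ t n

open _≈ˢ_

≗⇒≈ˢ : ∀ {s t} → s ≗ t → s ≈ˢ t
≗⇒≈ˢ eq = coefficientwise (λ n → ≡⇒≋ (eq n))

conv-cong-≋ : ∀ {s t u v} → (∀ n → s n ≋ t n) → (∀ n → u n ≋ v n) → ∀ n → conv s u n ≋ conv t v n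
conv-cong-≋ p q zero    = ≋-* (p 0) (q 0)
conv-cong-≋ p q (suc n) = ≋-+ (≋-* (p 0) (q (suc n))) (conv-cong-≋ (λ i → p (suc i)) q n)

⊛-cong : ∀ {s t u v} → s ≈ˢ t → u ≈ˢ v → s ⊛ u ≈ˢ t ⊛ v
⊛-cong {s} {t} {u} {v} (coefficientwise p) (coefficientwise q) = coefficientwise λ n →
  ≋-trans (≡⇒≋ (⊛≗conv s u n)) (≋-trans (conv-cong-≋ p q n) (≡⇒≋ (≡.sym (⊛≗conv t v n))))

⊛-comm : ∀ a b → a ⊛ b ≗ b ⊛ a
⊛-comm a b n = ≡.trans (⊛≗conv a b n) (≡.trans (conv-comm a b n) (≡.sym (⊛≗conv b a n)))

⊛-assoc : ∀ a b c → (a ⊛ b) ⊛ c ≗ a ⊛ (b ⊛ c)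
⊛-assoc a b c n = begin
  ((a ⊛ b) ⊛ c) n        ≡⟨ ⊛≗conv (a ⊛ b) c n ⟩
  conv (a ⊛ b) c n       ≡⟨ conv-cong (⊛≗conv a b) (λ _ → ≡.refl) n ⟩
  conv (conv a b) c n    ≡⟨ conv-assoc a b c n ⟩
  conv a (conv b c) n    ≡⟨ conv-cong {a = a} (λ _ → ≡.refl) (⊛≗conv b c) n ⟨
  conv a (b ⊛ c) n       ≡⟨ ⊛≗conv a (b ⊛ c) n ⟨
  (a ⊛ (b ⊛ c)) n        ∎
  where open ≡-Reasoning

⊛-distribʳ : ∀ c a b → (a ⊕ b) ⊛ c ≗ (a ⊛ c) ⊕ (b ⊛ c)
⊛-distribʳ c a b n = ≡.trans (⊛≗conv (a ⊕ b) c n) (≡.trans (conv-distribʳ a b c n)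
  (≡.sym (cong₂ ℤ._+_ (⊛≗conv a c n) (⊛≗conv b c n))))

⊛-distribˡ : ∀ c a b → c ⊛ (a ⊕ b) ≗ (c ⊛ a) ⊕ (c ⊛ b)
⊛-distribˡ c a b n = ≡.trans (⊛-comm c (a ⊕ b) n) (≡.trans (⊛-distribʳ c a b n) (cong₂ ℤ._+_ (⊛-comm a c n) (⊛-comm b c n)))

⊛-identityˡ : ∀ a → one ⊛ a ≗ a
⊛-identityˡ a n = ≡.trans (⊛≗conv one a n) (conv-oneˡ a n)

-- Sealed copies of the operations: series are functions, and their coefficients should not be computed.
opaque

  infixl 6 _⊞_
  infixl 7 _⊠_

  _⊞_ _⊠_ : Series → Series → Series
  _⊞_ = _⊕_
  _⊠_ = _⊛_

  ⊟_ ∂ˢ : Series → Series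
  ⊟_ = ⊖_
  ∂ˢ = derivative

  ⊞-coefficient : ∀ s t n → (s ⊞ t) n ≡ s n ℤ.+ t n
  ⊞-coefficient s t n = ≡.refl

  ⊟-coefficient : ∀ s n → (⊟ s) n ≡ ℤ.- s n
  ⊟-coefficient s n = ≡.refl

  ⊠-coefficient : ∀ s t → s ⊠ t ≗ conv s t
  ⊠-coefficient = ⊛≗conv

  ⊠≡⊛ : ∀ s t → s ⊠ t ≡ s ⊛ t
  ⊠≡⊛ s t = ≡.refl

  ∂ˢ-coefficient : ∀ s n → ∂ˢ s n ≡ + n ℤ.* s n
  ∂ˢ-coefficient s n = ≡.refl

  ⊞-⊠-isCommutativeRing : IsCommutativeRing _≈ˢ_ _⊞_ _⊠_ ⊟_ zeroSeries one
  ⊞-⊠-isCommutativeRing = record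
      { isRing = record
        { +-isAbelianGroup = record
          { isGroup = record
            { isMonoid = record
              { isSemigroup = record
                { isMagma = record
                  { isEquivalence = record
                    { refl = ≗⇒≈ˢ (λ _ → ≡.refl)
                    ; sym = λ p → coefficientwise (λ n → ≋-sym (coefficient p n))
                    ; trans = λ p q → coefficientwise (λ n → ≋-trans (coefficient p n) (coefficient q n)) }
                  ; ∙-cong = λ p q → coefficientwise (λ n → ≋-+ (coefficient p n) (coefficient q n)) }
                ; assoc = λ a b c → ≗⇒≈ˢ (λ n → ℤ.+-assoc (a n) (b n) (c n)) }
              ; identity = (λ a → ≗⇒≈ˢ (λ n → ℤ.+-identityˡ (a n))) , (λ a → ≗⇒≈ˢ (λ n → ℤ.+-identityʳ (a n))) }
            ; inverse = (λ a → ≗⇒≈ˢ (λ n → ℤ.+-inverseˡ (a n))) , (λ a → ≗⇒≈ˢ (λ n → ℤ.+-inverseʳ (a n)))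
            ; ⁻¹-cong = λ p → coefficientwise (λ n → ≋-neg (coefficient p n)) }
          ; comm = λ a b → ≗⇒≈ˢ (λ n → ℤ.+-comm (a n) (b n)) }
        ; *-cong = ⊛-cong
        ; *-assoc = λ a b c → ≗⇒≈ˢ (⊛-assoc a b c)
        ; *-identity = (λ a → ≗⇒≈ˢ (⊛-identityˡ a)) , (λ a → ≗⇒≈ˢ (λ n → ≡.trans (⊛-comm a one n) (⊛-identityˡ a n)))
        ; distrib = (λ c a b → ≗⇒≈ˢ (⊛-distribˡ c a b)) , (λ c a b → ≗⇒≈ˢ (⊛-distribʳ c a b)) }
      ; *-comm = λ a b → ≗⇒≈ˢ (⊛-comm a b) }

seriesRing : CommutativeRing 0ℓ 0ℓ
seriesRing = record { isCommutativeRing = ⊞-⊠-isCommutativeRing }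

module SeriesRing = CommutativeRing seriesRing
open RawMonoidDefinitions SeriesRing.+-rawMonoid using () renaming (_×_ to _·ˢ_)

opaque
  unfolding _⊞_

  eleven : 11 ·ˢ one ≈ˢ zeroSeries
  eleven = coefficientwise λ { zero → congruent (divides 1ℤ ≡.refl) ; (suc n) → ≡⇒≋ ≡.refl }

  ∂ˢ-cong : ∀ {s t} → s ≈ˢ t → ∂ˢ s ≈ˢ ∂ˢ t
  ∂ˢ-cong p = coefficientwise (λ n → ≋-* (≡⇒≋ {+ n} ≡.refl) (coefficient p n))

  ∂ˢ-⊞ : ∀ s t → ∂ˢ (s ⊞ t) ≈ˢ ∂ˢ s ⊞ ∂ˢ t
  ∂ˢ-⊞ s t = ≗⇒≈ˢ (λ n → ℤ.*-distribˡ-+ (+ n) (s n) (t n))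

  ∂ˢ-⊠ : ∀ s t → ∂ˢ (s ⊠ t) ≈ˢ ∂ˢ s ⊠ t ⊞ s ⊠ ∂ˢ t
  ∂ˢ-⊠ s t = ≗⇒≈ˢ (λ n → ≡.trans (cong (ℤ._*_ (+ n)) (⊛≗conv s t n)) (≡.trans (derivative-conv s t n)
    (≡.sym (cong₂ ℤ._+_ (⊛≗conv (derivative s) t n) (⊛≗conv s (derivative t) n)))))

seriesDifferentialRing : DifferentialRing
seriesDifferentialRing = record
  { commutativeRing = seriesRing ; char11 = eleven ; D = ∂ˢ ; D-cong = ∂ˢ-cong ; D-+ = ∂ˢ-⊞ ; D-* = ∂ˢ-⊠ }

record Order (n : ℕ) (s : Series) : Set where
  constructor order
  field
    vanishing : ∀ i → i < n → + 11 ∣ˢ s i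

open Order

-- Leading coefficients of s are peeled off: the first m are divisible by 11 themselves, and after
-- them only coefficients of t below n occur.
vanishing-conv : ∀ {m n} s t → (∀ i → i < m → + 11 ∣ˢ s i) → (∀ i → i < n → + 11 ∣ˢ t i) →
  ∀ i → i < m ℕ.+ n → + 11 ∣ˢ conv s t i
vanishing-conv {zero}  s t p q zero    i<n = ∣n⇒∣m*n (s 0) (q 0 i<n)
vanishing-conv {zero}  s t p q (suc i) i<n = ∣m∣n⇒∣m+n (∣n⇒∣m*n (s 0) (q (suc i) i<n))
  (vanishing-conv {zero} (shift s) t (λ _ ()) q i (ℕ.<-trans (ℕ.n<1+n i) i<n))
vanishing-conv {suc m} s t p q zero    i<n = ∣m⇒∣m*n (t 0) (p 0 (s≤s z≤n))
vanishing-conv {suc m} s t p q (suc i) (s≤s i<n) = ∣m∣n⇒∣m+n (∣m⇒∣m*n (t (suc i)) (p 0 (s≤s z≤n)))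
  (vanishing-conv {m} (shift s) t (λ j j<m → p (suc j) (s≤s j<m)) q i i<n)

seriesFilteredRing : FilteredRing
seriesFilteredRing = record
  { differentialRing = seriesDifferentialRing
  ; O = Order
  ; O-resp = λ {n} {s} {t} eq o → order λ i i<n →
      ∣-resp (restore (t i) (s i)) (∣m∣n⇒∣m+n (vanishing o i i<n) (difference (≋-sym (coefficient eq i))))
  ; O-zero = λ s → order λ i ()
  ; O-0# = λ n → order λ i _ → ∣0
  ; O-+ = λ {n} {s} {t} p q → order λ i i<n → ∣-resp (≡.sym (⊞-coefficient s t i)) (∣m∣n⇒∣m+n (vanishing p i i<n) (vanishing q i i<n))
  ; O-* = λ {m} {n} {s} {t} p q → order λ i i<n →
      ∣-resp (≡.sym (⊠-coefficient s t i)) (vanishing-conv s t (vanishing p) (vanishing q) i i<n)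
  ; O-weaken = λ m≤n p → order λ i i<m → vanishing p i (ℕ.<-≤-trans i<m m≤n)
  ; O-D = λ {n} {s} p → order λ i i<n → ∣-resp (≡.sym (∂ˢ-coefficient s i)) (∣n⇒∣m*n (+ i) (vanishing p i i<n))
  ; O-separated = λ {s} p → coefficientwise λ i →
      congruent (∣-resp (≡.sym (ℤ.+-identityʳ (s i))) (vanishing (p (suc i)) i (ℕ.n<1+n i)))
  }
  where
  restore : ∀ x y → y ℤ.+ (x ℤ.- y) ≡ x
  restore = solve-∀

-- The series f and its inverse as Euler products.

module SeriesEulerProducts where
  open FilteredRing seriesFilteredRing

  δ-index : ∀ {m n} → m ≡ n → ∀ {k} → δ m k ≡ δ n k
  δ-index ≡.refl = ≡.refl

  δ-above : ∀ {m n} → n < m → δ m n ≡ 0ℤ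
  δ-above {suc m} {zero}  _         = ≡.refl
  δ-above {suc m} {suc n} (s≤s n<m) = δ-above n<m

  δ-cancel : ∀ k m n → δ (k ℕ.+ m) (k ℕ.+ n) ≡ δ m n
  δ-cancel zero    m n = ≡.refl
  δ-cancel (suc k) m n = δ-cancel k m n

  conv-δ-suc : ∀ k b n → conv (δ (suc k)) b (suc n) ≡ conv (δ k) b n
  conv-δ-suc k b n = ℤ.+-identityˡ _

  conv-δ : ∀ k b n → conv (δ k) b (k ℕ.+ n) ≡ b n
  conv-δ zero    b n = conv-oneˡ b n
  conv-δ (suc k) b n = ≡.trans (conv-δ-suc k b (k ℕ.+ n)) (conv-δ k b n)

  conv-δ-below : ∀ {k n} b → n < k → conv (δ k) b n ≡ 0ℤ
  conv-δ-below {suc k} {zero}  b _         = ≡.refl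
  conv-δ-below {suc k} {suc n} b (s≤s n<k) = ≡.trans (conv-δ-suc k b n) (conv-δ-below b n<k)

  below-or-above : ∀ k n → n < k ⊎ Σ ℕ λ i → n ≡ k ℕ.+ i
  below-or-above k n with n ℕ.<? k
  ... | yes n<k = inj₁ n<k
  ... | no  n≮k = inj₂ (n ℕ.∸ k , ≡.sym (ℕ.m+[n∸m]≡n (ℕ.≮⇒≥ n≮k)))

  δ-⊠ : ∀ k m → δ k ⊠ δ m ≗ δ (k ℕ.+ m)
  δ-⊠ k m n with below-or-above k n
  ... | inj₁ n<k          = ≡.trans (⊠-coefficient (δ k) (δ m) n)
    (≡.trans (conv-δ-below (δ m) n<k) (≡.sym (δ-above (ℕ.<-≤-trans n<k (ℕ.m≤m+n k m)))))
  ... | inj₂ (i , ≡.refl) = ≡.trans (⊠-coefficient (δ k) (δ m) n)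
    (≡.trans (conv-δ k (δ m) i) (≡.sym (δ-cancel k m i)))

  sumBelow : ℕ → (ℕ → ℤ) → ℤ
  sumBelow N h = foldr ℤ._+_ 0ℤ (applyUpTo h N)

  sumTo≡sumBelow : ∀ n h → sumTo n h ≡ sumBelow (suc n) h
  sumTo≡sumBelow n h = cong (foldr ℤ._+_ 0ℤ) (map-applyUpTo id h (suc n))

  sumBelow-cong : ∀ N {h k : ℕ → ℤ} → h ≗ k → sumBelow N h ≡ sumBelow N k
  sumBelow-cong zero    eq = ≡.refl
  sumBelow-cong (suc N) eq = cong₂ ℤ._+_ (eq 0) (sumBelow-cong N (eq ∘ suc))

  sumBelow-stable : ∀ M N {h : ℕ → ℤ} → (∀ j → M ≤ j → h j ≡ 0ℤ) → sumBelow (M ℕ.+ N) h ≡ sumBelow M h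
  sumBelow-stable zero    zero    eq = ≡.refl
  sumBelow-stable zero    (suc N) eq = ≡.trans (cong₂ ℤ._+_ (eq 0 z≤n) (sumBelow-stable zero N (λ j _ → eq (suc j) z≤n))) ≡.refl
  sumBelow-stable (suc M) N {h}   eq = cong (ℤ._+_ (h 0)) (sumBelow-stable M N (λ j M≤j → eq (suc j) (s≤s M≤j)))

  -- At n = m + i the two sides truncate the geometric series at different j; the surplus terms have
  -- j > i, hence j m > i, and are zero.
  geom-recurrence : ∀ d n → geom (suc d) n ≡ δ 0 n ℤ.+ conv (δ (suc d)) (geom (suc d)) n
  geom-recurrence d n with below-or-above (suc d) n
  ... | inj₁ n<m = ≡.trans (sumTo≡sumBelow n (λ j → δ (j ℕ.* suc d) n)) (cong (ℤ._+_ (δ 0 n))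
    (≡.trans (sumBelow-stable 0 n (λ j _ → δ-above (ℕ.<-≤-trans n<m (ℕ.m≤m+n (suc d) (j ℕ.* suc d)))))
      (≡.sym (conv-δ-below (geom (suc d)) n<m))))
  ... | inj₂ (i , ≡.refl) = begin
    geom m (m ℕ.+ i)
      ≡⟨ sumTo≡sumBelow (m ℕ.+ i) (λ j → δ (j ℕ.* m) (m ℕ.+ i)) ⟩
    0ℤ ℤ.+ sumBelow (suc (d ℕ.+ i)) (λ j → δ (m ℕ.+ j ℕ.* m) (m ℕ.+ i))
      ≡⟨ cong (ℤ._+_ 0ℤ) (sumBelow-cong (suc (d ℕ.+ i)) (λ j → δ-cancel m (j ℕ.* m) i)) ⟩
    0ℤ ℤ.+ sumBelow (suc (d ℕ.+ i)) h
      ≡⟨ cong (λ N → 0ℤ ℤ.+ sumBelow (suc N) h) (ℕ.+-comm d i) ⟩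
    0ℤ ℤ.+ sumBelow (suc i ℕ.+ d) h
      ≡⟨ cong (ℤ._+_ 0ℤ) (sumBelow-stable (suc i) d (λ j i<j → δ-above (ℕ.<-≤-trans i<j (ℕ.m≤m*n j m)))) ⟩
    0ℤ ℤ.+ sumBelow (suc i) h
      ≡⟨ cong (ℤ._+_ 0ℤ) (≡.trans (≡.sym (sumTo≡sumBelow i h)) (≡.sym (conv-δ m (geom m) i))) ⟩
    δ 0 (m ℕ.+ i) ℤ.+ conv (δ m) (geom m) (m ℕ.+ i) ∎
    where
    open ≡-Reasoning
    m = suc d
    h : ℕ → ℤ
    h j = δ (j ℕ.* m) i

  geom-inverse : ∀ d → (1# - δ (suc d)) * geom (suc d) ≈ 1#
  geom-inverse d = begin
    (1# - δ m) * geom m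
      ≈⟨ identity ((:1 :- var 0F) :* var 1F) (var 1F :- var 0F :* var 1F) ≡.refl (δ m ∷ geom m ∷ []) ⟩
    geom m - δ m * geom m
      ≈⟨ +-congʳ (≗⇒≈ˢ (λ n → ≡.trans (geom-recurrence d n) (≡.trans (cong (ℤ._+_ (δ 0 n)) (≡.sym (⊠-coefficient (δ m) (geom m) n)))
           (≡.sym (⊞-coefficient 1# (δ m * geom m) n))))) ⟩
    1# + δ m * geom m - δ m * geom m
      ≈⟨ identity (:1 :+ var 0F :- var 0F) :1 ≡.refl (δ m * geom m ∷ []) ⟩
    1# ∎
    where
    open SetoidReasoning setoid
    m = suc d

  coefficient-· : ∀ k s n → (k · s) n ≡ + k ℤ.* s n
  coefficient-· zero    s n = ≡.sym (ℤ.*-zeroˡ (s n))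
  coefficient-· (suc k) s n = ≡.trans (≡.trans (⊞-coefficient s (k · s) n) (cong (ℤ._+_ (s n)) (coefficient-· k s n))) (≡.sym (ℤ.suc-* (+ k) (s n)))

  scalar-* : ∀ k s → k · 1# * s ≈ k · s
  scalar-* k s = trans (×-assoc-* k 1# s) (×-congʳ k (*-identityˡ s))

  D-δ : ∀ k → D (δ k) ≈ k · 1# * δ k
  D-δ k = trans (≗⇒≈ˢ (λ n → ≡.trans (∂ˢ-coefficient (δ k) n) (≡.trans (pointwise n) (≡.sym (coefficient-· k (δ k) n))))) (sym (scalar-* k (δ k)))
    where
    pointwise : ∀ n → + n ℤ.* δ k n ≡ + k ℤ.* δ k n
    pointwise n with k ≡ᵇ n in eq
    ... | true  = cong (λ j → + j ℤ.* 1ℤ) (≡.sym (ℕ.≡ᵇ⇒≡ k n (≡.subst Holds (≡.sym eq) tt)))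
    ... | false = ≡.trans (ℤ.*-zeroʳ (+ n)) (≡.sym (ℤ.*-zeroʳ (+ k)))

  minus-coefficient : ∀ s t n → (s - t) n ≡ s n ℤ.- t n
  minus-coefficient s t n = ≡.trans (⊞-coefficient s (- t) n) (cong (ℤ._+_ (s n)) (⊟-coefficient t n))

  diagonal : (ℕ → Series) → Series
  diagonal P n = P n n

  stabilises : ∀ {P : ℕ → Series} → (∀ N → P (suc N) ≈[ suc N ] P N) → ∀ (i k : ℕ) → P (k ℕ.+ i) ≈[ suc i ] P i
  stabilises {P} step i zero    = ≈⇒≈[] {s = P i} refl
  stabilises {P} step i (suc k) = ≈[]-trans (≈[]-weaken (s≤s (ℕ.m≤n+m i k)) (step (k ℕ.+ i))) (stabilises {P} step i k)

  -- `f` and `fInv` take the coefficient at n from the product of n factors, so they are diagonals;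
  -- later factors leave the coefficients up to n unchanged.
  diagonal-limit : ∀ {P : ℕ → Series} → (∀ N → P (suc N) ≈[ suc N ] P N) → ∀ n → diagonal P ≈[ suc n ] P n
  diagonal-limit {P} step n = order λ { i (s≤s i≤n) → ∣-resp
    (≡.trans (minus-coefficient (P i) (P n) i) (≡.sym (minus-coefficient (diagonal P) (P n) i)))
    (Order.vanishing (≡.subst (λ m → Order (suc i) (P i - P m)) (ℕ.m∸n+n≡m i≤n) (≈[]-sym (stabilises {P} step i (n ℕ.∸ i)))) i (ℕ.n<1+n i)) }

  prodTo-suc : ∀ n F → prodTo (suc n) F ≈ F (suc n) * prodTo n F
  prodTo-suc n F = reflexive (≡.sym (⊠≡⊛ (F (suc n)) (prodTo n F)))

  module _ (ℓ′ : ℕ) where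

    private
      ℓ = suc ℓ′
      x = δ ℓ

    δ-^ : ∀ n → x ^ n ≈ δ (ℓ ℕ.* n)
    δ-^ zero    = ≗⇒≈ˢ (λ n → δ-index (≡.sym (ℕ.*-zeroʳ ℓ)) {n})
    δ-^ (suc n) = trans (*-congˡ (δ-^ n)) (≗⇒≈ˢ (λ i → ≡.trans (δ-⊠ ℓ (ℓ ℕ.* n) i) (δ-index (≡.sym (ℕ.*-suc ℓ n)) {i})))

    x-O : O 1 x
    x-O = order λ { zero _ → ∣0 ; (suc i) (s≤s ()) }

    factor inverseFactor : ℕ → Series
    factor m = oneMinusQ (ℓ ℕ.* m)
    inverseFactor m = geom (ℓ ℕ.* m)

    factor≈ : ∀ n → factor n ≈ 1# - x ^ n
    factor≈ n = trans (≗⇒≈ˢ (λ i → ≡.sym (minus-coefficient 1# (δ (ℓ ℕ.* n)) i))) (+-congˡ (-‿cong (sym (δ-^ n))))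

    inverse-law : ∀ i → (1# - x ^ suc i) * inverseFactor (suc i) ≈ 1#
    inverse-law i = trans (*-congʳ (+-congˡ (-‿cong (δ-^ (suc i))))) (geom-inverse (i ℕ.+ ℓ′ ℕ.* suc i))

    product≈ : ∀ n → prodTo n factor ≈ partialProduct x n
    product≈ zero    = refl
    product≈ (suc n) = trans (prodTo-suc n factor) (*-cong (factor≈ (suc n)) (product≈ n))

    product-inverse : ∀ n → partialProduct x n * prodTo n inverseFactor ≈ 1#
    product-inverse zero    = *-identityˡ 1#
    product-inverse (suc n) = trans (*-congˡ (prodTo-suc n inverseFactor)) (trans
      (identity (var 0F :* var 1F :* (var 2F :* var 3F)) (var 0F :* var 2F :* (var 1F :* var 3F)) ≡.refl
        (1# - x ^ suc n ∷ partialProduct x n ∷ inverseFactor (suc n) ∷ prodTo n inverseFactor ∷ []))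
      (trans (*-cong (inverse-law n) (product-inverse n)) (*-identityˡ 1#)))

    product-step : ∀ n → prodTo (suc n) factor ≈[ suc n ] prodTo n factor
    product-step n = O-resp
      (trans (identity (:- var 1F :* var 0F) ((:1 :- var 0F) :* var 1F :- var 1F) ≡.refl (x ^ suc n ∷ prodTo n factor ∷ []))
        (+-congʳ (trans (*-congʳ (sym (factor≈ (suc n)))) (sym (prodTo-suc n factor)))))
      (O-*ˡ _ (O-^ x-O (suc n)))

    -- From (1 - X) I = 1 the difference I P - P is X I P with X = x^(n+1).
    inverse-step : ∀ n → prodTo (suc n) inverseFactor ≈[ suc n ] prodTo n inverseFactor
    inverse-step n = O-resp
      (trans (identity (var 2F :* var 1F :* var 0F) (var 1F :* var 2F :- (:1 :- var 0F) :* var 1F :* var 2F) ≡.refl (x ^ suc n ∷ I ∷ P ∷ []))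
        (+-cong (sym (prodTo-suc n inverseFactor)) (-‿cong (trans (*-congʳ (inverse-law n)) (*-identityˡ P)))))
      (O-*ˡ _ (O-^ x-O (suc n)))
      where
      I = inverseFactor (suc n)
      P = prodTo n inverseFactor

    f-limit : ∀ n → f ℓ ≈[ suc n ] partialProduct x n
    f-limit n = ≈[]-trans (diagonal-limit {λ N → prodTo N factor} product-step n) (≈⇒≈[] (product≈ n))

    f-inverse : f ℓ * fInv ℓ ≈ 1#
    f-inverse = ≈[]-separated (λ n → ≈[]-weaken (ℕ.n≤1+n n)
      (≈[]-trans (*-cong[] (f-limit n) (diagonal-limit {λ N → prodTo N inverseFactor} inverse-step n)) (≈⇒≈[] (product-inverse n))))

    seriesEulerProduct : EulerProduct seriesFilteredRing ℓ
    seriesEulerProduct = record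
      { x = x ; x-O = x-O ; D-x = D-δ ℓ ; inv = inverseFactor ; inv-law = inverse-law
      ; f = f ℓ ; f⁻ = fInv ℓ ; f-inv = f-inverse ; f-limit = f-limit }

-- From the invariant monomials to the congruences.

open SeriesEulerProducts using (seriesEulerProduct; δ-⊠; scalar-*; coefficient-·)
open import Data.Nat using (_+_; _*_)
open import Data.Integer.Divisibility using (_∣_)

module 𝓢 = FilteredRing seriesFilteredRing

module Series₂ = LevelTwo (seriesEulerProduct 0) (seriesEulerProduct 1) (𝓢.sym (≗⇒≈ˢ (δ-⊠ 1 1)))

pow≈^ : ∀ s k → pow s k 𝓢.≈ s 𝓢.^ k
pow≈^ s zero    = 𝓢.refl
pow≈^ s (suc k) = 𝓢.trans (𝓢.reflexive (≡.sym (⊠≡⊛ s (pow s k)))) (𝓢.*-congˡ (pow≈^ s k))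

-- Writing the residue of k as `suc b` lets the truncated subtraction k ∸ 1 reduce to 11 j + b.
a≈monomial : ∀ j b c → c + suc b ≡ 11 →
  a (11 * j + suc b) 𝓢.≈ Series₂.monomial (f 2 𝓢.^ j 𝓢.* fInv 1 𝓢.^ suc j) c b
a≈monomial j b c eq = 𝓢.trans (𝓢.reflexive (≡.sym (⊠≡⊛ (pow (f 2) (11 * j + suc b ℕ.∸ 1)) (pow (fInv 1) (11 * j + suc b)))))
  (𝓢.trans (𝓢.*-cong (pow≈^ (f 2) (11 * j + suc b ℕ.∸ 1)) (pow≈^ (fInv 1) (11 * j + suc b)))
  (𝓢.trans (𝓢.*-congʳ (𝓢.reflexive (≡.cong (λ m → f 2 𝓢.^ (m ℕ.∸ 1)) (ℕ.+-suc (11 * j) b))))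
  (Series₂.quotient≈monomial j c b (suc b) eq)))

shift-coefficient : ∀ e t n → (𝓢.D t 𝓢.+ e 𝓢.· 𝓢.1# 𝓢.* t) n ≋ (+ (n + e)) ℤ.* t n
shift-coefficient e t n = ≋-trans (_≈ˢ_.coefficient (𝓢.+-congˡ (scalar-* e t)) n)
  (≡⇒≋ (≡.trans (⊞-coefficient (∂ˢ t) (e 𝓢.· t) n) (≡.trans
    (≡.cong₂ ℤ._+_ (∂ˢ-coefficient t n) (coefficient-· e t n)) (≡.sym (ℤ.*-distribʳ-+ (t n) (+ n) (+ e))))))

-- The outermost D + e alone multiplies the coefficient at n by n + e, which is 0 modulo 11.
vanishing-coefficient : ∀ e {s} n → 𝓢.shifted e 10 s 𝓢.≈ s → 11 ℕ.∣ n + e → s n ≋ 0ℤ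
vanishing-coefficient e {s} n eq (ℕ.divides k n+e≡) = ≋-trans (≋-sym (_≈ˢ_.coefficient eq n))
  (≋-trans (shift-coefficient e (𝓢.shifted e 9 s) n) (congruent (∣-resp (≡.sym (ℤ.+-identityʳ _)) (∣m⇒∣m*n {m = + (n + e)} (𝓢.shifted e 9 s n) (∣ᵤ⇒∣ (ℕ.divides k n+e≡))))))

conclude : ∀ e {s t} n → s 𝓢.≈ t → 𝓢.shifted e 10 t 𝓢.≈ t → 11 ℕ.∣ n + e → (+ 11) ∣ s n
conclude e {s} {t} n s≈t inv div = ∣⇒∣ᵤ (∣-resp (ℤ.+-identityʳ (s n))
  (_≋_.difference (≋-trans (_≈ˢ_.coefficient s≈t n) (vanishing-coefficient e {t} n inv div))))

residue : ∀ n c e → c + e ≡ 11 → 11 ℕ.∣ 11 * n + c + e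
residue n c e eq = ℕ.divides (suc n) (≡.trans (ℕ.+-assoc (11 * n) c e) (≡.trans (≡.cong (ℕ._+_ (11 * n)) eq)
  (≡.trans (ℕ.+-comm (11 * n) 11) (≡.cong (ℕ._+_ 11) (ℕ.*-comm 11 n)))))

theorem9 : (j n : ℕ) →
    ((+ 11) ∣ a (11 * j + 1) (11 * n + 6)) ×
    ((+ 11) ∣ a (11 * j + 4) (11 * n + 10)) ×
    ((+ 11) ∣ a (11 * j + 6) (11 * n + 9)) ×
    ((+ 11) ∣ a (11 * j + 8) (11 * n + 8)) ×
    ((+ 11) ∣ a (11 * j + 11) (11 * n + 1))
theorem9 j n =
    -- For k = 11 j + r the monomial is f₁^(11-r) f₂^(r-1) up to an eleventh power; its q-exponent
    -- (9 + r) / 24 modulo 11 is e, and the coefficient that vanishes is at -e.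
    conclude 5  (11 * n + 6)  (a≈monomial j 0 10 ≡.refl) (Series₂.f₁¹⁰-invariant z)   (residue n 6 5 ≡.refl)
  , conclude 1  (11 * n + 10) (a≈monomial j 3 7 ≡.refl)  (Series₂.f₁⁷f₂³-invariant z) (residue n 10 1 ≡.refl)
  , conclude 2  (11 * n + 9)  (a≈monomial j 5 5 ≡.refl)  (Series₂.f₁⁵f₂⁵-invariant z) (residue n 9 2 ≡.refl)
  , conclude 3  (11 * n + 8)  (a≈monomial j 7 3 ≡.refl)  (Series₂.f₁³f₂⁷-invariant z) (residue n 8 3 ≡.refl)
  , conclude 10 (11 * n + 1)  (a≈monomial j 10 0 ≡.refl) (Series₂.f₂¹⁰-invariant z)   (residue n 1 10 ≡.refl)
  where
  z : Series
  z = f 2 𝓢.^ j 𝓢.* fInv 1 𝓢.^ suc j
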